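{- Let $q\in\mathbb{C}$ with $|q|<1$, $r\in\mathbb{N}$, $n\in\mathbb{Z}_{+}=\{0,1,2,\dots\}$, $x$ real with $x\neq0,-1,-2,\dots$, and let $\chi$ be a Dirichlet character with conductor $f\in\mathbb{N}$, $f$ odd. Then $$E_{n,\chi,q}^{(r)}(x)=[f]_q^n\left(\frac{[2]_q}{[2]_{q^f}}\right)^r\sum_{a_1,\dots,a_r=0}^{f-1}\left(\prod_{j=1}^r\chi(a_j)\right)(-1)^{\sum_{j=1}^r a_j}E_{n,q^f}^{(r)}\!\left(\frac{x+\sum_{j=1}^r a_j}{f}\right),$$ and $$E_{n,\chi,q}^{(r)}(x)=\frac{[2]_q^r}{(1-q)^n}\sum_{l=0}^{n}\binom{n}{l}(-q^x)^l\sum_{a_1,\dots,a_r=0}^{f-1}\frac{\left(\prod_{j=1}^r\chi(a_j)\right)(-q^l)^{\sum_{i=1}^r a_i}}{(1+q^{lf})^r}.$$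
   Context: For a complex number $q$ with $|q|<1$ and $x$ real, $[x]_q=\frac{1-q^x}{1-q}$ (so $[2]_q=1+q$). For $r\in\mathbb{N}$, the $q$-Euler polynomials of order $r$ are defined by $$[2]_q^r\sum_{m_1,\dots,m_r=0}^{\infty}(-1)^{m_1+\cdots+m_r}e^{[m_1+\cdots+m_r+x]_q t}=\sum_{n=0}^{\infty}E_{n,q}^{(r)}(x)\frac{t^n}{n!},$$ with $E_{n,q^f}^{(r)}$ the same with $q$ replaced by $q^f$. The generalized $q$-Euler polynomials of order $r$ attached to $\chi$ are defined by $$[2]_q^r\sum_{m_1,\dots,m_r=0}^{\infty}(-1)^{m_1+\cdots+m_r}\left(\prod_{j=1}^r\chi(m_j)\right)e^{[x+m_1+\cdots+m_r]_q t}=\sum_{n=0}^{\infty}E_{n,\chi,q}^{(r)}(x)\frac{t^n}{n!}.$$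
   Formalization: The defining series diverge as written and are read as Abel sums (limit s→1⁻ with factor s^(m1+…+mr)), coefficientwise in t; q^x means exp(x log q) for a chosen logarithm of q, so q ≠ 0, and q^f uses the logarithm f log q. -}

module Defs where

open import Algebra.Apartness.Bundles using (HeytingField)
open import Algebra.Bundles using (CommutativeRing)
import Algebra.Definitions.RawMonoid as RawMonoid
open import Algebra.Solver.Ring.AlmostCommutativeRing
  using (_-Raw-AlmostCommutative⟶_; fromCommutativeRing)
open import Data.Fin.Base using (toℕ; inject₁)
open import Data.Fin.Properties using (toℕ-inject₁; toℕ-fromℕ)
open import Data.Integer.Base as ℤ using (ℤ; +_; -[1+_])
import Data.Integer.Coprimality as ℤ
import Data.Integer.Divisibility as ℤ
import Data.Integer.Properties as ℤ
open import Data.Maybe.Base as Maybe using ()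
open import Data.Nat.Base as ℕ using (ℕ; zero; suc; NonZero; _!)
import Data.Nat.Divisibility as ℕ
import Data.Nat.Properties as ℕ
open import Data.Product.Base using (∃; _×_; _,_; proj₁; proj₂)
open import Data.Sum.Base as Sum using (_⊎_; inj₁; inj₂)
open import Data.Vec.Base as Vec using (Vec; []; _∷_)
open import Function.Base using (_∘_)
open import Level using (_⊔_)
open import Relation.Binary.PropositionalEquality.Core as ≡ using (_≡_)
open import Relation.Binary.Structures using (IsStrictPartialOrder)
open import Relation.Nullary.Decidable using (dec⇒maybe)
open import Relation.Nullary.Negation using (¬_; contradiction)

-- The real numbers, as an arbitrary Cauchy-complete Archimedean ordered field.
-- Classically ℝ is, up to isomorphism, the only one; apartness x # y is then x ≠ y.

record CompleteOrderedField c ℓ₁ ℓ₂ : Set (Level.suc (c ⊔ ℓ₁ ⊔ ℓ₂)) where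
  field
    heytingField : HeytingField c ℓ₁ ℓ₂

  open HeytingField heytingField public

  commutativeRing : CommutativeRing c ℓ₁
  commutativeRing = record { isCommutativeRing = isCommutativeRing }

  fromℕ : ℕ → Carrier
  fromℕ n = RawMonoid._×_ (CommutativeRing.+-rawMonoid commutativeRing) n 1#

  infix 4 _<_
  field
    _<_                  : Carrier → Carrier → Set ℓ₂
    isStrictPartialOrder : IsStrictPartialOrder _≈_ _<_
    #⇒<⊎>                : ∀ {x y} → x # y → x < y ⊎ y < x
    <⇒#                  : ∀ {x y} → x < y → x # y
    0<1                  : 0# < 1#
    +-monoˡ-<            : ∀ z {x y} → x < y → x + z < y + z
    *-pos                : ∀ {x y} → 0# < x → 0# < y → 0# < x * y
    archimedean          : ∀ x → ∃ λ n → x < fromℕ n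

  infix 4 ∣_∣<_
  ∣_∣<_ : Carrier → Carrier → Set ℓ₂
  ∣ x ∣< b = (- b < x) × (x < b)

  IsCauchy : (ℕ → Carrier) → Set (c ⊔ ℓ₂)
  IsCauchy u = ∀ ε → 0# < ε →
    ∃ λ N → ∀ m n → N ℕ.≤ m → N ℕ.≤ n → ∣ u m - u n ∣< ε

  _⟶_ : (ℕ → Carrier) → Carrier → Set (c ⊔ ℓ₂)
  u ⟶ L = ∀ ε → 0# < ε → ∃ λ N → ∀ n → N ℕ.≤ n → ∣ u n - L ∣< ε

  field
    complete : ∀ u → IsCauchy u → ∃ λ L → u ⟶ L

-- Algebra.Solver.Ring with integer coefficients, for an arbitrary commutative ring.

module IntegerSolver {c ℓ} (R : CommutativeRing c ℓ) where

  open CommutativeRing R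
  open import Algebra.Properties.Semiring.Mult semiring
    renaming (_×_ to _×ₙ_)
  open import Algebra.Properties.Ring ring
  open import Algebra.Properties.AbelianGroup +-abelianGroup using (⁻¹-∙-comm)
  open import Relation.Binary.Reasoning.Setoid setoid

  -- Chosen so that the coefficients 0 and 1 denote 0# and 1# definitionally.
  ι : ℕ → Carrier
  ι zero          = 0#
  ι (suc zero)    = 1#
  ι (suc (suc n)) = 1# + ι (suc n)

  ι≈× : ∀ n → ι n ≈ n ×ₙ 1#
  ι≈× zero          = refl
  ι≈× (suc zero)    = sym (+-identityʳ 1#)
  ι≈× (suc (suc n)) = +-congˡ (ι≈× (suc n))

  ⟦_⟧ℤ : ℤ → Carrier
  ⟦ + n ⟧ℤ      = ι n
  ⟦ -[1+ n ] ⟧ℤ = - ι (suc n)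

  private
    cancel : ∀ x y z → (x + y) - (x + z) ≈ y - z
    cancel x y z = begin
      (x + y) - (x + z)      ≈⟨ +-cong (+-comm x y) (sym (⁻¹-∙-comm x z)) ⟩
      (y + x) + (- x - z)    ≈⟨ +-assoc y x _ ⟩
      y + (x + (- x - z))    ≈⟨ +-congˡ (sym (+-assoc x (- x) _)) ⟩
      y + ((x - x) - z)      ≈⟨ +-congˡ (+-congʳ (-‿inverseʳ x)) ⟩
      y + (0# - z)           ≈⟨ +-congˡ (+-identityˡ _) ⟩
      y - z                  ∎

    ι-homo-+ : ∀ m n → ι (m ℕ.+ n) ≈ ι m + ι n
    ι-homo-+ m n = begin
      ι (m ℕ.+ n)          ≈⟨ ι≈× (m ℕ.+ n) ⟩
      (m ℕ.+ n) ×ₙ 1#      ≈⟨ ×-homo-+ 1# m n ⟩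
      m ×ₙ 1# + n ×ₙ 1#    ≈⟨ +-cong (ι≈× m) (ι≈× n) ⟨
      ι m + ι n            ∎

    ι-suc : ∀ n → ι (suc n) ≈ 1# + ι n
    ι-suc n = ι-homo-+ 1 n

    ι-homo-* : ∀ m n → ι (m ℕ.* n) ≈ ι m * ι n
    ι-homo-* m n = begin
      ι (m ℕ.* n)          ≈⟨ ι≈× (m ℕ.* n) ⟩
      (m ℕ.* n) ×ₙ 1#      ≈⟨ ×1-homo-* m n ⟩
      m ×ₙ 1# * n ×ₙ 1#    ≈⟨ *-cong (ι≈× m) (ι≈× n) ⟨
      ι m * ι n            ∎

    ⊖-homo : ∀ m n → ⟦ m ℤ.⊖ n ⟧ℤ ≈ ι m - ι n
    ⊖-homo zero    zero    = sym (-‿inverseʳ 0#)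
    ⊖-homo zero    (suc n) = sym (+-identityˡ _)
    ⊖-homo (suc m) zero    = sym (trans (+-congˡ -0#≈0#) (+-identityʳ _))
    ⊖-homo (suc m) (suc n) = begin
      ⟦ suc m ℤ.⊖ suc n ⟧ℤ       ≡⟨ ≡.cong ⟦_⟧ℤ (ℤ.[1+m]⊖[1+n]≡m⊖n m n) ⟩
      ⟦ m ℤ.⊖ n ⟧ℤ               ≈⟨ ⊖-homo m n ⟩
      ι m - ι n                  ≈⟨ cancel 1# _ _ ⟨
      (1# + ι m) - (1# + ι n)    ≈⟨ +-cong (ι-suc m) (-‿cong (ι-suc n)) ⟨
      ι (suc m) - ι (suc n)      ∎

    +-homo : ∀ i j → ⟦ i ℤ.+ j ⟧ℤ ≈ ⟦ i ⟧ℤ + ⟦ j ⟧ℤ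
    +-homo (+ m)      (+ n)      = ι-homo-+ m n
    +-homo (+ m)      -[1+ n ]   = ⊖-homo m (suc n)
    +-homo -[1+ m ]   (+ n)      = trans (⊖-homo n (suc m)) (+-comm _ _)
    +-homo -[1+ m ]   -[1+ n ]   = begin
      - ι (suc (suc (m ℕ.+ n)))       ≡⟨ ≡.cong (λ k → - ι (suc k)) (ℕ.+-suc m n) ⟨
      - ι (suc m ℕ.+ suc n)           ≈⟨ -‿cong (ι-homo-+ (suc m) (suc n)) ⟩
      - (ι (suc m) + ι (suc n))       ≈⟨ ⁻¹-∙-comm _ _ ⟨
      - ι (suc m) - ι (suc n)         ∎

    -‿homo : ∀ i → ⟦ ℤ.- i ⟧ℤ ≈ - ⟦ i ⟧ℤ
    -‿homo (+ zero)  = sym -0#≈0#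
    -‿homo (+ suc n) = refl
    -‿homo -[1+ n ]  = sym (-‿involutive _)

    *-homo⁺ : ∀ m j → ⟦ + m ℤ.* j ⟧ℤ ≈ ⟦ + m ⟧ℤ * ⟦ j ⟧ℤ
    *-homo⁺ m (+ n)    = begin
      ⟦ + m ℤ.* + n ⟧ℤ       ≡⟨ ≡.cong ⟦_⟧ℤ (ℤ.pos-* m n) ⟨
      ι (m ℕ.* n)            ≈⟨ ι-homo-* m n ⟩
      ι m * ι n              ∎
    *-homo⁺ m -[1+ n ] = begin
      ⟦ + m ℤ.* -[1+ n ] ⟧ℤ           ≡⟨ ≡.cong ⟦_⟧ℤ (ℤ.neg-distribʳ-* (+ m) (+ suc n)) ⟨
      ⟦ ℤ.- (+ m ℤ.* + suc n) ⟧ℤ      ≈⟨ -‿homo (+ m ℤ.* + suc n) ⟩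
      - ⟦ + m ℤ.* + suc n ⟧ℤ          ≈⟨ -‿cong (*-homo⁺ m (+ suc n)) ⟩
      - (ι m * ι (suc n))             ≈⟨ -‿distribʳ-* _ _ ⟩
      ι m * - ι (suc n)               ∎

    *-homo : ∀ i j → ⟦ i ℤ.* j ⟧ℤ ≈ ⟦ i ⟧ℤ * ⟦ j ⟧ℤ
    *-homo (+ m)    j = *-homo⁺ m j
    *-homo -[1+ m ] j = begin
      ⟦ -[1+ m ] ℤ.* j ⟧ℤ             ≡⟨ ≡.cong ⟦_⟧ℤ (ℤ.neg-distribˡ-* (+ suc m) j) ⟨
      ⟦ ℤ.- (+ suc m ℤ.* j) ⟧ℤ        ≈⟨ -‿homo (+ suc m ℤ.* j) ⟩
      - ⟦ + suc m ℤ.* j ⟧ℤ            ≈⟨ -‿cong (*-homo⁺ (suc m) j) ⟩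
      - (⟦ + suc m ⟧ℤ * ⟦ j ⟧ℤ)       ≈⟨ -‿distribˡ-* _ _ ⟩
      - ⟦ + suc m ⟧ℤ * ⟦ j ⟧ℤ         ∎

  morphism : ℤ.+-*-rawRing -Raw-AlmostCommutative⟶ fromCommutativeRing R
  morphism = record
    { ⟦_⟧    = ⟦_⟧ℤ
    ; +-homo = +-homo
    ; *-homo = *-homo
    ; -‿homo = -‿homo
    ; 0-homo = refl
    ; 1-homo = refl
    }

  open import Algebra.Solver.Ring ℤ.+-*-rawRing (fromCommutativeRing R) morphism
    (λ i j → Maybe.map (reflexive ∘ ≡.cong ⟦_⟧ℤ) (dec⇒maybe (i ℤ.≟ j)))
    public

module OrderedFieldProperties {c ℓ₁ ℓ₂} (R : CompleteOrderedField c ℓ₁ ℓ₂) where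

  open CompleteOrderedField R
  open IsStrictPartialOrder isStrictPartialOrder public
    using (<-respˡ-≈; <-respʳ-≈)
    renaming (trans to <-trans; irrefl to <-irrefl; asym to <-asym)
  open IntegerSolver commutativeRing using (solve; _:=_; _:+_; _:*_; _:-_; :-_; con)
  open import Algebra.Properties.Ring (CommutativeRing.ring commutativeRing)
    using (-‿distribʳ-*)

  <-resp-≈₂ : ∀ {x x′ y y′} → x ≈ x′ → y ≈ y′ → x < y → x′ < y′
  <-resp-≈₂ p q = <-respˡ-≈ p ∘ <-respʳ-≈ q

  diff⇒< : ∀ {x y d} → 0# < d → d ≈ y - x → x < y
  diff⇒< {x} {y} {d} 0<d d≈ = <-resp-≈₂ (+-identityˡ x)
    (trans (+-congʳ d≈) (solve 2 (λ y x → y :- x :+ x := y) refl y x))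
    (+-monoˡ-< x 0<d)

  <⇒diff : ∀ {x y} → x < y → 0# < y - x
  <⇒diff {x} x<y = <-respˡ-≈ (-‿inverseʳ x) (+-monoˡ-< (- x) x<y)

  +-pos : ∀ {x y} → 0# < x → 0# < y → 0# < x + y
  +-pos {x} {y} 0<x 0<y = <-trans 0<y (<-respˡ-≈ (+-identityˡ y) (+-monoˡ-< y 0<x))

  +-mono-< : ∀ {x y u v} → x < y → u < v → x + u < y + v
  +-mono-< {x} {y} {u} {v} x<y u<v = diff⇒< (+-pos (<⇒diff x<y) (<⇒diff u<v))
    (solve 4 (λ x y u v → (y :- x) :+ (v :- u) := (y :+ v) :- (x :+ u)) refl x y u v)

  neg-pos : ∀ {x} → x < 0# → 0# < - x
  neg-pos {x} x<0 = <-respʳ-≈ (+-identityˡ _) (<⇒diff x<0)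

  pos-neg : ∀ {x} → 0# < x → - x < 0#
  pos-neg {x} 0<x = diff⇒< 0<x (solve 1 (λ x → x := con (+ 0) :- (:- x)) refl x)

  *-monoˡ-< : ∀ {z x y} → 0# < z → x < y → z * x < z * y
  *-monoˡ-< {z} {x} {y} 0<z x<y = diff⇒< (*-pos 0<z (<⇒diff x<y))
    (solve 3 (λ z x y → z :* (y :- x) := z :* y :- z :* x) refl z x y)

  <-cotrans : ∀ {x y} → x < y → ∀ z → x < z ⊎ z < y
  <-cotrans x<y z with #-cotrans (<⇒# x<y) z
  ... | inj₁ x#z = Sum.[ inj₁ , (λ z<x → inj₂ (<-trans z<x x<y)) ] (#⇒<⊎> x#z)
  ... | inj₂ z#y = Sum.[ inj₂ , (λ y<z → inj₁ (<-trans x<y y<z)) ] (#⇒<⊎> z#y)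

  halve-pos : ∀ {x} → 0# < x + x → 0# < x
  halve-pos {x} 0<2x with <-cotrans 0<2x x
  ... | inj₁ 0<x  = 0<x
  ... | inj₂ x<2x = <-respʳ-≈ (solve 1 (λ x → (x :+ x) :- x := x) refl x) (<⇒diff x<2x)

  recip : ∀ x → x # 0# → Carrier
  recip x x#0 = proj₁ (#⇒invertible x#0)

  recip-inverseˡ : ∀ x (x#0 : x # 0#) → recip x x#0 * x ≈ 1#
  recip-inverseˡ x x#0 = trans
    (*-congˡ (solve 1 (λ x → x := x :- con (+ 0)) refl x))
    (proj₁ (proj₂ (#⇒invertible x#0)))

  *≈1⇒#0 : ∀ {x y} → x * y ≈ 1# → y # 0#
  *≈1⇒#0 {x} {y} xy≈1 = invertible⇒# (x , trans (*-congˡ y-0≈y) xy≈1 ,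
    trans (*-congʳ y-0≈y) (trans (*-comm y x) xy≈1))
    where
    y-0≈y : y - 0# ≈ y
    y-0≈y = solve 1 (λ y → y :- con (+ 0) := y) refl y

  *#0⇒#0ʳ : ∀ {x y} → x * y # 0# → y # 0#
  *#0⇒#0ʳ {x} {y} xy#0 = *≈1⇒#0 (trans (*-assoc (recip (x * y) xy#0) x y) (recip-inverseˡ (x * y) xy#0))

  >⇒# : ∀ {x y} → y < x → x # y
  >⇒# = #-sym ∘ <⇒#

  *-cancelˡ-pos : ∀ {x y} → 0# < x → 0# < x * y → 0# < y
  *-cancelˡ-pos {x} {y} 0<x 0<xy with #⇒<⊎> (*#0⇒#0ʳ (>⇒# 0<xy))
  ... | inj₂ 0<y = 0<y
  ... | inj₁ y<0 = contradiction
    (+-pos 0<xy (*-pos 0<x (neg-pos y<0)))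
    (<-irrefl (solve 2 (λ x y → con (+ 0) := x :* y :+ x :* (:- y)) refl x y))

  *-cancelˡ-< : ∀ {z x y} → 0# < z → z * x < z * y → x < y
  *-cancelˡ-< {z} {x} {y} 0<z zx<zy = diff⇒< (*-cancelˡ-pos 0<z (<-respʳ-≈
    (solve 3 (λ z x y → z :* y :- z :* x := z :* (y :- x)) refl z x y) (<⇒diff zx<zy))) refl

  recip-pos : ∀ {x} (x#0 : x # 0#) → 0# < x → 0# < recip x x#0
  recip-pos {x} x#0 0<x = *-cancelˡ-pos 0<x
    (<-respʳ-≈ (sym (trans (*-comm x _) (recip-inverseˡ x x#0))) 0<1)

  square-nonneg : ∀ x → ¬ (x * x < 0#)
  square-nonneg x x²<0 with #⇒<⊎> (*#0⇒#0ʳ (<⇒# x²<0))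
  ... | inj₂ 0<x = <-asym x²<0 (*-pos 0<x 0<x)
  ... | inj₁ x<0 = <-asym x²<0 (<-respʳ-≈
    (solve 1 (λ x → (:- x) :* (:- x) := x :* x) refl x) (*-pos (neg-pos x<0) (neg-pos x<0)))

  pos+nonneg : ∀ {x y} → 0# < x → ¬ (y < 0#) → 0# < x + y
  pos+nonneg {x} {y} 0<x y≮0 with <-cotrans (pos-neg 0<x) y
  ... | inj₂ y<0  = contradiction y<0 y≮0
  ... | inj₁ -x<y = <-respʳ-≈ (solve 2 (λ x y → y :- (:- x) := x :+ y) refl x y) (<⇒diff -x<y)

  nonneg+nonneg : ∀ {x y} → ¬ (x < 0#) → ¬ (y < 0#) → ¬ (x + y < 0#)
  nonneg+nonneg {x} {y} x≮0 y≮0 x+y<0 with <-cotrans x+y<0 y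
  ... | inj₂ y<0   = y≮0 y<0
  ... | inj₁ x+y<y = x≮0 (diff⇒< (<⇒diff x+y<y)
    (solve 2 (λ x y → y :- (x :+ y) := con (+ 0) :- x) refl x y))

  ∣∣<⇒pos : ∀ {x b} → ∣ x ∣< b → 0# < b
  ∣∣<⇒pos {x} {b} (-b<x , x<b) = halve-pos (<-respʳ-≈
    (solve 1 (λ b → b :- (:- b) := b :+ b) refl b) (<⇒diff (<-trans -b<x x<b)))

  ∣∣<-resp-≈ : ∀ {x y b} → x ≈ y → ∣ x ∣< b → ∣ y ∣< b
  ∣∣<-resp-≈ x≈y (l , u) = <-respʳ-≈ x≈y l , <-respˡ-≈ x≈y u

  ∣∣<-trans : ∀ {x b b′} → ∣ x ∣< b → b < b′ → ∣ x ∣< b′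
  ∣∣<-trans {x} {b} {b′} (l , u) b<b′ =
    <-trans (diff⇒< (<⇒diff b<b′) (solve 2 (λ b b′ → b′ :- b := (:- b) :- (:- b′)) refl b b′)) l ,
    <-trans u b<b′

  ∣∣<-+ : ∀ {x y a b} → ∣ x ∣< a → ∣ y ∣< b → ∣ x + y ∣< a + b
  ∣∣<-+ {x} {y} {a} {b} (l , u) (l′ , u′) =
    <-respˡ-≈ (solve 2 (λ a b → (:- a) :+ (:- b) := :- (a :+ b)) refl a b) (+-mono-< l l′) ,
    +-mono-< u u′

  ∣∣<-neg : ∀ {x b} → ∣ x ∣< b → ∣ - x ∣< b
  ∣∣<-neg {x} {b} (l , u) =
    diff⇒< (<⇒diff u) (solve 2 (λ x b → b :- x := (:- x) :- (:- b)) refl x b) ,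
    diff⇒< (<⇒diff l) (solve 2 (λ x b → x :- (:- b) := b :- (:- x)) refl x b)

  ∣∣<-* : ∀ {x y a b} → ∣ x ∣< a → ∣ y ∣< b → ∣ x * y ∣< a * b
  ∣∣<-* {x} {y} {a} {b} (l , u) (l′ , u′) =
    diff⇒< (halve-pos (<-respʳ-≈
      (solve 4 (λ x y a b → (a :- x) :* (b :- y) :+ (x :- (:- a)) :* (y :- (:- b))
        := (x :* y :- (:- (a :* b))) :+ (x :* y :- (:- (a :* b)))) refl x y a b)
      (+-pos (*-pos (<⇒diff u) (<⇒diff u′)) (*-pos (<⇒diff l) (<⇒diff l′))))) refl ,
    diff⇒< (halve-pos (<-respʳ-≈
      (solve 4 (λ x y a b → (a :- x) :* (y :- (:- b)) :+ (x :- (:- a)) :* (b :- y)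
        := (a :* b :- x :* y) :+ (a :* b :- x :* y)) refl x y a b)
      (+-pos (*-pos (<⇒diff u) (<⇒diff l′)) (*-pos (<⇒diff l) (<⇒diff u′))))) refl

  ∣∣<-scale : ∀ {s x b} → 0# < s → ∣ x ∣< b → ∣ s * x ∣< s * b
  ∣∣<-scale {s} {x} {b} 0<s (l , u) =
    <-respˡ-≈ (sym (-‿distribʳ-* s b)) (*-monoˡ-< 0<s l) , *-monoˡ-< 0<s u

  x<1+x : ∀ x → x < 1# + x
  x<1+x x = diff⇒< 0<1 (solve 1 (λ x → con (+ 1) := (con (+ 1) :+ x) :- x) refl x)

  fromℕ-pos : ∀ n → 0# < fromℕ (suc n)
  fromℕ-pos zero    = x<1+x 0#
  fromℕ-pos (suc n) = <-trans (fromℕ-pos n) (x<1+x _)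

  fromℕ#0 : ∀ n .{{_ : NonZero n}} → fromℕ n # 0#
  fromℕ#0 (suc n) = >⇒# (fromℕ-pos n)

  <fromℕ-+ : ∀ {x n} k → x < fromℕ n → x < fromℕ (k ℕ.+ n)
  <fromℕ-+ zero    p = p
  <fromℕ-+ (suc k) p = <-trans (<fromℕ-+ k p) (x<1+x _)

  bounded : ∀ x → ∃ λ n → ∣ x ∣< fromℕ n
  bounded x with archimedean x | archimedean (- x)
  ... | m , x<m | n , -x<n = m ℕ.+ n ,
    diff⇒< (<⇒diff (<fromℕ-+ m -x<n))
      (solve 2 (λ x b → b :- (:- x) := x :- (:- b)) refl x (fromℕ (m ℕ.+ n))) ,
    ≡.subst (λ k → x < fromℕ k) (ℕ.+-comm n m) (<fromℕ-+ n x<m)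

  -- A majorant whose terms eventually more than halve gives a Cauchy sequence.

  module Majorised (b : ℕ → Carrier) (0<b : ∀ n → 0# < b n)
    (K : ℕ) (halving : ∀ j → b (suc (j ℕ.+ K)) + b (suc (j ℕ.+ K)) < b (j ℕ.+ K)) where

    private
      3b : Carrier → Carrier
      3b x = x + x + x

      decay : ∀ j → fromℕ (suc (suc j)) * b (j ℕ.+ K) < 3b (b K)
      decay zero = diff⇒< (0<b K)
        (solve 1 (λ x → x := (x :+ x :+ x) :- (con (+ 1) :+ (con (+ 1) :+ con (+ 0))) :* x) refl (b K))
      decay (suc j) = <-trans
        (diff⇒< (+-pos (*-pos (fromℕ-pos (suc j)) (<⇒diff (halving j))) (*-pos (fromℕ-pos j) (0<b (suc (j ℕ.+ K)))))
          (solve 3 (λ n x y → (con (+ 1) :+ n) :* (x :- (y :+ y)) :+ n :* y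
              := (con (+ 1) :+ n) :* x :- (con (+ 1) :+ (con (+ 1) :+ n)) :* y)
            refl (fromℕ (suc j)) (b (j ℕ.+ K)) (b (suc (j ℕ.+ K)))))
        (decay j)

      triple-< : ∀ {x y} → x < y → 3b x < 3b y
      triple-< p = +-mono-< (+-mono-< p p) p

      factor : ∀ n x → 3b (n * x) + 3b (n * x) ≈ n * (3b x + 3b x)
      factor n x = solve 2 (λ n x →
        (n :* x :+ n :* x :+ n :* x) :+ (n :* x :+ n :* x :+ n :* x)
          := n :* ((x :+ x :+ x) :+ (x :+ x :+ x))) refl n x

      small : ∀ ε → 0# < ε → ∃ λ j → 3b (b (j ℕ.+ K)) + 3b (b (j ℕ.+ K)) < ε
      small ε 0<ε with archimedean (recip ε (>⇒# 0<ε) * (3b (3b (b K)) + 3b (3b (b K))))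
      ... | j , C/ε<j = j , *-cancelˡ-< (fromℕ-pos (suc j)) (<-trans
        (<-respˡ-≈ (factor _ _) (+-mono-< (triple-< (decay j)) (triple-< (decay j))))
        (<-resp-≈₂
          (trans (sym (*-assoc _ _ _)) (trans (*-congʳ (trans (*-comm _ _) (recip-inverseˡ ε _))) (*-identityˡ _)))
          (*-comm ε _)
          (*-monoˡ-< 0<ε (<-trans C/ε<j (<-trans (x<1+x _) (x<1+x _))))))

    module _ (u : ℕ → Carrier) (step : ∀ n → ∣ u (suc n) - u n ∣< b n) where

      private
        tail : ∀ i j → ∣ u (j ℕ.+ (i ℕ.+ K)) - u (i ℕ.+ K) ∣<
                       (3b (b (i ℕ.+ K)) - (b (j ℕ.+ (i ℕ.+ K)) + b (j ℕ.+ (i ℕ.+ K))))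
        tail i zero = ∣∣<-resp-≈ (sym (-‿inverseʳ _)) (pos-neg 0<b′ , 0<b′)
          where
          0<b′ = <-respʳ-≈ (solve 1 (λ x → x := (x :+ x :+ x) :- (x :+ x)) refl (b (i ℕ.+ K))) (0<b (i ℕ.+ K))
        tail i (suc j) = ∣∣<-trans
          (∣∣<-resp-≈
            (solve 3 (λ x y z → (y :- z) :+ (x :- y) := x :- z) refl
              (u (suc (j ℕ.+ (i ℕ.+ K)))) (u (j ℕ.+ (i ℕ.+ K))) (u (i ℕ.+ K)))
            (∣∣<-+ (tail i j) (step (j ℕ.+ (i ℕ.+ K)))))
          (diff⇒< (<⇒diff halving′)
            (solve 3 (λ x y z → x :- (y :+ y) := (z :- (y :+ y)) :- ((z :- (x :+ x)) :+ x)) refl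
              (b (j ℕ.+ (i ℕ.+ K))) (b (suc (j ℕ.+ (i ℕ.+ K)))) (3b (b (i ℕ.+ K)))))
          where
          halving′ : b (suc (j ℕ.+ (i ℕ.+ K))) + b (suc (j ℕ.+ (i ℕ.+ K))) < b (j ℕ.+ (i ℕ.+ K))
          halving′ = ≡.subst (λ k → b (suc k) + b (suc k) < b k) (ℕ.+-assoc j i K) (halving (j ℕ.+ i))

        tail′ : ∀ i m → i ℕ.+ K ℕ.≤ m → ∣ u m - u (i ℕ.+ K) ∣< 3b (b (i ℕ.+ K))
        tail′ i m i+K≤m = ≡.subst (λ k → ∣ u k - u (i ℕ.+ K) ∣< 3b (b (i ℕ.+ K)))
          (ℕ.m∸n+n≡m i+K≤m)
          (∣∣<-trans (tail i (m ℕ.∸ (i ℕ.+ K)))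
            (diff⇒< (+-pos (0<b k) (0<b k))
              (solve 2 (λ x y → x :+ x := y :- (y :- (x :+ x))) refl (b k) (3b (b (i ℕ.+ K))))))
          where
          k = m ℕ.∸ (i ℕ.+ K) ℕ.+ (i ℕ.+ K)

      isCauchy : IsCauchy u
      isCauchy ε 0<ε = i ℕ.+ K , λ m n N≤m N≤n → ∣∣<-trans
        (∣∣<-resp-≈ (regroup (u m) (u n) (u (i ℕ.+ K)))
          (∣∣<-+ (tail′ i m N≤m) (∣∣<-neg (tail′ i n N≤n))))
        (proj₂ (small ε 0<ε))
        where
        i = proj₁ (small ε 0<ε)

        regroup : ∀ x y z → (x - z) + (- (y - z)) ≈ x - y
        regroup = solve 3 (λ x y z → (x :- z) :+ (:- (y :- z)) := x :- y) refl

module ComplexNumbers {c ℓ₁ ℓ₂} (R : CompleteOrderedField c ℓ₁ ℓ₂) where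

  module ℝ where
    open CompleteOrderedField R public
    open OrderedFieldProperties R public
    open import Algebra.Properties.Semiring.Exp (CommutativeRing.semiring commutativeRing) public
      using (_^_)
    open IntegerSolver commutativeRing public
      using (solve; _:=_; _:+_; _:*_; _:-_; :-_; con)

  ℝ : Set c
  ℝ = ℝ.Carrier

  -- No η and copattern definitions: operations on ℂ then unfold only under re and im.
  record ℂ : Set c where
    no-eta-equality
    field
      re im : ℝ

  open ℂ public

  infix 4 _≈ᶜ_
  record _≈ᶜ_ (z w : ℂ) : Set ℓ₁ where
    constructor _,_
    field
      re≈ : re z ℝ.≈ re w
      im≈ : im z ℝ.≈ im w

  open _≈ᶜ_ public

  private
    _+ᶜ_ _*ᶜ_ : ℂ → ℂ → ℂ
    re (z +ᶜ w) = re z ℝ.+ re w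
    im (z +ᶜ w) = im z ℝ.+ im w
    re (z *ᶜ w) = re z ℝ.* re w ℝ.- im z ℝ.* im w
    im (z *ᶜ w) = re z ℝ.* im w ℝ.+ im z ℝ.* re w

    -ᶜ_ : ℂ → ℂ
    re (-ᶜ z) = ℝ.- re z
    im (-ᶜ z) = ℝ.- im z

  ofReal : ℝ → ℂ
  re (ofReal x) = x
  im (ofReal x) = ℝ.0#

  private
    0ᶜ 1ᶜ : ℂ
    0ᶜ = ofReal ℝ.0#
    1ᶜ = ofReal ℝ.1#

  ℂ-commutativeRing : CommutativeRing c ℓ₁
  ℂ-commutativeRing = record
    { Carrier = ℂ
    ; _≈_     = _≈ᶜ_
    ; _+_     = _+ᶜ_
    ; _*_     = _*ᶜ_
    ; -_      = -ᶜ_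
    ; 0#      = 0ᶜ
    ; 1#      = 1ᶜ
    ; isCommutativeRing = record
      { isRing = record
        { +-isAbelianGroup = record
          { isGroup = record
            { isMonoid = record
              { isSemigroup = record
                { isMagma = record
                  { isEquivalence = record
                    { refl  = ℝ.refl , ℝ.refl
                    ; sym   = λ p → ℝ.sym (re≈ p) , ℝ.sym (im≈ p)
                    ; trans = λ p q → ℝ.trans (re≈ p) (re≈ q) , ℝ.trans (im≈ p) (im≈ q)
                    }
                  ; ∙-cong = λ p q → ℝ.+-cong (re≈ p) (re≈ q) , ℝ.+-cong (im≈ p) (im≈ q)
                  }
                ; assoc = λ x y z → ℝ.+-assoc _ _ _ , ℝ.+-assoc _ _ _
                }
              ; identity = (λ x → ℝ.+-identityˡ _ , ℝ.+-identityˡ _)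
                         , (λ x → ℝ.+-identityʳ _ , ℝ.+-identityʳ _)
              }
            ; inverse = (λ x → ℝ.-‿inverseˡ _ , ℝ.-‿inverseˡ _)
                      , (λ x → ℝ.-‿inverseʳ _ , ℝ.-‿inverseʳ _)
            ; ⁻¹-cong = λ p → ℝ.-‿cong (re≈ p) , ℝ.-‿cong (im≈ p)
            }
          ; comm = λ x y → ℝ.+-comm _ _ , ℝ.+-comm _ _
          }
        ; *-cong = λ p q →
            ℝ.+-cong (ℝ.*-cong (re≈ p) (re≈ q)) (ℝ.-‿cong (ℝ.*-cong (im≈ p) (im≈ q))) ,
            ℝ.+-cong (ℝ.*-cong (re≈ p) (im≈ q)) (ℝ.*-cong (im≈ p) (re≈ q))
        ; *-assoc = λ x y z →
            assoc-re (re x) (im x) (re y) (im y) (re z) (im z) ,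
            assoc-im (re x) (im x) (re y) (im y) (re z) (im z)
        ; *-identity = (λ x → idˡ-re (re x) (im x) , idˡ-im (re x) (im x))
                     , (λ x → idʳ-re (re x) (im x) , idʳ-im (re x) (im x))
        ; distrib = (λ x y z →
              distribˡ-re (re x) (im x) (re y) (im y) (re z) (im z) ,
              distribˡ-im (re x) (im x) (re y) (im y) (re z) (im z))
          , (λ x y z →
              distribʳ-re (re x) (im x) (re y) (im y) (re z) (im z) ,
              distribʳ-im (re x) (im x) (re y) (im y) (re z) (im z))
        }
      ; *-comm = λ x y →
          ℝ.+-cong (ℝ.*-comm _ _) (ℝ.-‿cong (ℝ.*-comm _ _)) ,
          ℝ.trans (ℝ.+-comm _ _) (ℝ.+-cong (ℝ.*-comm _ _) (ℝ.*-comm _ _))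
      }
    }
    where
    open CompleteOrderedField R using (_≈_; _+_; _*_; _-_; 0#; 1#)
    open IntegerSolver ℝ.commutativeRing

    assoc-re : ∀ a b c d e f →
      (a * c - b * d) * e - (a * d + b * c) * f ≈ a * (c * e - d * f) - b * (c * f + d * e)
    assoc-re = solve 6 (λ a b c d e f →
      (a :* c :- b :* d) :* e :- (a :* d :+ b :* c) :* f
        := a :* (c :* e :- d :* f) :- b :* (c :* f :+ d :* e)) ℝ.refl

    assoc-im : ∀ a b c d e f →
      (a * c - b * d) * f + (a * d + b * c) * e ≈ a * (c * f + d * e) + b * (c * e - d * f)
    assoc-im = solve 6 (λ a b c d e f →
      (a :* c :- b :* d) :* f :+ (a :* d :+ b :* c) :* e
        := a :* (c :* f :+ d :* e) :+ b :* (c :* e :- d :* f)) ℝ.refl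

    distribˡ-re : ∀ a b c d e f →
      a * (c + e) - b * (d + f) ≈ (a * c - b * d) + (a * e - b * f)
    distribˡ-re = solve 6 (λ a b c d e f →
      a :* (c :+ e) :- b :* (d :+ f) := (a :* c :- b :* d) :+ (a :* e :- b :* f)) ℝ.refl

    distribˡ-im : ∀ a b c d e f →
      a * (d + f) + b * (c + e) ≈ (a * d + b * c) + (a * f + b * e)
    distribˡ-im = solve 6 (λ a b c d e f →
      a :* (d :+ f) :+ b :* (c :+ e) := (a :* d :+ b :* c) :+ (a :* f :+ b :* e)) ℝ.refl

    distribʳ-re : ∀ a b c d e f →
      (c + e) * a - (d + f) * b ≈ (c * a - d * b) + (e * a - f * b)
    distribʳ-re = solve 6 (λ a b c d e f →
      (c :+ e) :* a :- (d :+ f) :* b := (c :* a :- d :* b) :+ (e :* a :- f :* b)) ℝ.refl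

    distribʳ-im : ∀ a b c d e f →
      (c + e) * b + (d + f) * a ≈ (c * b + d * a) + (e * b + f * a)
    distribʳ-im = solve 6 (λ a b c d e f →
      (c :+ e) :* b :+ (d :+ f) :* a := (c :* b :+ d :* a) :+ (e :* b :+ f :* a)) ℝ.refl

    idˡ-re : ∀ a b → 1# * a - 0# * b ≈ a
    idˡ-re = solve 2 (λ a b → con (+ 1) :* a :- con (+ 0) :* b := a) ℝ.refl

    idˡ-im : ∀ a b → 1# * b + 0# * a ≈ b
    idˡ-im = solve 2 (λ a b → con (+ 1) :* b :+ con (+ 0) :* a := b) ℝ.refl

    idʳ-re : ∀ a b → a * 1# - b * 0# ≈ a
    idʳ-re = solve 2 (λ a b → a :* con (+ 1) :- b :* con (+ 0) := a) ℝ.refl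

    idʳ-im : ∀ a b → a * 0# + b * 1# ≈ b
    idʳ-im = solve 2 (λ a b → a :* con (+ 0) :+ b :* con (+ 1) := b) ℝ.refl

  open CommutativeRing ℂ-commutativeRing public
    hiding (Carrier; isEquivalence)
  open import Algebra.Properties.Semiring.Exp semiring public using (_^_)
  open import Algebra.Properties.Semiring.Sum semiring public
    using (sum; sum-syntax; sum⁺-syntax; sum-init-last; sum-cong-≗)
  open import Algebra.Properties.Semiring.Mult semiring public
    using () renaming (_×_ to _×ₙ_)

  infixr 7 _·_
  _·_ : ℝ → ℂ → ℂ
  re (x · z) = x ℝ.* re z
  im (x · z) = x ℝ.* im z

  -- ∣ z ∣² < b²; this is ∣ z ∣ < b only for 0 < b.
  normSq : ℂ → ℝ
  normSq z = re z ℝ.* re z ℝ.+ im z ℝ.* im z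

  infix 4 ∣_∣<_
  ∣_∣<_ : ℂ → ℝ → Set ℓ₂
  ∣ z ∣< b = normSq z ℝ.< b ℝ.* b

  NonZeroᶜ : ℂ → Set ℓ₂
  NonZeroᶜ z = ℝ.0# ℝ.< normSq z

  inv : ∀ z → NonZeroᶜ z → ℂ
  re (inv z z≠0) = ℝ.recip (normSq z) (ℝ.>⇒# z≠0) ℝ.* re z
  im (inv z z≠0) = ℝ.recip (normSq z) (ℝ.>⇒# z≠0) ℝ.* ℝ.- im z

  infixl 7 _/_[_]
  _/_[_] : ∀ (w z : ℂ) → NonZeroᶜ z → ℂ
  w / z [ z≠0 ] = w * inv z z≠0

  infixl 7 _/ℕ_
  _/ℕ_ : ℂ → (k : ℕ) .{{_ : NonZero k}} → ℂ
  z /ℕ k = ℝ.recip (ℝ.fromℕ k) (ℝ.fromℕ#0 k) · z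

  normSq-* : ∀ z w → normSq (z * w) ℝ.≈ normSq z ℝ.* normSq w
  normSq-* z w = ℝ.solve 4 (λ a b c d →
    let p = a ℝ.:* c ℝ.:- b ℝ.:* d
        q = a ℝ.:* d ℝ.:+ b ℝ.:* c
    in p ℝ.:* p ℝ.:+ q ℝ.:* q ℝ.:= (a ℝ.:* a ℝ.:+ b ℝ.:* b) ℝ.:* (c ℝ.:* c ℝ.:+ d ℝ.:* d))
    ℝ.refl (re z) (im z) (re w) (im w)

  normSq-nonneg : ∀ z → ¬ (normSq z ℝ.< ℝ.0#)
  normSq-nonneg z = ℝ.nonneg+nonneg (ℝ.square-nonneg (re z)) (ℝ.square-nonneg (im z))

  NonZeroᶜ-^ : ∀ z n → NonZeroᶜ z → NonZeroᶜ (z ^ n)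
  NonZeroᶜ-^ z zero    z≠0 = ℝ.<-respʳ-≈
    (ℝ.solve 0 (ℝ.con (+ 1) ℝ.:= ℝ.con (+ 1) ℝ.:* ℝ.con (+ 1) ℝ.:+ ℝ.con (+ 0) ℝ.:* ℝ.con (+ 0)) ℝ.refl)
    ℝ.0<1
  NonZeroᶜ-^ z (suc n) z≠0 =
    ℝ.<-respʳ-≈ (ℝ.sym (normSq-* z (z ^ n))) (ℝ.*-pos z≠0 (NonZeroᶜ-^ z n z≠0))

  private
    normSq-bound : ∀ z → ∣ z ∣< ℝ.1# → ℝ.∣ normSq z ∣< ℝ.1#
    normSq-bound z z<1 = lower , ℝ.<-respʳ-≈ (ℝ.*-identityˡ ℝ.1#) z<1
      where
      lower : ℝ.- ℝ.1# ℝ.< normSq z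
      lower with ℝ.<-cotrans (ℝ.pos-neg ℝ.0<1) (normSq z)
      ... | inj₁ p = p
      ... | inj₂ p = contradiction p (normSq-nonneg z)

  ∣∣<1-* : ∀ z w → ∣ z ∣< ℝ.1# → ∣ w ∣< ℝ.1# → ∣ z * w ∣< ℝ.1#
  ∣∣<1-* z w z<1 w<1 = ℝ.<-respˡ-≈ (ℝ.sym (normSq-* z w))
    (proj₂ (ℝ.∣∣<-* (normSq-bound z z<1) (normSq-bound w w<1)))

  ∣∣<1-^ : ∀ z n .{{_ : NonZero n}} → ∣ z ∣< ℝ.1# → ∣ z ^ n ∣< ℝ.1#
  ∣∣<1-^ z (suc zero)    z<1 = ℝ.<-respˡ-≈
    (ℝ.solve 2 (λ a b → a ℝ.:* a ℝ.:+ b ℝ.:* b ℝ.:=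
      (a ℝ.:* ℝ.con (+ 1) ℝ.:- b ℝ.:* ℝ.con (+ 0)) ℝ.:* (a ℝ.:* ℝ.con (+ 1) ℝ.:- b ℝ.:* ℝ.con (+ 0))
      ℝ.:+ (a ℝ.:* ℝ.con (+ 0) ℝ.:+ b ℝ.:* ℝ.con (+ 1)) ℝ.:* (a ℝ.:* ℝ.con (+ 0) ℝ.:+ b ℝ.:* ℝ.con (+ 1)))
      ℝ.refl (re z) (im z))
    z<1
  ∣∣<1-^ z (suc (suc n)) z<1 = ∣∣<1-* z (z ^ suc n) z<1 (∣∣<1-^ z (suc n) z<1)

  1+≠0 : ∀ z → ∣ z ∣< ℝ.1# → NonZeroᶜ (1# + z)
  1+≠0 z z<1 = ℝ.pos+nonneg (ℝ.*-pos 0<1+a 0<1+a) (ℝ.square-nonneg (im (1# + z)))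
    where
    a = re z

    normSq<1 = proj₂ (normSq-bound z z<1)

    a²<1 : a ℝ.* a ℝ.< ℝ.1#
    a²<1 with ℝ.<-cotrans normSq<1 (a ℝ.* a)
    ... | inj₂ p = p
    ... | inj₁ p = contradiction
      (ℝ.diff⇒< (ℝ.<⇒diff p) (ℝ.solve 2 (λ x y → x ℝ.:- (x ℝ.:+ y) ℝ.:= ℝ.con (+ 0) ℝ.:- y) ℝ.refl _ _))
      (ℝ.square-nonneg (im z))

    0<1+a : ℝ.0# ℝ.< ℝ.1# ℝ.+ a
    0<1+a with ℝ.<-cotrans (ℝ.pos-neg ℝ.0<1) a
    ... | inj₁ -1<a = ℝ.<-respʳ-≈
      (ℝ.solve 1 (λ a → a ℝ.:- (ℝ.:- ℝ.con (+ 1)) ℝ.:= ℝ.con (+ 1) ℝ.:+ a) ℝ.refl a) (ℝ.<⇒diff -1<a)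
    ... | inj₂ a<0  = ℝ.*-cancelˡ-pos (ℝ.+-pos ℝ.0<1 (ℝ.neg-pos a<0))
      (ℝ.<-respʳ-≈
        (ℝ.solve 1 (λ a → ℝ.con (+ 1) ℝ.:- a ℝ.:* a ℝ.:=
          (ℝ.con (+ 1) ℝ.:+ (ℝ.:- a)) ℝ.:* (ℝ.con (+ 1) ℝ.:+ a)) ℝ.refl a)
        (ℝ.<⇒diff a²<1))

  1-≠0 : ∀ z → ∣ z ∣< ℝ.1# → NonZeroᶜ (1# - z)
  1-≠0 z z<1 = 1+≠0 (- z) (ℝ.<-respˡ-≈
    (ℝ.solve 2 (λ a b → a ℝ.:* a ℝ.:+ b ℝ.:* b ℝ.:=
      (ℝ.:- a) ℝ.:* (ℝ.:- a) ℝ.:+ (ℝ.:- b) ℝ.:* (ℝ.:- b)) ℝ.refl (re z) (im z))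
    z<1)

  1+^≠0 : ∀ z n → ∣ z ∣< ℝ.1# → NonZeroᶜ (1# + z ^ n)
  1+^≠0 z zero    z<1 = ℝ.pos+nonneg (ℝ.*-pos 0<2 0<2) (ℝ.square-nonneg (im (1# + 1#)))
    where 0<2 = ℝ.+-pos ℝ.0<1 ℝ.0<1
  1+^≠0 z (suc n) z<1 = 1+≠0 (z ^ suc n) (∣∣<1-^ z (suc n) z<1)

  infixl 7 _/!_
  _/!_ : ℂ → ℕ → ℂ
  z /! k = (z /ℕ (k !)) {{k ℕ.!≢0}}

  private
    partialSum-suc : ∀ (u : ℕ → ℂ) n →
      ∑[ k < suc n ] u (toℕ k) ≈ ∑[ k < n ] u (toℕ k) + u n
    partialSum-suc u n = trans (sum-init-last (u ∘ toℕ)) (reflexive (≡.cong₂ _+_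
      (sum-cong-≗ {n} {λ k → u (toℕ (inject₁ k))} {u ∘ toℕ} (≡.cong u ∘ toℕ-inject₁))
      (≡.cong u (toℕ-fromℕ n))))

  module ExpSeries (z : ℂ) where

    term : ℕ → ℂ
    term k = z ^ k /! k

    partialSum : ℕ → ℂ
    partialSum n = ∑[ k < n ] term (toℕ k)

    M : ℕ
    M = proj₁ (ℝ.bounded (re z)) ℕ.+ proj₁ (ℝ.bounded (im z))

    m : ℝ
    m = ℝ.fromℕ M

    fromℕ-mono : ∀ {n} k → ∀ {x} → ℝ.∣ x ∣< ℝ.fromℕ n → ℝ.∣ x ∣< ℝ.fromℕ (k ℕ.+ n)
    fromℕ-mono zero    p = p
    fromℕ-mono (suc k) p = ℝ.∣∣<-trans (fromℕ-mono k p) (ℝ.x<1+x _)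

    re-bound : ℝ.∣ re z ∣< m
    re-bound = ≡.subst (λ k → ℝ.∣ re z ∣< ℝ.fromℕ k)
      (ℕ.+-comm (proj₁ (ℝ.bounded (im z))) (proj₁ (ℝ.bounded (re z))))
      (fromℕ-mono (proj₁ (ℝ.bounded (im z))) (proj₂ (ℝ.bounded (re z))))

    im-bound : ℝ.∣ im z ∣< m
    im-bound = fromℕ-mono (proj₁ (ℝ.bounded (re z))) (proj₂ (ℝ.bounded (im z)))

    0<m : ℝ.0# ℝ.< m
    0<m = ℝ.∣∣<⇒pos re-bound

    β : ℕ → ℝ
    β zero    = ℝ.1# ℝ.+ ℝ.1#
    β (suc k) = (m ℝ.+ m) ℝ.* β k

    0<2 : ℝ.0# ℝ.< ℝ.1# ℝ.+ ℝ.1#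
    0<2 = ℝ.+-pos ℝ.0<1 ℝ.0<1

    0<β : ∀ k → ℝ.0# ℝ.< β k
    0<β zero    = 0<2
    0<β (suc k) = ℝ.*-pos (ℝ.+-pos 0<m 0<m) (0<β k)

    ∣∣<-respʳ-≈ : ∀ {x b b′} → b ℝ.≈ b′ → ℝ.∣ x ∣< b → ℝ.∣ x ∣< b′
    ∣∣<-respʳ-≈ p (l , u) = ℝ.<-respˡ-≈ (ℝ.-‿cong p) l , ℝ.<-respʳ-≈ p u

    ^-bound : ∀ k → ℝ.∣ re (z ^ k) ∣< β k × ℝ.∣ im (z ^ k) ∣< β k
    ^-bound zero    = (ℝ.<-trans (ℝ.pos-neg 0<2) ℝ.0<1 , ℝ.x<1+x ℝ.1#)
                    , (ℝ.pos-neg 0<2 , 0<2)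
    ^-bound (suc k) =
      ∣∣<-respʳ-≈ (ℝ.sym (ℝ.distribʳ _ m m))
        (ℝ.∣∣<-+ (ℝ.∣∣<-* re-bound (proj₁ (^-bound k)))
                 (ℝ.∣∣<-neg (ℝ.∣∣<-* im-bound (proj₂ (^-bound k))))) ,
      ∣∣<-respʳ-≈ (ℝ.sym (ℝ.distribʳ _ m m))
        (ℝ.∣∣<-+ (ℝ.∣∣<-* re-bound (proj₂ (^-bound k)))
                 (ℝ.∣∣<-* im-bound (proj₁ (^-bound k))))

    e : ℕ → ℝ
    e k = ℝ.recip (ℝ.fromℕ (k !)) (ℝ.fromℕ#0 (k !) {{k ℕ.!≢0}})

    e-inverse : ∀ k → e k ℝ.* ℝ.fromℕ (k !) ℝ.≈ ℝ.1#
    e-inverse k = ℝ.recip-inverseˡ (ℝ.fromℕ (k !)) (ℝ.fromℕ#0 (k !) {{k ℕ.!≢0}})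

    0<fromℕ : ∀ n .{{_ : NonZero n}} → ℝ.0# ℝ.< ℝ.fromℕ n
    0<fromℕ (suc n) = ℝ.fromℕ-pos n

    0<e : ∀ k → ℝ.0# ℝ.< e k
    0<e k = ℝ.recip-pos (ℝ.fromℕ#0 (k !) {{k ℕ.!≢0}}) (0<fromℕ (k !) {{k ℕ.!≢0}})

    inverse-unique : ∀ {x r s} → r ℝ.* x ℝ.≈ ℝ.1# → s ℝ.* x ℝ.≈ ℝ.1# → r ℝ.≈ s
    inverse-unique {x} {r} {s} rx≈1 sx≈1 = begin
      r                ≈⟨ ℝ.*-identityʳ r ⟨
      r ℝ.* ℝ.1#       ≈⟨ ℝ.*-congˡ sx≈1 ⟨
      r ℝ.* (s ℝ.* x)  ≈⟨ ℝ.solve 3 (λ r s x → r ℝ.:* (s ℝ.:* x) ℝ.:= s ℝ.:* (r ℝ.:* x)) ℝ.refl r s x ⟩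
      s ℝ.* (r ℝ.* x)  ≈⟨ ℝ.*-congˡ rx≈1 ⟩
      s ℝ.* ℝ.1#       ≈⟨ ℝ.*-identityʳ s ⟩
      s                ∎
      where open import Relation.Binary.Reasoning.Setoid (CommutativeRing.setoid ℝ.commutativeRing)

    e-suc : ∀ k → ℝ.fromℕ (suc k) ℝ.* e (suc k) ℝ.≈ e k
    e-suc k = inverse-unique
      (ℝ.trans
        (ℝ.solve 3 (λ n e f → (n ℝ.:* e) ℝ.:* f ℝ.:= e ℝ.:* (n ℝ.:* f)) ℝ.refl
          (ℝ.fromℕ (suc k)) (e (suc k)) (ℝ.fromℕ (k !)))
        (ℝ.trans (ℝ.*-congˡ (ℝ.sym (×1-homo-* (suc k) (k !)))) (e-inverse (suc k))))
      (e-inverse k)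
      where open import Algebra.Properties.Semiring.Mult (CommutativeRing.semiring ℝ.commutativeRing)

    b : ℕ → ℝ
    b k = e k ℝ.* β k

    0<b : ∀ k → ℝ.0# ℝ.< b k
    0<b k = ℝ.*-pos (0<e k) (0<β k)

    b-suc : ∀ k → ℝ.fromℕ (suc k) ℝ.* b (suc k) ℝ.≈ (m ℝ.+ m) ℝ.* b k
    b-suc k = ℝ.trans
      (ℝ.solve 4 (λ n e s β → n ℝ.:* (e ℝ.:* (s ℝ.:* β)) ℝ.:= s ℝ.:* ((n ℝ.:* e) ℝ.:* β)) ℝ.refl
        (ℝ.fromℕ (suc k)) (e (suc k)) (m ℝ.+ m) (β k))
      (ℝ.*-congˡ (ℝ.*-congʳ (e-suc k)))

    L K : ℕ
    L = (M ℕ.+ M) ℕ.+ (M ℕ.+ M)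
    K = suc L

    fromℕ-L : ℝ.fromℕ L ℝ.≈ (m ℝ.+ m) ℝ.+ (m ℝ.+ m)
    fromℕ-L = ℝ.trans (×-homo-+ ℝ.1# (M ℕ.+ M) (M ℕ.+ M))
      (ℝ.+-cong (×-homo-+ ℝ.1# M M) (×-homo-+ ℝ.1# M M))
      where open import Algebra.Properties.Semiring.Mult (CommutativeRing.semiring ℝ.commutativeRing)

    halving : ∀ j → b (suc (j ℕ.+ K)) ℝ.+ b (suc (j ℕ.+ K)) ℝ.< b (j ℕ.+ K)
    halving j = ℝ.*-cancelˡ-< (ℝ.+-pos 0<m 0<m) (ℝ.<-resp-≈₂
      (double (b (suc (j ℕ.+ K))) (m ℝ.+ m))
      (ℝ.trans (ℝ.*-comm _ _) (b-suc (j ℕ.+ K)))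
      (ℝ.*-monoˡ-< (0<b (suc (j ℕ.+ K)))
        (ℝ.<-respˡ-≈ fromℕ-L (ℝ.<fromℕ-+ (suc j) (ℝ.x<1+x (ℝ.fromℕ L))))))
      where
      double : ∀ x s → x ℝ.* (s ℝ.+ s) ℝ.≈ s ℝ.* (x ℝ.+ x)
      double = ℝ.solve 2 (λ x s → x ℝ.:* (s ℝ.:+ s) ℝ.:= s ℝ.:* (x ℝ.:+ x)) ℝ.refl

    increment : ∀ {x y t} → x ℝ.≈ y ℝ.+ t → t ℝ.≈ x ℝ.- y
    increment {x} {y} {t} p = ℝ.trans
      (ℝ.solve 2 (λ y t → t ℝ.:= (y ℝ.:+ t) ℝ.:- y) ℝ.refl y t)
      (ℝ.+-congʳ (ℝ.sym p))

    re-isCauchy : ℝ.IsCauchy (re ∘ partialSum)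
    re-isCauchy = ℝ.Majorised.isCauchy b 0<b K halving (re ∘ partialSum) λ n →
      ℝ.∣∣<-resp-≈ (increment (re≈ (partialSum-suc term n))) (ℝ.∣∣<-scale (0<e n) (proj₁ (^-bound n)))

    im-isCauchy : ℝ.IsCauchy (im ∘ partialSum)
    im-isCauchy = ℝ.Majorised.isCauchy b 0<b K halving (im ∘ partialSum) λ n →
      ℝ.∣∣<-resp-≈ (increment (im≈ (partialSum-suc term n))) (ℝ.∣∣<-scale (0<e n) (proj₂ (^-bound n)))

  -- exp z = ∑ zᵏ / k!
  exp : ℂ → ℂ
  re (exp z) = proj₁ (ℝ.complete _ (ExpSeries.re-isCauchy z))
  im (exp z) = proj₁ (ℝ.complete _ (ExpSeries.im-isCauchy z))

module QEuler {c ℓ₁ ℓ₂} (R : CompleteOrderedField c ℓ₁ ℓ₂) where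

  open ComplexNumbers R public

  -- The index set of boxSum r N is {0, …, N - 1}ʳ.
  boxSum : ∀ r → ℕ → (Vec ℕ r → ℂ) → ℂ
  boxSum zero    N g = g []
  boxSum (suc r) N g = ∑[ m < N ] boxSum r N (λ ms → g (toℕ m ∷ ms))

  infixl 10 boxSum
  syntax boxSum r N (λ a → z) = ∑[ a <[ N ]^ r ] z

  ∏ : ∀ {r} → (ℕ → ℂ) → Vec ℕ r → ℂ
  ∏ u = Vec.foldr′ (λ m z → u m * z) 1#

  HasSum : ∀ r → (Vec ℕ r → ℂ) → ℂ → Set (c ⊔ ℓ₂)
  HasSum r g S = ∀ ε → ℝ.0# ℝ.< ε →
    ∃ λ N₀ → ∀ N → N₀ ℕ.≤ N → ∣ boxSum r N g - S ∣< ε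

  -- The series defining the q-Euler polynomials have terms of modulus bounded away
  -- from 0, so they do not converge; they are summed by Abel's method:
  -- ∑ g(m) = lim_{s → 1⁻} ∑ s^(m₁ + ⋯ + mᵣ) g(m).
  -- For s < 1 they converge absolutely, so the use of cubical partial sums is immaterial.
  record HasAbelSum r (g : Vec ℕ r → ℂ) (L : ℂ) : Set (c ⊔ ℓ₂) where
    field
      sumAt  : ∀ s → ℝ.0# ℝ.< s → s ℝ.< ℝ.1# → ℂ
      hasSum : ∀ s 0<s s<1 →
        HasSum r (λ m → (s ℝ.^ Vec.sum m) · g m) (sumAt s 0<s s<1)
      limit  : ∀ ε → ℝ.0# ℝ.< ε → ∃ λ δ → ℝ.0# ℝ.< δ ×
        (∀ s 0<s s<1 → ℝ.1# ℝ.- δ ℝ.< s → ∣ sumAt s 0<s s<1 - L ∣< ε)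

  -- Formal power series in t, as sequences of coefficients of tᵏ.
  PowerSeries : Set c
  PowerSeries = ℕ → ℂ

  infix 4 _≈ₚ_
  _≈ₚ_ : PowerSeries → PowerSeries → Set ℓ₁
  F ≈ₚ G = ∀ k → F k ≈ G k

  _*ₚ_ : ℂ → PowerSeries → PowerSeries
  (z *ₚ F) k = z * F k

  exp[_t] : ℂ → PowerSeries
  exp[ a t] k = a ^ k /! k

  egf : (ℕ → ℂ) → PowerSeries
  egf E k = E k /! k

  HasAbelSumₚ : ∀ r → (Vec ℕ r → PowerSeries) → PowerSeries → Set (c ⊔ ℓ₂)
  HasAbelSumₚ r g G = ∀ k → HasAbelSum r (λ m → g m k) (G k)

  -- Complex powers q^x = exp (x log q) depend on the choice of a logarithm of q, which is
  -- therefore part of the data. Replacing q by q^f replaces q^x by q^(f x), so that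
  -- log (q^f) is f log q and not, say, the principal value.
  record Base : Set (c ⊔ ℓ₂) where
    field
      q log-q : ℂ
      ∣q∣<1   : ∣ q ∣< ℝ.1#

  open Base public

  pow : Base → ℝ → ℂ
  pow B x = exp (x · log-q B)

  _^ᵇ_ : Base → (f : ℕ) .{{_ : NonZero f}} → Base
  B ^ᵇ f = record
    { q     = q B ^ f
    ; log-q = ℝ.fromℕ f · log-q B
    ; ∣q∣<1 = ∣∣<1-^ (q B) f (∣q∣<1 B)
    }

  [_]_ : ℝ → Base → ℂ
  [ x ] B = (1# - pow B x) / (1# - q B) [ 1-≠0 (q B) (∣q∣<1 B) ]

  -- [2]_q = (1 - q²) / (1 - q)
  [2]_ : Base → ℂ
  [2] B = 1# + q B

  [2]≠0 : ∀ B → NonZeroᶜ ([2] B)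
  [2]≠0 B = 1+≠0 (q B) (∣q∣<1 B)

  -- E k is the value at x of the k-th q-Euler polynomial of order r.
  IsEuler : Base → ∀ r → ℝ → (ℕ → ℂ) → Set (c ⊔ ℓ₁ ⊔ ℓ₂)
  IsEuler B r x E = ∃ λ G →
    HasAbelSumₚ r
      (λ m → ((- 1#) ^ Vec.sum m) *ₚ exp[ [ ℝ.fromℕ (Vec.sum m) ℝ.+ x ] B t]) G
    × ([2] B ^ r) *ₚ G ≈ₚ egf E

  IsGeneralizedEuler : Base → ∀ r → (ℤ → ℂ) → ℝ → (ℕ → ℂ) → Set (c ⊔ ℓ₁ ⊔ ℓ₂)
  IsGeneralizedEuler B r χ x E = ∃ λ G →
    HasAbelSumₚ r
      (λ m → ((- 1#) ^ Vec.sum m * ∏ (λ j → χ (+ j)) m)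
        *ₚ exp[ [ x ℝ.+ ℝ.fromℕ (Vec.sum m) ] B t]) G
    × ([2] B ^ r) *ₚ G ≈ₚ egf E

  record DirichletCharacter (N : ℕ) : Set (c ⊔ ℓ₁) where
    field
      χ            : ℤ → ℂ
      periodic     : ∀ a → χ (a ℤ.+ + N) ≈ χ a
      *-homo       : ∀ a b → χ (a ℤ.* b) ≈ χ a * χ b
      1-homo       : χ (+ 1) ≈ 1#
      coprime⇒≉0   : ∀ a → ℤ.Coprime a (+ N) → ¬ (χ a ≈ 0#)
      ¬coprime⇒≈0  : ∀ a → ¬ ℤ.Coprime a (+ N) → χ a ≈ 0#

    IsInducedModulus : ℕ → Set ℓ₁
    IsInducedModulus d = d ℕ.∣ N ×
      (∀ a → ℤ.Coprime a (+ N) → + d ℤ.∣ a ℤ.- + 1 → χ a ≈ 1#)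

    HasConductor : ℕ → Set ℓ₁
    HasConductor d = IsInducedModulus d × (∀ d′ → IsInducedModulus d′ → d ℕ.≤ d′)

  infixl 7 _/ʳ_
  _/ʳ_ : ℝ → (k : ℕ) .{{_ : NonZero k}} → ℝ
  x /ʳ k = x ℝ.* ℝ.recip (ℝ.fromℕ k) (ℝ.fromℕ#0 k)

{-# OPTIONS --safe #-}
module Submission where

-- By exp (z + w) = exp z exp w and the binomial theorem, [x + m₁ + ⋯ + mᵣ]ⁿ is a combination
-- of the powers q^(l (m₁ + ⋯ + mᵣ)), l ≤ n. The s-th Abel mean of the defining series is thus
-- a finite combination of r-th powers of series ∑ⱼ χ(j) (- s q^l)^j. By periodicity of χ and
-- oddness of f, such a series sums to (∑_{a < f} χ(a) (- s q^l)^a) / (1 + (s q^l)^f), which is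
-- continuous at s = 1. This gives the second formula; with the trivial character of conductor
-- 1 and base q^f it evaluates the q-Euler polynomials, whence the first formula.

open import Defs
open import Algebra.Bundles using (CommutativeRing)
open import Data.Fin.Base as Fin using (toℕ)
import Data.Fin.Properties as Fin
open import Data.Integer.Base using (ℤ; +_)
open import Data.Nat.Base as ℕ using (ℕ; zero; suc; NonZero; _!; z≤n; s≤s)
open import Data.Nat.Combinatorics using (_C_; nCk≡n!/k![n-k]!; k![n∸k]!∣n!)
open import Data.Nat.DivMod using (_%_; m%n<n; m≡m%n+[m/n]*n; m/n*n≡m) renaming (_/_ to _div_)
open import Data.Nat.Divisibility using (_∣_; divides; ∣1⇒≡1)
import Data.Nat.Properties as ℕ
open import Data.Product.Base using (∃; _×_; _,_; proj₁; proj₂)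
open import Data.Sum.Base using (inj₁; inj₂; [_,_])
open import Data.Vec.Base as Vec using (Vec; []; _∷_; sum)
open import Function.Base using (_∘_; const)
open import Level using (_⊔_)
open import Relation.Binary.PropositionalEquality.Core as ≡ using (_≡_)
open import Relation.Nullary.Negation using (¬_; contradiction)

-- The defining series diverge because q^0 = 1: the summands with l = 0 do not decay, and only the
-- factor s^(m₁ + ⋯ + mᵣ) makes them summable. Passing to s = 1 then needs a denominator that
-- survives there. The geometric argument yields 1 - (- s q^l)^f, which for odd f is 1 + (s q^l)^f
-- and tends to 2 at l = 0; for even f it would tend to 0. The polynomials are given by a relation,
-- not by a function, so both existence and uniqueness of Abel sums are required. Two kinds of limit
-- occur, N → ∞ inside and s → 1 outside, and one calculus over an arbitrary filter serves both. No
-- classical logic is assumed: case distinctions rest on cotransitivity of the order, two-sided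
-- strict bounds stand in for absolute values, and tightness of apartness gives uniqueness of
-- limits. The first identity is not obtained by resumming the series along residues mod f. Its two
-- sides are compared as finite sums, where passing from q to q^f and from x to (x + a) / f only
-- splits off a factor (q^l)^a.

module OrderedFieldLemmas {c ℓ₁ ℓ₂} (R : CompleteOrderedField c ℓ₁ ℓ₂) where

  open CompleteOrderedField R
  open OrderedFieldProperties R
  open IntegerSolver commutativeRing using (solve; _:=_; _:+_; _:*_; _:-_; :-_; con)
  open import Algebra.Properties.Semiring.Exp (CommutativeRing.semiring commutativeRing)
    using (_^_)
  open import Relation.Binary.Reasoning.Setoid (CommutativeRing.setoid commutativeRing)

  -- Halves, squares and powers in the ordered field

  2# : Carrier
  2# = 1# + 1#

  0<2 : 0# < 2#
  0<2 = +-pos 0<1 0<1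

  half : Carrier
  half = recip 2# (>⇒# 0<2)

  0<half : 0# < half
  0<half = recip-pos (>⇒# 0<2) 0<2

  half+half : ∀ x → half * x + half * x ≈ x
  half+half x = trans (solve 2 (λ h x → h :* x :+ h :* x := (h :* (con (+ 1) :+ con (+ 1))) :* x) refl half x)
    (trans (*-congʳ (recip-inverseˡ 2# _)) (*-identityˡ x))

  half<1 : half < 1#
  half<1 = diff⇒< 0<half (trans
    (solve 1 (λ y → y := (y :* con (+ 1) :+ y :* con (+ 1)) :- y) refl half)
    (+-congʳ (half+half 1#)))

  half*-pos : ∀ {x} → 0# < x → 0# < half * x
  half*-pos = *-pos 0<half

  half*-< : ∀ {x} → 0# < x → half * x < x
  half*-< {x} 0<x = diff⇒< (half*-pos 0<x) (trans
    (solve 1 (λ y → y := (y :+ y) :- y) refl (half * x)) (+-congʳ (half+half x)))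

  -- A minimum cannot be chosen without deciding the order. Cotransitivity places y relative to the
  -- gap between x/2 and x, and in either case x/2 or y/2 will do.
  common-lower-bound : ∀ {x y} → 0# < x → 0# < y → ∃ λ z → 0# < z × z < x × z < y
  common-lower-bound {x} {y} 0<x 0<y with <-cotrans (half*-< 0<x) y
  ... | inj₁ x/2<y = half * x , half*-pos 0<x , half*-< 0<x , x/2<y
  ... | inj₂ y<x   = half * y , half*-pos 0<y , <-trans (half*-< 0<y) y<x , half*-< 0<y

  recip-inverseʳ : ∀ x (x#0 : x # 0#) → x * recip x x#0 ≈ 1#
  recip-inverseʳ x x#0 = trans (*-comm _ _) (recip-inverseˡ x x#0)

  *-cancel-recip : ∀ x (x#0 : x # 0#) y → x * (recip x x#0 * y) ≈ y
  *-cancel-recip x x#0 y =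
    trans (sym (*-assoc _ _ _)) (trans (*-congʳ (recip-inverseʳ x x#0)) (*-identityˡ y))

  -- By tightness it is enough to refute `x # 0#`; each sign of x is refuted by taking ε to be x or
  -- - x.
  small⇒≈0 : ∀ {x} → (∀ ε → 0# < ε → ∣ x ∣< ε) → x ≈ 0#
  small⇒≈0 {x} small = tight x 0# .proj₁ λ x#0 → [ neg , pos ] (#⇒<⊎> x#0)
    where
    pos : ¬ (0# < x)
    pos 0<x = <-irrefl refl (proj₂ (small x 0<x))

    neg : ¬ (x < 0#)
    neg x<0 = <-irrefl (solve 1 (λ x → :- (:- x) := x) refl x) (proj₁ (small (- x) (neg-pos x<0)))

  ∣∣<-respʳ-≈ : ∀ {x b b′} → b ≈ b′ → ∣ x ∣< b → ∣ x ∣< b′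
  ∣∣<-respʳ-≈ p (l , u) = <-respˡ-≈ (-‿cong p) l , <-respʳ-≈ p u

  ∣0∣< : ∀ {b} → 0# < b → ∣ 0# ∣< b
  ∣0∣< 0<b = pos-neg 0<b , 0<b

  pos⇒∣∣< : ∀ {x b} → 0# < x → x < b → ∣ x ∣< b
  pos⇒∣∣< 0<x x<b = <-trans (pos-neg (<-trans 0<x x<b)) 0<x , x<b

  nonneg⇒∣∣< : ∀ {x b} → 0# < b → ¬ (x < 0#) → x < b → ∣ x ∣< b
  nonneg⇒∣∣< {x} 0<b x≮0 x<b with <-cotrans (pos-neg 0<b) x
  ... | inj₁ -b<x = -b<x , x<b
  ... | inj₂ x<0  = contradiction x<0 x≮0

  -- Cotransitivity at - b < 0: if - b < x, the positive factor x + b cancels from b² - x² = (x + b)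
  -- (b - x); otherwise x < 0 < b.
  square-<⇒< : ∀ {x b} → 0# < b → x * x < b * b → x < b
  square-<⇒< {x} {b} 0<b x²<b² with <-cotrans (pos-neg 0<b) x
  ... | inj₁ -b<x = diff⇒< (*-cancelˡ-pos
      (<⇒diff -b<x)
      (<-respʳ-≈ (solve 2 (λ x b → b :* b :- x :* x := (x :- (:- b)) :* (b :- x)) refl x b) (<⇒diff x²<b²)))
      refl
  ... | inj₂ x<0  = <-trans x<0 0<b

  square-<⇒∣∣< : ∀ {x b} → 0# < b → x * x < b * b → ∣ x ∣< b
  square-<⇒∣∣< {x} {b} 0<b x²<b² =
    diff⇒< (<⇒diff (square-<⇒< 0<b (<-respˡ-≈ (solve 1 (λ x → x :* x := (:- x) :* (:- x)) refl x) x²<b²)))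
      (solve 2 (λ x b → b :- (:- x) := x :- (:- b)) refl x b) ,
    square-<⇒< 0<b x²<b²

  ^-pos : ∀ {ρ} n → 0# < ρ → 0# < ρ ^ n
  ^-pos zero    0<ρ = 0<1
  ^-pos (suc n) 0<ρ = *-pos 0<ρ (^-pos n 0<ρ)

  -- The left-hand side is decreasing in n: this is Bernoulli's inequality for 1/ρ without division.
  ^-decay : ∀ {ρ} → 0# < ρ → ρ < 1# → ∀ n → ρ ^ n * (1# + fromℕ n * (1# - ρ)) < 2#
  ^-decay {ρ} 0<ρ ρ<1 zero = diff⇒< 0<1
    (solve 1 (λ ρ → con (+ 1) := (con (+ 1) :+ con (+ 1)) :- con (+ 1) :* (con (+ 1) :+ con (+ 0) :* (con (+ 1) :- ρ))) refl ρ)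
  ^-decay {ρ} 0<ρ ρ<1 (suc n) = <-trans
    (diff⇒< (*-pos (^-pos n 0<ρ) (*-pos (fromℕ-pos n) (*-pos (<⇒diff ρ<1) (<⇒diff ρ<1))))
      (solve 3 (λ ρ p n → p :* ((con (+ 1) :+ n) :* ((con (+ 1) :- ρ) :* (con (+ 1) :- ρ)))
         := p :* (con (+ 1) :+ n :* (con (+ 1) :- ρ)) :- (ρ :* p) :* (con (+ 1) :+ (con (+ 1) :+ n) :* (con (+ 1) :- ρ)))
        refl ρ (ρ ^ n) (fromℕ n)))
    (^-decay 0<ρ ρ<1 n)

  -- In this form the bound serves twice: it makes ρⁿ tend to 0, and it absorbs a factor linear in
  -- n.
  n*ρ^n-bound : ∀ {ρ} → 0# < ρ → ρ < 1# → ∀ n → fromℕ n * ρ ^ n * (1# - ρ) < 2#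
  n*ρ^n-bound {ρ} 0<ρ ρ<1 n = <-trans
    (diff⇒< (^-pos n 0<ρ) (solve 3 (λ ρ p n → p := p :* (con (+ 1) :+ n :* (con (+ 1) :- ρ)) :- n :* p :* (con (+ 1) :- ρ)) refl ρ (ρ ^ n) (fromℕ n)))
    (^-decay 0<ρ ρ<1 n)

-- Ev P says that P holds eventually; by witness, the filter is proper.

record Filter i e ℓ : Set (Level.suc (i ⊔ e ⊔ ℓ)) where
  field
    Index   : Set i
    Ev      : (Index → Set ℓ) → Set e
    always  : ∀ {P} → (∀ j → P j) → Ev P
    Ev-map₂ : ∀ {P Q S} → (∀ j → P j → Q j → S j) → Ev P → Ev Q → Ev S
    witness : ∀ {P} → Ev P → ∃ P

  Ev-map : ∀ {P Q} → (∀ j → P j → Q j) → Ev P → Ev Q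
  Ev-map f p = Ev-map₂ (λ j x _ → f j x) p p

-- Limits of real functions along a filter

module RealLimits {c ℓ₁ ℓ₂} (R : CompleteOrderedField c ℓ₁ ℓ₂) {i e} (𝓕 : Filter i e ℓ₂) where

  open CompleteOrderedField R
  open OrderedFieldProperties R
  open OrderedFieldLemmas R
  open Filter 𝓕
  open IntegerSolver commutativeRing using (solve; _:=_; _:+_; _:*_; _:-_; :-_; con)

  Lim : (Index → Carrier) → Carrier → Set (c ⊔ ℓ₂ ⊔ e)
  Lim F L = ∀ ε → 0# < ε → Ev λ j → ∣ F j - L ∣< ε

  EvBounded : (Index → Carrier) → Set (c ⊔ e)
  EvBounded F = ∃ λ b → Ev λ j → ∣ F j ∣< b

  Lim-cong : ∀ {F G L M} → (∀ j → F j ≈ G j) → L ≈ M → Lim F L → Lim G M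
  Lim-cong F≈G L≈M F→L ε 0<ε =
    Ev-map (λ j → ∣∣<-resp-≈ (+-cong (F≈G j) (-‿cong L≈M))) (F→L ε 0<ε)

  Lim-const : ∀ x → Lim (const x) x
  Lim-const x ε 0<ε = always λ _ → ∣∣<-resp-≈ (sym (-‿inverseʳ x)) (∣0∣< 0<ε)

  Lim-+ : ∀ {F G L M} → Lim F L → Lim G M → Lim (λ j → F j + G j) (L + M)
  Lim-+ {F} {G} {L} {M} F→L G→M ε 0<ε = Ev-map₂
    (λ j p q → ∣∣<-resp-≈
      (solve 4 (λ f g l m → (f :- l) :+ (g :- m) := (f :+ g) :- (l :+ m)) refl (F j) (G j) L M)
      (∣∣<-respʳ-≈ (half+half ε) (∣∣<-+ p q)))
    (F→L _ (half*-pos 0<ε)) (G→M _ (half*-pos 0<ε))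

  Lim-neg : ∀ {F L} → Lim F L → Lim (λ j → - F j) (- L)
  Lim-neg {F} {L} F→L ε 0<ε = Ev-map
    (λ j p → ∣∣<-resp-≈ (solve 2 (λ f l → :- (f :- l) := (:- f) :- (:- l)) refl (F j) L) (∣∣<-neg p))
    (F→L ε 0<ε)

  Lim⇒bounded : ∀ {F L} → Lim F L → EvBounded F
  Lim⇒bounded {F} {L} F→L = fromℕ (proj₁ (bounded L)) + 1# , Ev-map
    (λ j p → ∣∣<-resp-≈ (solve 2 (λ f l → l :+ (f :- l) := f) refl (F j) L) (∣∣<-+ (proj₂ (bounded L)) p))
    (F→L 1# 0<1)

  -- Kept apart from `Lim-*` for factors that are bounded without having a known limit, such as
  -- periodic ones.
  Lim-bounded-*-null : ∀ {F G} → EvBounded F → Lim G 0# → Lim (λ j → F j * G j) 0#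
  Lim-bounded-*-null {F} {G} (b , F<b) G→0 ε 0<ε = Ev-map₂
    (λ j p q → ∣∣<-resp-≈ (solve 2 (λ f g → f :* (g :- con (+ 0)) := f :* g :- con (+ 0)) refl (F j) (G j))
      (∣∣<-respʳ-≈ (*-cancel-recip b (>⇒# 0<b) ε) (∣∣<-* p q)))
    F<b (G→0 _ (*-pos (recip-pos (>⇒# 0<b) 0<b) 0<ε))
    where
    -- A two-sided strict bound is positive as soon as it holds at a single index, and a proper
    -- filter provides one.
    0<b : 0# < b
    0<b = ∣∣<⇒pos (proj₂ (witness F<b))

  Lim-diff : ∀ {F L} → Lim F L → Lim (λ j → F j - L) 0#
  Lim-diff {F} {L} F→L = Lim-cong (λ _ → refl) (-‿inverseʳ L) (Lim-+ F→L (Lim-const (- L)))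

  Lim-undiff : ∀ {F L} → Lim (λ j → F j - L) 0# → Lim F L
  Lim-undiff {F} {L} p = Lim-cong (λ j → solve 2 (λ f l → (f :- l) :+ l := f) refl (F j) L) (+-identityˡ L)
    (Lim-+ p (Lim-const L))

  Lim-* : ∀ {F G L M} → Lim F L → Lim G M → Lim (λ j → F j * G j) (L * M)
  Lim-* {F} {G} {L} {M} F→L G→M = Lim-undiff (Lim-cong
    (λ j → solve 4 (λ f g l m → f :* (g :- m) :+ m :* (f :- l) := f :* g :- l :* m) refl (F j) (G j) L M)
    (+-identityˡ 0#)
    (Lim-+ (Lim-bounded-*-null (Lim⇒bounded F→L) (Lim-diff G→M))
           (Lim-bounded-*-null (Lim⇒bounded (Lim-const M)) (Lim-diff F→L))))

  -- 1/F - 1/L = - 1/L · (1/F · (F - L)), where 1/F is eventually bounded by 2/L. Positive limits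
  -- suffice for squared moduli, to which complex inverses reduce.
  Lim-recip : ∀ {F L} (F#0 : ∀ j → F j # 0#) (L#0 : L # 0#) → 0# < L → Lim F L →
              Lim (λ j → recip (F j) (F#0 j)) (recip L L#0)
  Lim-recip {F} {L} F#0 L#0 0<L F→L = Lim-undiff (Lim-cong
    (λ j → identity (recip (F j) (F#0 j)) (recip L L#0) (F j) L
             (recip-inverseˡ (F j) (F#0 j)) (recip-inverseˡ L L#0))
    (zeroʳ (- recip L L#0))
    (Lim-* (Lim-const (- recip L L#0)) (Lim-bounded-*-null recip-bounded (Lim-diff F→L))))
    where
    identity : ∀ a b x y → a * x ≈ 1# → b * y ≈ 1# → - b * (a * (x - y)) ≈ a - b
    identity a b x y ax≈1 by≈1 = trans
      (solve 4 (λ a b x y → (:- b) :* (a :* (x :- y)) := a :* (b :* y) :- b :* (a :* x)) refl a b x y)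
      (+-cong (trans (*-congˡ by≈1) (*-identityʳ a)) (-‿cong (trans (*-congˡ ax≈1) (*-identityʳ b))))

    h#0 : half * L # 0#
    h#0 = >⇒# (half*-pos 0<L)

    recip-bound : ∀ {x} (x#0 : x # 0#) → ∣ x - L ∣< half * L → ∣ recip x x#0 ∣< recip (half * L) h#0
    recip-bound {x} x#0 (lower , _) = pos⇒∣∣< (recip-pos x#0 0<x)
      (*-cancelˡ-< (half*-pos 0<L) (<-respʳ-≈ (sym (recip-inverseʳ _ h#0))
        (<-resp-≈₂ (*-comm _ _) (recip-inverseˡ x x#0) (*-monoˡ-< (recip-pos x#0 0<x) h<x))))
      where
      h<x : half * L < x
      h<x = diff⇒< (<⇒diff lower) (trans
        (solve 3 (λ x l h → (x :- l) :- (:- h) := x :- (l :- h)) refl x L (half * L))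
        (+-congˡ (-‿cong (trans (+-congʳ (sym (half+half L)))
          (solve 1 (λ h → (h :+ h) :- h := h) refl (half * L))))))
      0<x : 0# < x
      0<x = <-trans (half*-pos 0<L) h<x

    recip-bounded : EvBounded (λ j → recip (F j) (F#0 j))
    recip-bounded = recip (half * L) h#0 , Ev-map (λ j → recip-bound (F#0 j)) (F→L _ (half*-pos 0<L))

  Lim-unique : ∀ {F L M} → Lim F L → Lim F M → L ≈ M
  Lim-unique {F} {L} {M} F→L F→M = trans
    (trans (solve 2 (λ l m → l := (l :- m) :+ m) refl L M) (+-congʳ (small⇒≈0 difference))) (+-identityˡ M)
    where
    difference : ∀ ε → 0# < ε → ∣ L - M ∣< ε
    difference ε 0<ε = proj₂ (witness (Ev-map₂
      (λ j p q → ∣∣<-resp-≈ (solve 3 (λ f l m → (:- (f :- l)) :+ (f :- m) := l :- m) refl (F j) L M)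
        (∣∣<-respʳ-≈ (half+half ε) (∣∣<-+ (∣∣<-neg p) q)))
      (F→L _ (half*-pos 0<ε)) (F→M _ (half*-pos 0<ε))))

-- `Ev` has the quantifiers of `_⟶_` and `HasSum`, so that completeness yields a `Lim` statement as
-- it stands.
atTop : ∀ {ℓ} → Filter _ ℓ ℓ
atTop = record
  { Index   = ℕ
  ; Ev      = λ P → ∃ λ N₀ → ∀ N → N₀ ℕ.≤ N → P N
  ; always  = λ p → 0 , λ N _ → p N
  ; Ev-map₂ = λ { f (M , p) (N , q) → M ℕ.⊔ N , λ j M⊔N≤j →
      f j (p j (ℕ.m⊔n≤o⇒m≤o M N M⊔N≤j)) (q j (ℕ.m⊔n≤o⇒n≤o M N M⊔N≤j)) }
  ; witness = λ { (N , p) → N , p N ℕ.≤-refl }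
  }

-- Left neighbourhoods of 1

module LeftOfOne {c ℓ₁ ℓ₂} (R : CompleteOrderedField c ℓ₁ ℓ₂) where

  open CompleteOrderedField R
  open OrderedFieldProperties R
  open OrderedFieldLemmas R
  open IntegerSolver commutativeRing using (solve; _:=_; _:+_; _:-_; :-_; con)

  -- The bounds on s are part of the point because `sumAt` depends on them.
  UnitInterval : Set (c ⊔ ℓ₂)
  UnitInterval = ∃ λ s → 0# < s × s < 1#

  private
    1-‿anti : ∀ {δ δ′} → δ < δ′ → 1# - δ′ < 1# - δ
    1-‿anti {δ} {δ′} p = diff⇒< (<⇒diff p) (solve 2 (λ x y → x :- y := (con (+ 1) :- y) :- (con (+ 1) :- x)) refl δ′ δ)

  leftOfOne : Filter (c ⊔ ℓ₂) (c ⊔ ℓ₂) ℓ₂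
  leftOfOne = record
    { Index   = UnitInterval
    ; Ev      = λ P → ∃ λ δ → 0# < δ × (∀ s 0<s s<1 → 1# - δ < s → P (s , 0<s , s<1))
    ; always  = λ p → 1# , 0<1 , λ s 0<s s<1 _ → p (s , 0<s , s<1)
    ; Ev-map₂ = λ { f (δ₁ , 0<δ₁ , p) (δ₂ , 0<δ₂ , q) →
        let δ , 0<δ , δ<δ₁ , δ<δ₂ = common-lower-bound 0<δ₁ 0<δ₂ in
        δ , 0<δ , λ s 0<s s<1 1-δ<s → f (s , 0<s , s<1)
          (p s 0<s s<1 (<-trans (1-‿anti δ<δ₁) 1-δ<s))
          (q s 0<s s<1 (<-trans (1-‿anti δ<δ₂) 1-δ<s)) }
    ; witness = λ { (δ , 0<δ , p) →
        let η , 0<η , η<δ , η<1 = common-lower-bound 0<δ 0<1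
            0<s = <⇒diff η<1
            s<1 = diff⇒< 0<η (solve 1 (λ x → x := con (+ 1) :- (con (+ 1) :- x)) refl η)
        in (1# - η , 0<s , s<1) , p (1# - η) 0<s s<1 (1-‿anti η<δ) }
    }

  open RealLimits R leftOfOne

  Lim-identity : Lim proj₁ 1#
  Lim-identity ε 0<ε = ε , 0<ε , λ s 0<s s<1 1-ε<s →
    diff⇒< (<⇒diff 1-ε<s) (solve 2 (λ s e → s :- (con (+ 1) :- e) := (s :- con (+ 1)) :- (:- e)) refl s ε) ,
    diff⇒< (+-pos (<⇒diff s<1) 0<ε) (solve 2 (λ s e → (con (+ 1) :- s) :+ e := e :- (s :- con (+ 1))) refl s ε)

-- Limits of complex functions

module ComplexLimits {c ℓ₁ ℓ₂} (R : CompleteOrderedField c ℓ₁ ℓ₂) {i e} (𝓕 : Filter i e ℓ₂) where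

  open ComplexNumbers R
  open OrderedFieldLemmas R
  open Filter 𝓕
  open RealLimits R 𝓕

  -- Coordinatewise, so that the real calculus applies directly; `Limᶜ⇒∣∣<` and `∣∣<⇒Limᶜ` translate
  -- to and from the modulus of the definitions.
  record Limᶜ (F : Index → ℂ) (L : ℂ) : Set (c ⊔ ℓ₂ ⊔ e) where
    constructor _,_
    field
      re-lim : Lim (re ∘ F) (re L)
      im-lim : Lim (im ∘ F) (im L)

  Limᶜ-cong : ∀ {F G L M} → (∀ j → F j ≈ G j) → L ≈ M → Limᶜ F L → Limᶜ G M
  Limᶜ-cong F≈G L≈M (p , p′) =
    Lim-cong (re≈ ∘ F≈G) (re≈ L≈M) p , Lim-cong (im≈ ∘ F≈G) (im≈ L≈M) p′

  Limᶜ-const : ∀ z → Limᶜ (const z) z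
  Limᶜ-const z = Lim-const (re z) , Lim-const (im z)

  Limᶜ-+ : ∀ {F G L M} → Limᶜ F L → Limᶜ G M → Limᶜ (λ j → F j + G j) (L + M)
  Limᶜ-+ (p , p′) (q , q′) = Lim-+ p q , Lim-+ p′ q′

  Limᶜ-neg : ∀ {F L} → Limᶜ F L → Limᶜ (λ j → - F j) (- L)
  Limᶜ-neg (p , p′) = Lim-neg p , Lim-neg p′

  Limᶜ-* : ∀ {F G L M} → Limᶜ F L → Limᶜ G M → Limᶜ (λ j → F j * G j) (L * M)
  Limᶜ-* (p , p′) (q , q′) =
    Lim-+ (Lim-* p q) (Lim-neg (Lim-* p′ q′)) , Lim-+ (Lim-* p q′) (Lim-* p′ q)

  Limᶜ-^ : ∀ {F L} n → Limᶜ F L → Limᶜ (λ j → F j ^ n) (L ^ n)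
  Limᶜ-^ zero    p = Limᶜ-const 1#
  Limᶜ-^ (suc n) p = Limᶜ-* p (Limᶜ-^ n p)

  Limᶜ-sum : ∀ {n} {F : Index → Fin.Fin n → ℂ} {L : Fin.Fin n → ℂ} →
             (∀ k → Limᶜ (λ j → F j k) (L k)) → Limᶜ (λ j → ∑[ k < n ] F j k) (∑[ k < n ] L k)
  Limᶜ-sum {zero}          p = Limᶜ-const 0#
  Limᶜ-sum {suc n} {F} {L} p = Limᶜ-+ (p Fin.zero)
    (Limᶜ-sum {n} {λ j k → F j (Fin.suc k)} {λ k → L (Fin.suc k)} (p ∘ Fin.suc))

  Limᶜ-bounded-*-null : ∀ {F G} → EvBounded (re ∘ F) → EvBounded (im ∘ F) →
                        Limᶜ G 0# → Limᶜ (λ j → F j * G j) 0#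
  Limᶜ-bounded-*-null b b′ (q , q′) =
    Lim-cong (λ _ → ℝ.refl) (ℝ.-‿inverseʳ ℝ.0#)
      (Lim-+ (Lim-bounded-*-null b q) (Lim-neg (Lim-bounded-*-null b′ q′))) ,
    Lim-cong (λ _ → ℝ.refl) (ℝ.+-identityʳ ℝ.0#)
      (Lim-+ (Lim-bounded-*-null b q′) (Lim-bounded-*-null b′ q))

  Limᶜ-inv : ∀ {F L} (F≠0 : ∀ j → NonZeroᶜ (F j)) (L≠0 : NonZeroᶜ L) → Limᶜ F L →
             Limᶜ (λ j → inv (F j) (F≠0 j)) (inv L L≠0)
  Limᶜ-inv F≠0 L≠0 (p , p′) = Lim-* recips p , Lim-* recips (Lim-neg p′)
    where
    recips = Lim-recip (ℝ.>⇒# ∘ F≠0) (ℝ.>⇒# L≠0) L≠0 (Lim-+ (Lim-* p p) (Lim-* p′ p′))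

  Limᶜ-unique : ∀ {F L M} → Limᶜ F L → Limᶜ F M → L ≈ M
  Limᶜ-unique (p , p′) (q , q′) = Lim-unique p q , Lim-unique p′ q′

  -- Coordinates within ε/2 give a squared distance below 2 (ε/2)², which is less than ε².
  Limᶜ⇒∣∣< : ∀ {F L} → Limᶜ F L → ∀ ε → ℝ.0# ℝ.< ε → Ev λ j → ∣ F j - L ∣< ε
  Limᶜ⇒∣∣< {F} {L} (p , p′) ε 0<ε = Ev-map₂ close (p _ (half*-pos 0<ε)) (p′ _ (half*-pos 0<ε))
    where
    η = half ℝ.* ε
    0<η = half*-pos 0<ε
    close : ∀ j → ℝ.∣ re (F j) ℝ.- re L ∣< η → ℝ.∣ im (F j) ℝ.- im L ∣< η → ∣ F j - L ∣< ε
    close j a b = ℝ.<-trans (ℝ.+-mono-< (proj₂ (ℝ.∣∣<-* a a)) (proj₂ (ℝ.∣∣<-* b b)))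
      (ℝ.diff⇒< (ℝ.*-pos (ℝ.+-pos 0<η 0<η) 0<η) (ℝ.trans
        (ℝ.solve 1 (λ h → (h ℝ.:+ h) ℝ.:* h ℝ.:= (h ℝ.:+ h) ℝ.:* (h ℝ.:+ h) ℝ.:- (h ℝ.:* h ℝ.:+ h ℝ.:* h)) ℝ.refl η)
        (ℝ.+-congʳ (ℝ.*-cong (half+half ε) (half+half ε)))))

  ∣∣<⇒Limᶜ : ∀ {F L} → (∀ ε → ℝ.0# ℝ.< ε → Ev λ j → ∣ F j - L ∣< ε) → Limᶜ F L
  ∣∣<⇒Limᶜ {F} {L} p =
    (λ ε 0<ε → Ev-map (λ j q → square-<⇒∣∣< 0<ε (drop-square _ _ q)) (p ε 0<ε)) ,
    (λ ε 0<ε → Ev-map (λ j q → square-<⇒∣∣< 0<ε (drop-square _ _ (ℝ.<-respˡ-≈ (ℝ.+-comm _ _) q))) (p ε 0<ε))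
    where
    drop-square : ∀ x y {b} → x ℝ.* x ℝ.+ y ℝ.* y ℝ.< b → x ℝ.* x ℝ.< b
    drop-square x y {b} q with ℝ.<-cotrans q (x ℝ.* x)
    ... | inj₂ r = r
    ... | inj₁ r = contradiction
      (ℝ.diff⇒< (ℝ.<⇒diff r)
        (ℝ.solve 2 (λ x y → x ℝ.:- (x ℝ.:+ y) ℝ.:= ℝ.con (+ 0) ℝ.:- y) ℝ.refl (x ℝ.* x) (y ℝ.* y)))
      (ℝ.square-nonneg y)

-- Geometric and periodic sequences

module Sequences {c ℓ₁ ℓ₂} (R : CompleteOrderedField c ℓ₁ ℓ₂) where

  open ComplexNumbers R
  open OrderedFieldLemmas R
  open RealLimits R atTop
  open ComplexLimits R atTop

  Lim-squeeze : ∀ {u v} → (∀ n → ℝ.∣ u n ∣< v n) → Lim v ℝ.0# → Lim u ℝ.0#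
  Lim-squeeze {u} {v} u<v v→0 ε 0<ε = proj₁ (v→0 ε 0<ε) , λ n N≤n → ℝ.∣∣<-resp-≈ (minus-0 (u n))
    (ℝ.∣∣<-trans (u<v n) (ℝ.<-respˡ-≈ (ℝ.sym (minus-0 (v n))) (proj₂ (proj₂ (v→0 ε 0<ε) n N≤n))))
    where
    minus-0 : ∀ x → x ℝ.≈ x ℝ.- ℝ.0#
    minus-0 = ℝ.solve 1 (λ x → x ℝ.:= x ℝ.:- ℝ.con (+ 0)) ℝ.refl

  archimedean-multiple : ∀ {a} → ℝ.0# ℝ.< a → ∀ b → ∃ λ N → ∀ n → N ℕ.≤ n → b ℝ.< a ℝ.* ℝ.fromℕ n
  archimedean-multiple {a} 0<a b = proj₁ N , λ n N≤n →
    ℝ.<-respˡ-≈ (*-cancel-recip a (ℝ.>⇒# 0<a) b) (ℝ.*-monoˡ-< 0<a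
      (≡.subst (λ k → b/a ℝ.< ℝ.fromℕ k) (ℕ.m∸n+n≡m N≤n) (ℝ.<fromℕ-+ (n ℕ.∸ proj₁ N) (proj₂ N))))
    where
    b/a : ℝ
    b/a = ℝ.recip a (ℝ.>⇒# 0<a) ℝ.* b

    N = ℝ.archimedean b/a

  Lim-ρ^n : ∀ {ρ} → ℝ.0# ℝ.< ρ → ρ ℝ.< ℝ.1# → Lim (ρ ℝ.^_) ℝ.0#
  Lim-ρ^n {ρ} 0<ρ ρ<1 ε 0<ε = proj₁ large , λ n N≤n → ℝ.∣∣<-resp-≈
    (ℝ.solve 1 (λ x → x ℝ.:= x ℝ.:- ℝ.con (+ 0)) ℝ.refl (ρ ℝ.^ n))
    (pos⇒∣∣< (^-pos n 0<ρ) (below n (proj₂ large n N≤n)))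
    where
    h : ℝ
    h = ℝ.1# ℝ.- ρ

    -- From this index on, ε (1 - ρ) n exceeds 2, hence exceeds n ρⁿ (1 - ρ); cancelling n (1 - ρ)
    -- leaves ρⁿ < ε.
    large = archimedean-multiple (ℝ.*-pos 0<ε (ℝ.<⇒diff ρ<1)) 2#

    assoc : ∀ n → (ε ℝ.* h) ℝ.* n ℝ.≈ (h ℝ.* n) ℝ.* ε
    assoc = ℝ.solve 3 (λ e h n → (e ℝ.:* h) ℝ.:* n ℝ.:= (h ℝ.:* n) ℝ.:* e) ℝ.refl ε h

    below : ∀ n → 2# ℝ.< (ε ℝ.* h) ℝ.* ℝ.fromℕ n → ρ ℝ.^ n ℝ.< ε
    below n 2<εhn = ℝ.*-cancelˡ-< 0<hn (ℝ.<-trans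
      (ℝ.<-respˡ-≈
        (ℝ.solve 3 (λ n p h → n ℝ.:* p ℝ.:* h ℝ.:= (h ℝ.:* n) ℝ.:* p) ℝ.refl (ℝ.fromℕ n) (ρ ℝ.^ n) h)
        (n*ρ^n-bound 0<ρ ρ<1 n))
      (ℝ.<-respʳ-≈ (assoc (ℝ.fromℕ n)) 2<εhn))
      where
      0<hn : ℝ.0# ℝ.< h ℝ.* ℝ.fromℕ n
      0<hn = ℝ.*-cancelˡ-pos 0<ε (ℝ.<-trans 0<2 (ℝ.<-respʳ-≈ (ℝ.*-assoc _ _ _) 2<εhn))

  Limᶜ-z^n : ∀ z → ∣ z ∣< ℝ.1# → Limᶜ (z ^_) 0#
  Limᶜ-z^n z ∣z∣<1 = ∣∣<⇒Limᶜ λ ε 0<ε → let N , p = normSq-null (ε ℝ.* ε) (ℝ.*-pos 0<ε 0<ε) in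
    N , λ n N≤n → ℝ.<-respˡ-≈ (minus-0 (z ^ n)) (proj₂ (p n N≤n))
    where
    minus-0 : ∀ z → normSq z ℝ.- ℝ.0# ℝ.≈ normSq (z - 0#)
    minus-0 z = ℝ.solve 2 (λ a b → (a ℝ.:* a ℝ.:+ b ℝ.:* b) ℝ.:- ℝ.con (+ 0) ℝ.:=
      (a ℝ.:- ℝ.con (+ 0)) ℝ.:* (a ℝ.:- ℝ.con (+ 0)) ℝ.:+ (b ℝ.:- ℝ.con (+ 0)) ℝ.:* (b ℝ.:- ℝ.con (+ 0)))
      ℝ.refl (re z) (im z)

    normSq<1 : normSq z ℝ.< ℝ.1#
    normSq<1 = ℝ.<-respʳ-≈ (ℝ.*-identityˡ ℝ.1#) ∣z∣<1

    -- The midpoint of normSq z and 1, which unlike normSq z is known to be positive.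
    ρ : ℝ
    ρ = half ℝ.* (ℝ.1# ℝ.+ normSq z)

    0<ρ : ℝ.0# ℝ.< ρ
    0<ρ = half*-pos (ℝ.pos+nonneg ℝ.0<1 (normSq-nonneg z))

    0<gap : ℝ.0# ℝ.< half ℝ.* (ℝ.1# ℝ.- normSq z)
    0<gap = half*-pos (ℝ.<⇒diff normSq<1)

    ρ<1 : ρ ℝ.< ℝ.1#
    ρ<1 = ℝ.diff⇒< 0<gap (ℝ.trans
      (ℝ.solve 2 (λ h a → h ℝ.:* (ℝ.con (+ 1) ℝ.:- a) ℝ.:=
        (h ℝ.:* ℝ.con (+ 1) ℝ.:+ h ℝ.:* ℝ.con (+ 1)) ℝ.:- h ℝ.:* (ℝ.con (+ 1) ℝ.:+ a)) ℝ.refl half (normSq z))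
      (ℝ.+-congʳ (half+half ℝ.1#)))

    normSq<ρ : normSq z ℝ.< ρ
    normSq<ρ = ℝ.diff⇒< 0<gap (ℝ.trans
      (ℝ.solve 2 (λ h a → h ℝ.:* (ℝ.con (+ 1) ℝ.:- a) ℝ.:=
        h ℝ.:* (ℝ.con (+ 1) ℝ.:+ a) ℝ.:- (h ℝ.:* a ℝ.:+ h ℝ.:* a)) ℝ.refl half (normSq z))
      (ℝ.+-congˡ (ℝ.-‿cong (half+half (normSq z)))))

    ∣normSq∣<ρ : ℝ.∣ normSq z ∣< ρ
    ∣normSq∣<ρ = nonneg⇒∣∣< 0<ρ (normSq-nonneg z) normSq<ρ

    ∣normSq-^∣< : ∀ n → ℝ.∣ normSq (z ^ n) ∣< 2# ℝ.* ρ ℝ.^ n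
    -- For n = 0 the squared modulus and ρⁿ are both 1, so a strict bound needs the factor 2.
    ∣normSq-^∣< zero = ℝ.∣∣<-resp-≈
      (ℝ.solve 0 (ℝ.con (+ 1) ℝ.:= ℝ.con (+ 1) ℝ.:* ℝ.con (+ 1) ℝ.:+ ℝ.con (+ 0) ℝ.:* ℝ.con (+ 0)) ℝ.refl)
      (pos⇒∣∣< ℝ.0<1 (ℝ.<-respʳ-≈ (ℝ.sym (ℝ.*-identityʳ 2#)) (ℝ.x<1+x ℝ.1#)))
    ∣normSq-^∣< (suc n) = ∣∣<-respʳ-≈
      (ℝ.solve 2 (λ r p → r ℝ.:* ((ℝ.con (+ 1) ℝ.:+ ℝ.con (+ 1)) ℝ.:* p) ℝ.:=
        (ℝ.con (+ 1) ℝ.:+ ℝ.con (+ 1)) ℝ.:* (r ℝ.:* p)) ℝ.refl ρ (ρ ℝ.^ n))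
      (ℝ.∣∣<-resp-≈ (ℝ.sym (normSq-* z (z ^ n))) (ℝ.∣∣<-* ∣normSq∣<ρ (∣normSq-^∣< n)))

    normSq-null : Lim (λ n → normSq (z ^ n)) ℝ.0#
    normSq-null = Lim-squeeze ∣normSq-^∣< (Lim-cong (λ _ → ℝ.refl) (ℝ.zeroʳ 2#)
      (Lim-* (Lim-const 2#) (Lim-ρ^n 0<ρ ρ<1)))

  -- Natural bounds are added, where real bounds would call for a maximum.
  bounded-initially : ∀ (u : ℕ → ℝ) n → ∃ λ b → ∀ {m} → m ℕ.< n → ℝ.∣ u m ∣< ℝ.fromℕ b
  bounded-initially u zero    = 0 , λ ()
  bounded-initially u (suc n) = proj₁ IH ℕ.+ proj₁ (ℝ.bounded (u n)) , bound
    where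
    IH = bounded-initially u n

    ∣∣<fromℕ-+ : ∀ {x a} k → ℝ.∣ x ∣< ℝ.fromℕ a → ℝ.∣ x ∣< ℝ.fromℕ (k ℕ.+ a)
    ∣∣<fromℕ-+ zero    p = p
    ∣∣<fromℕ-+ (suc k) p = ℝ.∣∣<-trans (∣∣<fromℕ-+ k p) (ℝ.x<1+x _)

    bound : ∀ {m} → m ℕ.< suc n → ℝ.∣ u m ∣< ℝ.fromℕ (proj₁ IH ℕ.+ proj₁ (ℝ.bounded (u n)))
    bound {m} (ℕ.s≤s m≤n) with ℕ.m≤n⇒m<n∨m≡n m≤n
    ... | inj₁ m<n    = ≡.subst (λ b → ℝ.∣ u m ∣< ℝ.fromℕ b) (ℕ.+-comm (proj₁ (ℝ.bounded (u n))) (proj₁ IH))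
      (∣∣<fromℕ-+ (proj₁ (ℝ.bounded (u n))) (proj₂ IH m<n))
    ... | inj₂ ≡.refl = ∣∣<fromℕ-+ (proj₁ IH) (proj₂ (ℝ.bounded (u n)))

  periodic-% : ∀ {ψ : ℕ → ℂ} f .{{_ : NonZero f}} → (∀ m → ψ (m ℕ.+ f) ≈ ψ m) → ∀ m → ψ m ≈ ψ (m % f)
  periodic-% {ψ} f periodic m = trans (reflexive (≡.cong ψ (m≡m%n+[m/n]*n m f))) (multiple (m div f))
    where
    multiple : ∀ k → ψ (m % f ℕ.+ k ℕ.* f) ≈ ψ (m % f)
    multiple zero    = reflexive (≡.cong ψ (ℕ.+-identityʳ _))
    multiple (suc k) = trans
      (reflexive (≡.cong ψ (≡.trans (≡.cong (m % f ℕ.+_) (ℕ.+-comm f (k ℕ.* f))) (≡.sym (ℕ.+-assoc (m % f) _ f)))))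
      (trans (periodic _) (multiple k))

  periodic⇒bounded : ∀ {ψ : ℕ → ℂ} f .{{_ : NonZero f}} → (∀ m → ψ (m ℕ.+ f) ≈ ψ m) →
                     EvBounded (re ∘ ψ) × EvBounded (im ∘ ψ)
  periodic⇒bounded {ψ} f periodic =
    component re re≈ , component im im≈
    where
    component : (p : ℂ → ℝ) → (∀ {z w} → z ≈ w → p z ℝ.≈ p w) → EvBounded (p ∘ ψ)
    component p p-cong with bounded-initially (p ∘ ψ) f
    ... | b , ∣ψ∣<b = ℝ.fromℕ b , 0 , λ m _ →
      ℝ.∣∣<-resp-≈ (p-cong (sym (periodic-% f periodic m))) (∣ψ∣<b (m%n<n m f))

nCk*k![n∸k]!≡n! : ∀ {n k} → k ℕ.≤ n → (n C k) ℕ.* (k ! ℕ.* (n ℕ.∸ k) !) ≡ n !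
nCk*k![n∸k]!≡n! {n} {k} k≤n = ≡.trans
  (≡.cong (ℕ._* (k ! ℕ.* (n ℕ.∸ k) !)) (nCk≡n!/k![n-k]! k≤n))
  (m/n*n≡m {{k ℕ.!* (n ℕ.∸ k) !≢0}} (k![n∸k]!∣n! k≤n))

-- Finite sums and real scalars in the complex numbers

module ComplexLemmas {c ℓ₁ ℓ₂} (R : CompleteOrderedField c ℓ₁ ℓ₂) where

  open ComplexNumbers R
  open IntegerSolver ℂ-commutativeRing using (solve; _:=_; _:+_; _:*_; _:-_; :-_; con)
  open import Algebra.Properties.Semiring.Sum semiring
    using (sum-cong-≋; ∑-distrib-+; *-distribˡ-sum; *-distribʳ-sum)
  open import Relation.Binary.Reasoning.Setoid setoid

  -- The summand lives on ℕ rather than on `Fin n`, so that splitting and shifting a sum need no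
  -- conversion of indices.
  ∑< : ℕ → (ℕ → ℂ) → ℂ
  ∑< n u = ∑[ k < n ] u (toℕ k)

  ∑<-cong : ∀ n {u v : ℕ → ℂ} → (∀ k → u k ≈ v k) → ∑< n u ≈ ∑< n v
  ∑<-cong n p = sum-cong-≋ {n} (p ∘ toℕ)

  ∑<-homo-+ : ∀ m n u → ∑< (m ℕ.+ n) u ≈ ∑< m u + ∑< n (λ k → u (m ℕ.+ k))
  ∑<-homo-+ zero    n u = sym (+-identityˡ _)
  ∑<-homo-+ (suc m) n u = trans (+-congˡ (∑<-homo-+ m n (u ∘ suc))) (sym (+-assoc _ _ _))

  ∑<-distrib-+ : ∀ n (u v : ℕ → ℂ) → ∑< n (λ k → u k + v k) ≈ ∑< n u + ∑< n v
  ∑<-distrib-+ n u v = ∑-distrib-+ {n} (u ∘ toℕ) (v ∘ toℕ)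

  *-distribˡ-∑< : ∀ n z u → z * ∑< n u ≈ ∑< n (λ k → z * u k)
  *-distribˡ-∑< n z u = *-distribˡ-sum {n} z (u ∘ toℕ)

  *-distribʳ-∑< : ∀ n z u → ∑< n u * z ≈ ∑< n (λ k → u k * z)
  *-distribʳ-∑< n z u = *-distribʳ-sum {n} z (u ∘ toℕ)

  ofReal-* : ∀ x z → ofReal x * z ≈ x · z
  ofReal-* x z =
    ℝ.solve 3 (λ x a b → x ℝ.:* a ℝ.:- ℝ.con (+ 0) ℝ.:* b ℝ.:= x ℝ.:* a) ℝ.refl x (re z) (im z) ,
    ℝ.solve 3 (λ x a b → x ℝ.:* b ℝ.:+ ℝ.con (+ 0) ℝ.:* a ℝ.:= x ℝ.:* b) ℝ.refl x (re z) (im z)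

  ·-cong : ∀ {x y z w} → x ℝ.≈ y → z ≈ w → x · z ≈ y · w
  ·-cong p q = ℝ.*-cong p (re≈ q) , ℝ.*-cong p (im≈ q)

  ·-congʳ : ∀ {x y z} → x ℝ.≈ y → x · z ≈ y · z
  ·-congʳ p = ·-cong p refl

  ·-congˡ : ∀ {x z w} → z ≈ w → x · z ≈ x · w
  ·-congˡ p = ·-cong ℝ.refl p

  ·-identity : ∀ z → ℝ.1# · z ≈ z
  ·-identity z = ℝ.*-identityˡ _ , ℝ.*-identityˡ _

  ·-assoc : ∀ x y z → (x ℝ.* y) · z ≈ x · (y · z)
  ·-assoc x y z = ℝ.*-assoc _ _ _ , ℝ.*-assoc _ _ _

  ·-distrib : ∀ x y z → (x ℝ.+ y) · z ≈ x · z + y · z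
  ·-distrib x y z = ℝ.distribʳ _ _ _ , ℝ.distribʳ _ _ _

  ·-*-assoc : ∀ x z w → (x · z) * w ≈ x · (z * w)
  ·-*-assoc x z w = begin
    (x · z) * w          ≈⟨ *-congʳ (ofReal-* x z) ⟨
    (ofReal x * z) * w   ≈⟨ *-assoc _ _ _ ⟩
    ofReal x * (z * w)   ≈⟨ ofReal-* x _ ⟩
    x · (z * w)          ∎

  *-·-comm : ∀ x z w → z * (x · w) ≈ x · (z * w)
  *-·-comm x z w = trans (*-comm _ _) (trans (·-*-assoc x w z) (·-congˡ (*-comm w z)))

  ·-*-· : ∀ x y z w → (x · z) * (y · w) ≈ (x ℝ.* y) · (z * w)
  ·-*-· x y z w = begin
    (x · z) * (y · w)     ≈⟨ ·-*-assoc x z (y · w) ⟩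
    x · (z * (y · w))     ≈⟨ ·-congˡ (*-·-comm y z w) ⟩
    x · (y · (z * w))     ≈⟨ ·-assoc x y _ ⟨
    (x ℝ.* y) · (z * w)   ∎

  ·-^ : ∀ x z n → (x · z) ^ n ≈ (x ℝ.^ n) · z ^ n
  ·-^ x z zero    = sym (·-identity 1#)
  ·-^ x z (suc n) = trans (*-congˡ (·-^ x z n)) (·-*-· x (x ℝ.^ n) z (z ^ n))

  1^ : ∀ n → 1# ^ n ≈ 1#
  1^ zero    = refl
  1^ (suc n) = trans (*-identityˡ _) (1^ n)

  ofReal-^ : ∀ x n → ofReal (x ℝ.^ n) ≈ ofReal x ^ n
  ofReal-^ x zero    = refl
  ofReal-^ x (suc n) = trans (sym (ℝ.refl , ℝ.zeroʳ x)) (trans (sym (ofReal-* x (ofReal (x ℝ.^ n)))) (*-congˡ (ofReal-^ x n)))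

  ×ₙ≈· : ∀ n z → n ×ₙ z ≈ ℝ.fromℕ n · z
  ×ₙ≈· zero    z = sym (ℝ.zeroˡ _ , ℝ.zeroˡ _)
  ×ₙ≈· (suc n) z = begin
    z + n ×ₙ z                    ≈⟨ +-cong (·-identity z) (sym (×ₙ≈· n z)) ⟨
    ℝ.1# · z + ℝ.fromℕ n · z      ≈⟨ ·-distrib _ _ z ⟨
    ℝ.fromℕ (suc n) · z           ∎

-- The addition formula of the exponential

module Exponential {c ℓ₁ ℓ₂} (R : CompleteOrderedField c ℓ₁ ℓ₂) where

  open ComplexNumbers R
  open ComplexLemmas R
  open OrderedFieldLemmas R
  open RealLimits R atTop
  open ComplexLimits R atTop
  open Sequences R
  open IntegerSolver ℂ-commutativeRing using (solve; _:=_; _:+_; _:*_; _:-_; :-_; con)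
  open import Algebra.Properties.Semiring.Mult (CommutativeRing.semiring ℝ.commutativeRing)
    using (×1-homo-*)
  module ℝ^ where
    open import Algebra.Properties.Semiring.Exp (CommutativeRing.semiring ℝ.commutativeRing) public
      using (^-homo-*)
    open import Algebra.Properties.CommutativeSemiring.Exp
      (CommutativeRing.commutativeSemiring ℝ.commutativeRing) public using (^-distrib-*)
  open import Algebra.Properties.Semiring.Exp semiring using (^-congˡ)
  open import Algebra.Properties.CommutativeSemiring.Binomial commutativeSemiring
    using (theorem)
  open import Relation.Binary.Reasoning.Setoid setoid

  open ExpSeries using (term; partialSum)

  exp-lim : ∀ z → Limᶜ (partialSum z) (exp z)
  exp-lim z = proj₂ (ℝ.complete _ (ExpSeries.re-isCauchy z)) , proj₂ (ℝ.complete _ (ExpSeries.im-isCauchy z))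

  term-cong : ∀ {z w} → z ≈ w → ∀ k → term z k ≈ term w k
  term-cong z≈w k = ·-congˡ (^-congˡ k z≈w)

  exp-cong : ∀ {z w} → z ≈ w → exp z ≈ exp w
  exp-cong {z} {w} z≈w = Limᶜ-unique (exp-lim z)
    (Limᶜ-cong (λ N → ∑<-cong N (λ k → sym (term-cong z≈w k))) refl (exp-lim w))

  -- Bounds on the coordinates add and multiply without square roots; the price is the factor 2 in
  -- `Box-*`.
  record Box (z : ℂ) (b : ℝ) : Set ℓ₂ where
    constructor _,_
    field
      re-< : ℝ.∣ re z ∣< b
      im-< : ℝ.∣ im z ∣< b

  open Box

  Box-resp-≈ : ∀ {z w a b} → z ≈ w → a ℝ.≈ b → Box z a → Box w b
  Box-resp-≈ z≈w a≈b (p , q) =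
    ∣∣<-respʳ-≈ a≈b (ℝ.∣∣<-resp-≈ (re≈ z≈w) p) , ∣∣<-respʳ-≈ a≈b (ℝ.∣∣<-resp-≈ (im≈ z≈w) q)

  Box-mono : ∀ {z a b} → a ℝ.< b → Box z a → Box z b
  Box-mono a<b (p , q) = ℝ.∣∣<-trans p a<b , ℝ.∣∣<-trans q a<b

  Box-+ : ∀ {z w a b} → Box z a → Box w b → Box (z + w) (a ℝ.+ b)
  Box-+ (p , p′) (q , q′) = ℝ.∣∣<-+ p q , ℝ.∣∣<-+ p′ q′

  Box-* : ∀ {z w a b} → Box z a → Box w b → Box (z * w) (a ℝ.* b ℝ.+ a ℝ.* b)
  Box-* (p , p′) (q , q′) =
    ℝ.∣∣<-+ (ℝ.∣∣<-* p q) (ℝ.∣∣<-neg (ℝ.∣∣<-* p′ q′)) , ℝ.∣∣<-+ (ℝ.∣∣<-* p q′) (ℝ.∣∣<-* p′ q)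

  Box-· : ∀ {s z b} → ℝ.0# ℝ.< s → Box z b → Box (s · z) (s ℝ.* b)
  Box-· 0<s (p , q) = ℝ.∣∣<-scale 0<s p , ℝ.∣∣<-scale 0<s q

  -- Counting one ε too many keeps the strict bound true of the empty sum.
  Box-∑< : ∀ {u : ℕ → ℂ} {ε} → ℝ.0# ℝ.< ε → ∀ {m n} → m ℕ.≤ n → (∀ k → Box (u k) ε) → Box (∑< m u) (ℝ.fromℕ (suc n) ℝ.* ε)
  Box-∑< {ε = ε} 0<ε {n = n} z≤n p = ∣0∣< 0<nε , ∣0∣< 0<nε
    where 0<nε = ℝ.*-pos (ℝ.fromℕ-pos n) 0<ε
  Box-∑< {ε = ε} 0<ε {n = suc n} (s≤s m≤n) p = Box-resp-≈ refl
    (ℝ.solve 2 (λ n e → e ℝ.:+ n ℝ.:* e ℝ.:= (ℝ.con (+ 1) ℝ.:+ n) ℝ.:* e) ℝ.refl (ℝ.fromℕ (suc n)) ε)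
    (Box-+ (p 0) (Box-∑< 0<ε m≤n (p ∘ suc)))

  Square : ℕ → ℕ → (ℕ → ℕ → ℂ) → ℂ
  Square m n T = ∑< m λ i → ∑< n λ j → T i j

  -- The sum of T i j over i + j < n, taken by rows so that it can be compared with `Square` one row
  -- at a time.
  Triangle : ℕ → (ℕ → ℕ → ℂ) → ℂ
  Triangle zero    T = 0#
  Triangle (suc n) T = ∑< (suc n) (T 0) + Triangle n (T ∘ suc)

  -- The entries k = 0 of the antidiagonals form row 0; what remains are the antidiagonals of
  -- `T ∘ suc`.
  Triangle-antidiagonal : ∀ N T → Triangle N T ≈ ∑< N λ n → ∑< (suc n) λ k → T k (n ℕ.∸ k)
  Triangle-antidiagonal zero    T = refl
  Triangle-antidiagonal (suc N) T = sym (begin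
    ∑< (suc N) (λ n → T 0 n + ∑< n λ k → T (suc k) (n ℕ.∸ suc k))
      ≈⟨ ∑<-distrib-+ (suc N) (T 0) (λ n → ∑< n λ k → T (suc k) (n ℕ.∸ suc k)) ⟩
    -- The summand 0 is the remainder of the antidiagonal n = 0, which is empty.
    ∑< (suc N) (T 0) + (0# + ∑< N (λ n → ∑< (suc n) λ k → T (suc k) (n ℕ.∸ k)))
      ≈⟨ +-congˡ (trans (+-identityˡ _) (sym (Triangle-antidiagonal N (T ∘ suc)))) ⟩
    ∑< (suc N) (T 0) + Triangle N (T ∘ suc) ∎)

  -- The difference consists of entries with i + j ≥ m. A rectangle with m rows and m + d columns is
  -- needed for the induction: dropping row 0 shrinks the triangle but not the length of the rows.
  Square-Triangle : ∀ m d T {ε} → ℝ.0# ℝ.< ε → (∀ i j → m ℕ.≤ i ℕ.+ j → Box (T i j) ε) →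
    Box (Square m (m ℕ.+ d) T - Triangle m T) (ℝ.fromℕ (suc m) ℝ.* (ℝ.fromℕ (suc (m ℕ.+ d)) ℝ.* ε))
  Square-Triangle zero d T {ε} 0<ε p = Box-resp-≈ (sym (-‿inverseʳ 0#)) ℝ.refl (∣0∣< 0<b , ∣0∣< 0<b)
    where 0<b = ℝ.*-pos (ℝ.fromℕ-pos 0) (ℝ.*-pos (ℝ.fromℕ-pos d) 0<ε)
  Square-Triangle (suc m) d T {ε} 0<ε p = Box-resp-≈ regroup
    (ℝ.solve 2 (λ m b → b ℝ.:+ m ℝ.:* b ℝ.:= (ℝ.con (+ 1) ℝ.:+ m) ℝ.:* b) ℝ.refl (ℝ.fromℕ (suc m)) _)
    (Box-+
      (Box-∑< 0<ε (ℕ.m≤n+m d (suc m)) (λ k → p 0 (suc m ℕ.+ k) (ℕ.m≤m+n (suc m) k)))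
      (≡.subst (λ n → Box (Square m n (T ∘ suc) - Triangle m (T ∘ suc)) (ℝ.fromℕ (suc m) ℝ.* (ℝ.fromℕ (suc n) ℝ.* ε)))
        (ℕ.+-suc m d)
        (Square-Triangle m (suc d) (T ∘ suc) 0<ε (λ i j m≤i+j → p (suc i) j (s≤s m≤i+j)))))
    where
    regroup = begin
      ∑< d (λ k → T 0 (suc m ℕ.+ k)) + (Square m (suc m ℕ.+ d) (T ∘ suc) - Triangle m (T ∘ suc))
        ≈⟨ solve 4 (λ r s a b → r :+ (a :- b) := ((s :+ r) :+ a) :- (s :+ b)) refl
             (∑< d (λ k → T 0 (suc m ℕ.+ k))) (∑< (suc m) (T 0)) _ _ ⟩
      ((∑< (suc m) (T 0) + ∑< d (λ k → T 0 (suc m ℕ.+ k))) + Square m (suc m ℕ.+ d) (T ∘ suc))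
        - (∑< (suc m) (T 0) + Triangle m (T ∘ suc))
        ≈⟨ +-congʳ (+-congʳ (∑<-homo-+ (suc m) d (T 0))) ⟨
      Square (suc m) (suc m ℕ.+ d) T - Triangle (suc m) T ∎

  product : ℂ → ℂ → ℕ → ℕ → ℂ
  product z w i j = term z i * term w j

  Square-product : ∀ m n z w → partialSum z m * partialSum w n ≈ Square m n (product z w)
  Square-product m n z w = trans (*-distribʳ-∑< m _ (term z)) (∑<-cong m λ i → *-distribˡ-∑< n (term z i) (term w))

  e : ℕ → ℝ
  e = ExpSeries.e 0#

  -- Both sides are inverse to k! (n - k)!.
  e-binomial : ∀ {n k} → k ℕ.≤ n → e n ℝ.* ℝ.fromℕ (n C k) ℝ.≈ e k ℝ.* e (n ℕ.∸ k)
  e-binomial {n} {k} k≤n = ExpSeries.inverse-unique 0# {fromℕ-k! ℝ.* fromℕ-[n∸k]!}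
    (ℝ.trans (ℝ.*-assoc _ _ _) (ℝ.trans (ℝ.*-congˡ (ℝ.trans
      (ℝ.trans (ℝ.*-congˡ (ℝ.sym (×1-homo-* (k !) ((n ℕ.∸ k) !)))) (ℝ.sym (×1-homo-* (n C k) _)))
      (ℝ.reflexive (≡.cong ℝ.fromℕ (nCk*k![n∸k]!≡n! k≤n)))))
      (ExpSeries.e-inverse 0# n)))
    (ℝ.trans
      (ℝ.solve 4 (λ a b x y → (a ℝ.:* b) ℝ.:* (x ℝ.:* y) ℝ.:= (a ℝ.:* x) ℝ.:* (b ℝ.:* y)) ℝ.refl _ _ _ _)
      (ℝ.trans (ℝ.*-cong (ExpSeries.e-inverse 0# k) (ExpSeries.e-inverse 0# (n ℕ.∸ k))) (ℝ.*-identityˡ _)))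
    where
    fromℕ-k!     = ℝ.fromℕ (k !)
    fromℕ-[n∸k]! = ℝ.fromℕ ((n ℕ.∸ k) !)

  term-binomial : ∀ z w n → term (z + w) n ≈ ∑< (suc n) λ k → product z w k (n ℕ.∸ k)
  term-binomial z w n = begin
    e n · (z + w) ^ n                            ≈⟨ ·-congˡ (theorem n z w) ⟩
    e n · ∑[ k ≤ n ] ((n C toℕ k) ×ₙ (z ^ toℕ k * w ^ (n ℕ.∸ toℕ k)))
      ≈⟨ ofReal-* (e n) _ ⟨
    ofReal (e n) * ∑[ k ≤ n ] ((n C toℕ k) ×ₙ (z ^ toℕ k * w ^ (n ℕ.∸ toℕ k)))
      ≈⟨ *-distribˡ-sum {suc n} (ofReal (e n)) (λ k → (n C toℕ k) ×ₙ (z ^ toℕ k * w ^ (n ℕ.∸ toℕ k))) ⟩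
    ∑[ k ≤ n ] (ofReal (e n) * (n C toℕ k) ×ₙ (z ^ toℕ k * w ^ (n ℕ.∸ toℕ k)))
      ≈⟨ sum-cong-≋ {suc n} (λ k → summand (toℕ k) (Fin.toℕ≤pred[n] k)) ⟩
    ∑< (suc n) (λ k → product z w k (n ℕ.∸ k)) ∎
    where
    open import Algebra.Properties.Semiring.Sum semiring using (sum-cong-≋; *-distribˡ-sum)

    summand : ∀ k → k ℕ.≤ n → ofReal (e n) * (n C k) ×ₙ (z ^ k * w ^ (n ℕ.∸ k)) ≈ product z w k (n ℕ.∸ k)
    summand k k≤n = begin
      ofReal (e n) * (n C k) ×ₙ (z ^ k * w ^ (n ℕ.∸ k))       ≈⟨ ofReal-* (e n) _ ⟩
      e n · (n C k) ×ₙ (z ^ k * w ^ (n ℕ.∸ k))                ≈⟨ ·-congˡ (×ₙ≈· (n C k) _) ⟩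
      e n · ℝ.fromℕ (n C k) · (z ^ k * w ^ (n ℕ.∸ k))         ≈⟨ ·-assoc _ _ _ ⟨
      (e n ℝ.* ℝ.fromℕ (n C k)) · (z ^ k * w ^ (n ℕ.∸ k))     ≈⟨ ·-congʳ (e-binomial k≤n) ⟩
      (e k ℝ.* e (n ℕ.∸ k)) · (z ^ k * w ^ (n ℕ.∸ k))         ≈⟨ ·-*-· _ _ _ _ ⟨
      product z w k (n ℕ.∸ k)                                 ∎

  partialSum-Triangle : ∀ z w N → partialSum (z + w) N ≈ Triangle N (product z w)
  partialSum-Triangle z w N = trans (∑<-cong N (term-binomial z w)) (sym (Triangle-antidiagonal N (product z w)))

  -- One eighth: of the three factors halfᴺ in hᴺ, two absorb the factors N + 1 of `error` and the
  -- third tends to 0.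
  h : ℝ
  h = half ℝ.* (half ℝ.* half)

  0<h : ℝ.0# ℝ.< h
  0<h = half*-pos (half*-pos 0<half)

  decreasing⇒bounded : ∀ (b : ℕ → ℝ) K → (∀ j → b (suc (j ℕ.+ K)) ℝ.< b (j ℕ.+ K)) → ∃ λ C₀ → ∀ k → b k ℝ.< C₀
  decreasing⇒bounded b K dec with bounded-initially b (suc K)
  ... | C₀ , bound = ℝ.fromℕ C₀ , below
    where
    beyond : ∀ j → b (j ℕ.+ K) ℝ.< ℝ.fromℕ C₀
    beyond zero    = proj₂ (bound ℕ.≤-refl)
    beyond (suc j) = ℝ.<-trans (dec j) (beyond j)

    below : ∀ k → b k ℝ.< ℝ.fromℕ C₀
    below k with ℕ.≤-total k K
    ... | inj₁ k≤K = proj₂ (bound (s≤s k≤K))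
    ... | inj₂ K≤k = ≡.subst (λ k → b k ℝ.< ℝ.fromℕ C₀) (ℕ.m∸n+n≡m K≤k) (beyond (k ℕ.∸ K))

  -- The majorant of `ExpSeries` more than halves at each step from K on, hence is bounded.
  term-bounded : ∀ z → ∃ λ C₀ → ∀ k → Box (term z k) C₀
  term-bounded z = proj₁ bound , λ k → Box-mono (proj₂ bound k) (Box-· (0<e k) (proj₁ (^-bound k) , proj₂ (^-bound k)))
    where
    open ExpSeries z using (b; 0<b; 0<e; K; halving; ^-bound)

    bound : ∃ λ C₀ → ∀ k → b k ℝ.< C₀
    bound = decreasing⇒bounded b K λ j →
      ℝ.<-trans (ℝ.<-respˡ-≈ (ℝ.+-identityˡ _) (ℝ.+-monoˡ-< _ (0<b (suc (j ℕ.+ K))))) (halving j)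

  term-· : ∀ s z k → term (s · z) k ≈ (s ℝ.^ k) · term z k
  term-· s z k = begin
    e k · (s · z) ^ k            ≈⟨ ·-congˡ (·-^ s z k) ⟩
    e k · (s ℝ.^ k) · z ^ k      ≈⟨ ·-assoc _ _ _ ⟨
    (e k ℝ.* s ℝ.^ k) · z ^ k    ≈⟨ ·-congʳ (ℝ.*-comm _ _) ⟩
    (s ℝ.^ k ℝ.* e k) · z ^ k    ≈⟨ ·-assoc _ _ _ ⟩
    (s ℝ.^ k) · e k · z ^ k      ∎

  -- The k-th term at z is h^k times the k-th term at z / h, and the latter is bounded. Rescaling
  -- thus gives geometric decay with no further estimate of factorials.
  term-decay : ∀ z → ∃ λ C₀ → ∀ k → Box (term z k) (h ℝ.^ k ℝ.* C₀)
  term-decay z = proj₁ bound , λ k → Box-resp-≈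
    (trans (sym (term-· h z′ k)) (term-cong hz′≈z k))
    ℝ.refl (Box-· (^-pos k 0<h) (proj₂ bound k))
    where
    z′ : ℂ
    z′ = ℝ.recip h (ℝ.>⇒# 0<h) · z

    bound = term-bounded z′

    hz′≈z : h · z′ ≈ z
    hz′≈z = trans (sym (·-assoc _ _ _)) (trans (·-congʳ (recip-inverseʳ h _)) (·-identity z))

  h<1 : h ℝ.< ℝ.1#
  h<1 = ℝ.<-trans (half*-< (half*-pos 0<half)) (ℝ.<-trans (half*-< 0<half) half<1)

  -- The factor 2 makes the inequality strict for m = n as well.
  ^-quasi-antitone : ∀ {ρ m n} → ℝ.0# ℝ.< ρ → ρ ℝ.< ℝ.1# → m ℕ.≤ n → ρ ℝ.^ n ℝ.< ρ ℝ.^ m ℝ.* 2#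
  ^-quasi-antitone {n = zero}  0<ρ ρ<1 z≤n = ℝ.<-respʳ-≈ (ℝ.sym (ℝ.*-identityˡ _)) (ℝ.x<1+x ℝ.1#)
  ^-quasi-antitone {ρ} {n = suc n} 0<ρ ρ<1 z≤n = ℝ.<-trans
    (ℝ.<-resp-≈₂ (ℝ.*-comm _ _) (ℝ.*-identityʳ _) (ℝ.*-monoˡ-< (^-pos n 0<ρ) ρ<1))
    (^-quasi-antitone {n = n} 0<ρ ρ<1 z≤n)
  ^-quasi-antitone 0<ρ ρ<1 (s≤s m≤n) =
    ℝ.<-respʳ-≈ (ℝ.sym (ℝ.*-assoc _ _ _)) (ℝ.*-monoˡ-< 0<ρ (^-quasi-antitone 0<ρ ρ<1 m≤n))

  product-decay : ∀ {z w A B} → (∀ k → Box (term z k) (h ℝ.^ k ℝ.* A)) → (∀ k → Box (term w k) (h ℝ.^ k ℝ.* B)) →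
    ∃ λ C₀ → ℝ.0# ℝ.< C₀ × (∀ N i j → N ℕ.≤ i ℕ.+ j → Box (product z w i j) (h ℝ.^ N ℝ.* C₀))
  product-decay {z} {w} {A} {B} ∣z∣< ∣w∣< = 2# ℝ.* D , ℝ.*-pos 0<2 0<D , λ N i j N≤i+j → Box-mono
    (ℝ.<-resp-≈₂ (ℝ.*-comm _ _) (ℝ.solve 3 (λ d p t → d ℝ.:* (p ℝ.:* t) ℝ.:= p ℝ.:* (t ℝ.:* d)) ℝ.refl D (h ℝ.^ N) 2#)
      (ℝ.*-monoˡ-< 0<D (^-quasi-antitone 0<h h<1 N≤i+j)))
    (Box-resp-≈ refl
      (ℝ.trans
        (ℝ.solve 4 (λ p q a b → (p ℝ.:* a) ℝ.:* (q ℝ.:* b) ℝ.:+ (p ℝ.:* a) ℝ.:* (q ℝ.:* b)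
          ℝ.:= (p ℝ.:* q) ℝ.:* (a ℝ.:* b ℝ.:+ a ℝ.:* b)) ℝ.refl (h ℝ.^ i) (h ℝ.^ j) A B)
        (ℝ.*-congʳ (ℝ.sym (ℝ^.^-homo-* h i j))))
      (Box-* (∣z∣< i) (∣w∣< j)))
    where
    D : ℝ
    D = A ℝ.* B ℝ.+ A ℝ.* B

    pos : ∀ {y C₀} → ℝ.∣ y ∣< ℝ.1# ℝ.* C₀ → ℝ.0# ℝ.< C₀
    pos p = ℝ.<-respʳ-≈ (ℝ.*-identityˡ _) (ℝ.∣∣<⇒pos p)

    0<D : ℝ.0# ℝ.< D
    0<D = ℝ.+-pos 0<AB 0<AB
      -- At k = 0 the hypotheses bound a term by 1 * A or 1 * B, and a two-sided strict bound is
      -- positive.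
      where 0<AB = ℝ.*-pos (pos (re-< (∣z∣< 0))) (pos (re-< (∣w∣< 0)))

  error : ℝ → ℕ → ℝ
  error C₀ N = ℝ.fromℕ (suc N) ℝ.* (ℝ.fromℕ (suc N) ℝ.* (h ℝ.^ N ℝ.* C₀))

  -- h is the cube of half, and N halfᴺ is bounded.
  error-null : ∀ C₀ → Lim (error C₀) ℝ.0#
  error-null C₀ = Lim-cong
    (λ N → ℝ.trans
      (ℝ.solve 3 (λ n p c → (n ℝ.:* p) ℝ.:* ((n ℝ.:* p) ℝ.:* (c ℝ.:* p))
        ℝ.:= n ℝ.:* (n ℝ.:* ((p ℝ.:* (p ℝ.:* p)) ℝ.:* c))) ℝ.refl (ℝ.fromℕ (suc N)) (half ℝ.^ N) C₀)
      (ℝ.*-congˡ (ℝ.*-congˡ (ℝ.*-congʳ (ℝ.trans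
        (ℝ.*-congˡ (ℝ.sym (ℝ^.^-distrib-* half half N)))
        (ℝ.sym (ℝ^.^-distrib-* half (half ℝ.* half) N)))))))
    ℝ.refl
    (Lim-bounded-*-null linear (Lim-bounded-*-null linear
      (Lim-bounded-*-null (Lim⇒bounded (Lim-const C₀)) (Lim-ρ^n 0<half half<1))))
    where
    s : ℝ
    s = half ℝ.* (ℝ.1# ℝ.- half)

    0<s : ℝ.0# ℝ.< s
    0<s = half*-pos (ℝ.<⇒diff half<1)

    linear : EvBounded (λ N → ℝ.fromℕ (suc N) ℝ.* half ℝ.^ N)
    linear = ℝ.recip s (ℝ.>⇒# 0<s) ℝ.* 2# , 0 , λ N _ → pos⇒∣∣<
      (ℝ.*-pos (ℝ.fromℕ-pos N) (^-pos N 0<half))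
      (ℝ.*-cancelˡ-< 0<s (ℝ.<-resp-≈₂
        (ℝ.solve 3 (λ n p x → n ℝ.:* (x ℝ.:* p) ℝ.:* (ℝ.con (+ 1) ℝ.:- x)
          ℝ.:= (x ℝ.:* (ℝ.con (+ 1) ℝ.:- x)) ℝ.:* (n ℝ.:* p)) ℝ.refl (ℝ.fromℕ (suc N)) (half ℝ.^ N) half)
        (ℝ.sym (*-cancel-recip s (ℝ.>⇒# 0<s) 2#))
        (n*ρ^n-bound 0<half half<1 (suc N))))

  -- The product of the partial sums differs from the partial sum of the Cauchy product by at
  -- most N² terms zⁱ wʲ / (i! j!) with i + j ≥ N, each of order h^N.
  defect-lim : ∀ {z w C₀} → ℝ.0# ℝ.< C₀ →
    (∀ N i j → N ℕ.≤ i ℕ.+ j → Box (product z w i j) (h ℝ.^ N ℝ.* C₀)) →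
    Limᶜ (λ N → partialSum z N * partialSum w N - partialSum (z + w) N) 0#
  defect-lim {z} {w} {C₀} 0<C₀ decay =
    Lim-squeeze (λ N → re-< (small N)) (error-null C₀) ,
    Lim-squeeze (λ N → im-< (small N)) (error-null C₀)
    where
    small : ∀ N → Box (partialSum z N * partialSum w N - partialSum (z + w) N) (error C₀ N)
    small N = Box-resp-≈
      (+-cong (sym (Square-product N N z w)) (-‿cong (sym (partialSum-Triangle z w N))))
      ℝ.refl
      (≡.subst (λ n → Box (Square N n (product z w) - Triangle N (product z w))
                          (ℝ.fromℕ (suc N) ℝ.* (ℝ.fromℕ (suc n) ℝ.* (h ℝ.^ N ℝ.* C₀))))
        (ℕ.+-identityʳ N)
        (Square-Triangle N 0 (product z w) (ℝ.*-pos (^-pos N 0<h) 0<C₀) (decay N)))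

  exp-homo-+ : ∀ z w → exp (z + w) ≈ exp z * exp w
  exp-homo-+ z w = sym (Limᶜ-unique (Limᶜ-* (exp-lim z) (exp-lim w))
    (Limᶜ-cong
      (λ N → solve 2 (λ a b → b :+ (a :- b) := a) refl (partialSum z N * partialSum w N) (partialSum (z + w) N))
      (+-identityʳ _)
      (Limᶜ-+ (exp-lim (z + w)) (defect-lim (proj₁ (proj₂ decay)) (proj₂ (proj₂ decay))))))
    where
    decay = product-decay {z} {w} (proj₂ (term-decay z)) (proj₂ (term-decay w))

  exp-0 : exp 0# ≈ 1#
  exp-0 = Limᶜ-unique (exp-lim 0#) (component re re≈ , component im im≈)
    where
    term-0 : term 0# 0 ≈ 1#
    term-0 = trans (·-congʳ (ℝ.trans (ℝ.sym (ℝ.*-identityʳ _))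
        (ℝ.trans (ℝ.*-congˡ (ℝ.sym (ℝ.+-identityʳ _))) (ExpSeries.e-inverse 0# 0))))
      (·-identity 1#)

    term-suc : ∀ k → term 0# (suc k) ≈ 0#
    term-suc k = trans (·-congˡ (zeroˡ _)) (ℝ.zeroʳ _ , ℝ.zeroʳ _)

    partial : ∀ N → partialSum 0# (suc N) ≈ 1#
    partial N = trans (+-cong term-0 (trans (∑<-cong N term-suc) (∑<-0 N))) (+-identityʳ 1#)
      where
      ∑<-0 : ∀ n → ∑< n (const 0#) ≈ 0#
      ∑<-0 zero    = refl
      ∑<-0 (suc n) = trans (+-identityˡ _) (∑<-0 n)

    component : (p : ℂ → ℝ) → (∀ {z w} → z ≈ w → p z ℝ.≈ p w) → Lim (p ∘ partialSum 0#) (p 1#)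
    component p p-cong ε 0<ε = 1 , λ { (suc N) _ → ℝ.∣∣<-resp-≈
      (ℝ.sym (ℝ.trans (ℝ.+-congʳ (p-cong (partial N))) (ℝ.-‿inverseʳ _))) (∣0∣< 0<ε) }

  exp-fromℕ-· : ∀ n z → exp (ℝ.fromℕ n · z) ≈ exp z ^ n
  exp-fromℕ-· zero    z = trans (exp-cong (ℝ.zeroˡ _ , ℝ.zeroˡ _)) exp-0
  exp-fromℕ-· (suc n) z = begin
    exp (ℝ.fromℕ (suc n) · z)      ≈⟨ exp-cong (trans (·-distrib _ _ z) (+-congʳ (·-identity z))) ⟩
    exp (z + ℝ.fromℕ n · z)        ≈⟨ exp-homo-+ z _ ⟩
    exp z * exp (ℝ.fromℕ n · z)    ≈⟨ *-congˡ (exp-fromℕ-· n z) ⟩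
    exp z ^ suc n                  ∎

-- Box sums, inverses and periodic geometric series

module BoxSums {c ℓ₁ ℓ₂} (R : CompleteOrderedField c ℓ₁ ℓ₂) where

  open QEuler R
  open ComplexLemmas R
  open IntegerSolver ℂ-commutativeRing using (solve; _:=_; _:+_; _:*_; _:-_; :-_; con)
  open import Algebra.Properties.Semiring.Sum semiring using (∑-comm)
  open import Algebra.Properties.Semiring.Exp semiring using (^-homo-*; ^-congˡ)
  open import Algebra.Properties.CommutativeSemiring.Exp commutativeSemiring using (^-distrib-*)
  open import Relation.Binary.Reasoning.Setoid setoid

  boxSum-cong : ∀ r N {g g′ : Vec ℕ r → ℂ} → (∀ a → g a ≈ g′ a) → boxSum r N g ≈ boxSum r N g′
  boxSum-cong zero    N p = p []
  boxSum-cong (suc r) N p = ∑<-cong N λ m → boxSum-cong r N (p ∘ (m ∷_))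

  *-distribˡ-boxSum : ∀ r N z g → z * boxSum r N g ≈ boxSum r N (λ a → z * g a)
  *-distribˡ-boxSum zero    N z g = refl
  *-distribˡ-boxSum (suc r) N z g =
    trans (*-distribˡ-∑< N z (λ m → boxSum r N (g ∘ (m ∷_)))) (∑<-cong N λ m → *-distribˡ-boxSum r N z (g ∘ (m ∷_)))

  boxSum-∑<-comm : ∀ r N n (G : ℕ → Vec ℕ r → ℂ) →
    boxSum r N (λ a → ∑< n λ l → G l a) ≈ ∑< n λ l → boxSum r N (G l)
  boxSum-∑<-comm zero    N n G = refl
  boxSum-∑<-comm (suc r) N n G = trans
    (∑<-cong N λ m → boxSum-∑<-comm r N n (λ l → G l ∘ (m ∷_)))
    (∑-comm {N} {n} (λ m l → boxSum r N (G (toℕ l) ∘ (toℕ m ∷_))))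

  boxSum-∏ : ∀ r N u → boxSum r N (∏ u) ≈ ∑< N u ^ r
  boxSum-∏ zero    N u = refl
  boxSum-∏ (suc r) N u = begin
    ∑< N (λ m → boxSum r N (λ ms → u m * ∏ u ms))   ≈⟨ ∑<-cong N (λ m → *-distribˡ-boxSum r N (u m) (∏ u)) ⟨
    ∑< N (λ m → u m * boxSum r N (∏ u))             ≈⟨ *-distribʳ-∑< N _ u ⟨
    ∑< N u * boxSum r N (∏ u)                       ≈⟨ *-congˡ (boxSum-∏ r N u) ⟩
    ∑< N u ^ suc r                                  ∎

  ∏-*-^ : ∀ {r} u w (a : Vec ℕ r) → ∏ u a * w ^ Vec.sum a ≈ ∏ (λ j → u j * w ^ j) a
  ∏-*-^ u w []       = *-identityˡ 1#
  ∏-*-^ u w (m ∷ ms) = begin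
    (u m * ∏ u ms) * w ^ (m ℕ.+ Vec.sum ms)          ≈⟨ *-congˡ (^-homo-* w m _) ⟩
    (u m * ∏ u ms) * (w ^ m * w ^ Vec.sum ms)
      ≈⟨ solve 4 (λ a b c d → (a :* b) :* (c :* d) := (a :* c) :* (b :* d)) refl _ _ _ _ ⟩
    (u m * w ^ m) * (∏ u ms * w ^ Vec.sum ms)        ≈⟨ *-congˡ (∏-*-^ u w ms) ⟩
    ∏ (λ j → u j * w ^ j) (m ∷ ms)                   ∎

  ∏-1 : ∀ {r} (a : Vec ℕ r) → ∏ (const 1#) a ≈ 1#
  ∏-1 []       = refl
  ∏-1 (m ∷ ms) = trans (*-identityˡ _) (∏-1 ms)

  boxSum-∏-^ : ∀ r N u w → boxSum r N (λ a → ∏ u a * w ^ Vec.sum a) ≈ ∑< N (λ j → u j * w ^ j) ^ r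
  boxSum-∏-^ r N u w = trans (boxSum-cong r N (∏-*-^ u w)) (boxSum-∏ r N _)

  neg-^ : ∀ z n → (- z) ^ n ≈ (- 1#) ^ n * z ^ n
  neg-^ z n = trans (^-congˡ n (solve 1 (λ z → :- z := (:- con (+ 1)) :* z) refl z)) (^-distrib-* (- 1#) z n)

  neg-^-odd : ∀ z n → ¬ (2 ∣ n) → (- z) ^ n ≈ - (z ^ n)
  neg-^-odd z zero          odd = contradiction (divides 0 ≡.refl) odd
  neg-^-odd z (suc zero)    odd = solve 1 (λ z → (:- z) :* con (+ 1) := :- (z :* con (+ 1))) refl z
  neg-^-odd z (suc (suc n)) odd = begin
    - z * (- z * (- z) ^ n)   ≈⟨ *-congˡ (*-congˡ (neg-^-odd z n (λ { (divides k p) → odd (divides (suc k) (≡.cong (suc ∘ suc) p)) }))) ⟩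
    - z * (- z * - (z ^ n))   ≈⟨ solve 2 (λ z p → (:- z) :* ((:- z) :* (:- p)) := :- (z :* (z :* p))) refl z (z ^ n) ⟩
    - (z ^ suc (suc n))       ∎

  inv-inverseˡ : ∀ z (z≠0 : NonZeroᶜ z) → inv z z≠0 * z ≈ 1#
  inv-inverseˡ z z≠0 =
    ℝ.trans (ℝ.solve 3 (λ n a b → n ℝ.:* a ℝ.:* a ℝ.:- n ℝ.:* (ℝ.:- b) ℝ.:* b ℝ.:= n ℝ.:* (a ℝ.:* a ℝ.:+ b ℝ.:* b))
      ℝ.refl _ (re z) (im z)) (ℝ.recip-inverseˡ (normSq z) (ℝ.>⇒# z≠0)) ,
    ℝ.solve 3 (λ n a b → n ℝ.:* a ℝ.:* b ℝ.:+ n ℝ.:* (ℝ.:- b) ℝ.:* a ℝ.:= ℝ.con (+ 0)) ℝ.refl _ (re z) (im z)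

  inverse-unique : ∀ {z w a b} → z ≈ w → a * z ≈ 1# → b * w ≈ 1# → a ≈ b
  inverse-unique {z} {w} {a} {b} z≈w az≈1 bw≈1 = begin
    a              ≈⟨ *-identityʳ a ⟨
    a * 1#         ≈⟨ *-congˡ (trans (*-congˡ z≈w) bw≈1) ⟨
    a * (b * z)    ≈⟨ solve 3 (λ a b z → a :* (b :* z) := b :* (a :* z)) refl a b z ⟩
    b * (a * z)    ≈⟨ *-congˡ az≈1 ⟩
    b * 1#         ≈⟨ *-identityʳ b ⟩
    b              ∎

  -- Goes through the uniqueness of inverses, which covers different proofs of nonvanishing.
  inv-cong : ∀ {z w} (z≠0 : NonZeroᶜ z) (w≠0 : NonZeroᶜ w) → z ≈ w → inv z z≠0 ≈ inv w w≠0
  inv-cong z≠0 w≠0 z≈w = inverse-unique z≈w (inv-inverseˡ _ z≠0) (inv-inverseˡ _ w≠0)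

  ^-inverse : ∀ {a z} n → a * z ≈ 1# → a ^ n * z ^ n ≈ 1#
  ^-inverse {a} {z} n az≈1 = trans (sym (^-distrib-* a z n)) (trans (^-congˡ n az≈1) (1^ n))

  inv-^ : ∀ z n (z≠0 : NonZeroᶜ z) (z^n≠0 : NonZeroᶜ (z ^ n)) → inv (z ^ n) z^n≠0 ≈ inv z z≠0 ^ n
  inv-^ z n z≠0 z^n≠0 = inverse-unique refl (inv-inverseˡ _ z^n≠0) (^-inverse n (inv-inverseˡ z z≠0))

  /!≈* : ∀ z k → z /! k ≈ 1# /! k * z
  /!≈* z k = sym (trans (·-*-assoc _ 1# z) (·-congˡ (*-identityˡ z)))

  /!-cancel : ∀ {z w} k → z /! k ≈ w /! k → z ≈ w
  /!-cancel {z} {w} k p = begin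
    z                          ≈⟨ scale z ⟨
    ℝ.fromℕ (k !) · (z /! k)   ≈⟨ ·-congˡ p ⟩
    ℝ.fromℕ (k !) · (w /! k)   ≈⟨ scale w ⟩
    w                          ∎
    where
    scale : ∀ z → ℝ.fromℕ (k !) · (z /! k) ≈ z
    scale z = trans (sym (·-assoc _ _ z)) (trans
      (·-congʳ (ℝ.trans (ℝ.*-comm _ _) (ExpSeries.e-inverse 0# k))) (·-identity z))

  module _ {ψ : ℕ → ℂ} f .{{_ : NonZero f}} (periodic : ∀ m → ψ (m ℕ.+ f) ≈ ψ m) where

    open RealLimits R atTop
    open ComplexLimits R atTop
    open Sequences R

    -- With A N the N-th partial sum, w^f A N + A f = A (f + N) = A N + (terms of order w^N).
    geometric-lim : ∀ {w v} → ∣ w ∣< ℝ.1# → v * (1# - w ^ f) ≈ 1# →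
      Limᶜ (λ N → ∑< N λ j → ψ j * w ^ j) (v * ∑< f λ j → ψ j * w ^ j)
    geometric-lim {w} {v} ∣w∣<1 v-inverse = Limᶜ-cong (sym ∘ partial)
      (solve 2 (λ v a → v :* (a :+ (:- con (+ 0))) := v :* a) refl v (A f))
      (Limᶜ-* (Limᶜ-const v) (Limᶜ-+ (Limᶜ-const (A f)) (Limᶜ-neg
        (Limᶜ-bounded-*-null (proj₁ β-bounded) (proj₂ β-bounded) (Limᶜ-z^n w ∣w∣<1)))))
      where
      u : ℕ → ℂ
      u j = ψ j * w ^ j

      A : ℕ → ℂ
      A N = ∑< N u

      β : ℕ → ℂ
      β N = ∑< f λ j → ψ (N ℕ.+ j) * w ^ j

      -- β need not converge, but being periodic it is bounded, so its product with wᴺ tends to 0.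
      β-periodic : ∀ N → β (N ℕ.+ f) ≈ β N
      β-periodic N = ∑<-cong f {λ j → ψ (N ℕ.+ f ℕ.+ j) * w ^ j} {λ j → ψ (N ℕ.+ j) * w ^ j} λ j → *-congʳ
        (trans (reflexive (≡.cong ψ (swap N f j))) (periodic (N ℕ.+ j)))
        where
        swap : ∀ N f j → N ℕ.+ f ℕ.+ j ≡ N ℕ.+ j ℕ.+ f
        swap N f j = ≡.trans (ℕ.+-assoc N f j)
          (≡.trans (≡.cong (N ℕ.+_) (ℕ.+-comm f j)) (≡.sym (ℕ.+-assoc N j f)))

      β-bounded = periodic⇒bounded {β} f β-periodic

      tail : ∀ N → ∑< f (λ j → u (N ℕ.+ j)) ≈ β N * w ^ N
      tail N = trans
        (∑<-cong f λ j → trans (*-congˡ (^-homo-* w N j))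
          (solve 3 (λ a b c → a :* (b :* c) := (a :* c) :* b) refl (ψ (N ℕ.+ j)) (w ^ N) (w ^ j)))
        (sym (*-distribʳ-∑< f (w ^ N) (λ j → ψ (N ℕ.+ j) * w ^ j)))

      shift : ∀ N → ∑< N (λ j → u (f ℕ.+ j)) ≈ w ^ f * A N
      shift N = trans
        (∑<-cong N λ j → trans
          (*-cong (trans (reflexive (≡.cong ψ (ℕ.+-comm f j))) (periodic j)) (^-homo-* w f j))
          (solve 3 (λ a b c → a :* (b :* c) := b :* (a :* c)) refl _ _ _))
        (sym (*-distribˡ-∑< N (w ^ f) u))

      recurrence : ∀ N → A N + β N * w ^ N ≈ A f + w ^ f * A N
      recurrence N = begin
        A N + β N * w ^ N                       ≈⟨ +-congˡ (tail N) ⟨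
        A N + ∑< f (λ j → u (N ℕ.+ j))          ≈⟨ ∑<-homo-+ N f u ⟨
        A (N ℕ.+ f)                             ≡⟨ ≡.cong A (ℕ.+-comm N f) ⟩
        A (f ℕ.+ N)                             ≈⟨ ∑<-homo-+ f N u ⟩
        A f + ∑< N (λ j → u (f ℕ.+ j))          ≈⟨ +-congˡ (shift N) ⟩
        A f + w ^ f * A N                       ∎

      partial : ∀ N → A N ≈ v * (A f - β N * w ^ N)
      partial N = sym (begin
        v * (A f - β N * w ^ N)
          ≈⟨ solve 4 (λ v a b c → v :* (a :- b) := v :* ((a :+ c) :- b :- c)) refl v (A f) (β N * w ^ N) (w ^ f * A N) ⟩
        v * ((A f + w ^ f * A N) - β N * w ^ N - w ^ f * A N)
          ≈⟨ *-congˡ (+-congʳ (+-congʳ (recurrence N))) ⟨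
        v * ((A N + β N * w ^ N) - β N * w ^ N - w ^ f * A N)
          ≈⟨ solve 4 (λ v a b p → v :* ((a :+ b) :- b :- p :* a) := (v :* (con (+ 1) :- p)) :* a) refl v (A N) (β N * w ^ N) (w ^ f) ⟩
        (v * (1# - w ^ f)) * A N    ≈⟨ *-congʳ v-inverse ⟩
        1# * A N                    ≈⟨ *-identityˡ _ ⟩
        A N                         ∎)

-- Uniqueness of Abel sums

module AbelSums {c ℓ₁ ℓ₂} (R : CompleteOrderedField c ℓ₁ ℓ₂) where

  open QEuler R
  open ComplexLemmas R
  open BoxSums R
  open LeftOfOne R
  module N = ComplexLimits R atTop
  module S = ComplexLimits R leftOfOne
  open HasAbelSum

  -- Limits are unique twice: for each s the damped series determines `sumAt`, and these values
  -- determine the limit at 1.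
  HasAbelSum-unique : ∀ {r g g′ L L′} → (∀ m → g m ≈ g′ m) → HasAbelSum r g L → HasAbelSum r g′ L′ → L ≈ L′
  HasAbelSum-unique {r} {L = L} {L′} g≈g′ p p′ = S.Limᶜ-unique
    (S.∣∣<⇒Limᶜ {F = λ { (s , 0<s , s<1) → sumAt p s 0<s s<1 }} (limit p))
    (S.Limᶜ-cong {L = L′} (λ { (s , 0<s , s<1) → sym (sumAt-unique s 0<s s<1) }) refl
      (S.∣∣<⇒Limᶜ {F = λ { (s , 0<s , s<1) → sumAt p′ s 0<s s<1 }} (limit p′)))
    where
    sumAt-unique : ∀ s 0<s s<1 → sumAt p s 0<s s<1 ≈ sumAt p′ s 0<s s<1
    sumAt-unique s 0<s s<1 = N.Limᶜ-unique
      (N.∣∣<⇒Limᶜ {L = sumAt p s 0<s s<1} (hasSum p s 0<s s<1))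
      (N.Limᶜ-cong (λ N → boxSum-cong r N (λ m → ·-congˡ (sym (g≈g′ m)))) refl
        (N.∣∣<⇒Limᶜ {L = sumAt p′ s 0<s s<1} (hasSum p′ s 0<s s<1)))

  HasAbelSum-cong : ∀ {r g g′ L} → (∀ m → g m ≈ g′ m) → HasAbelSum r g L → HasAbelSum r g′ L
  HasAbelSum-cong {r} g≈g′ p = record
    { sumAt  = sumAt p
    ; hasSum = λ s 0<s s<1 → N.Limᶜ⇒∣∣<
        (N.Limᶜ-cong (λ N → boxSum-cong r N (λ m → ·-congˡ (g≈g′ m))) refl
          (N.∣∣<⇒Limᶜ {L = sumAt p s 0<s s<1} (hasSum p s 0<s s<1)))
    ; limit  = limit p
    }

-- Abel sums of the defining series

module EulerSums {c ℓ₁ ℓ₂} (R : CompleteOrderedField c ℓ₁ ℓ₂) where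

  open QEuler R
  open ComplexLemmas R
  open BoxSums R
  open AbelSums R
  open LeftOfOne R
  open Exponential R using (exp-cong; exp-homo-+; exp-fromℕ-·)
  open OrderedFieldLemmas R using (pos⇒∣∣<)
  open IntegerSolver ℂ-commutativeRing using (solve; _:=_; _:+_; _:*_; _:-_; :-_; con)
  open import Algebra.Properties.Semiring.Exp semiring using (^-congˡ; ^-assocʳ; ^-congʳ)
  open import Algebra.Properties.CommutativeSemiring.Exp commutativeSemiring using (^-distrib-*)
  open import Algebra.Properties.CommutativeSemiring.Binomial commutativeSemiring using (theorem)
  open import Algebra.Properties.Semiring.Mult semiring using (×-congʳ; ×-assoc-*)
  open import Relation.Binary.Reasoning.Setoid setoid

  [1-q]⁻¹ : Base → ℂ
  [1-q]⁻¹ B = inv (1# - q B) (1-≠0 (q B) (∣q∣<1 B))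

  Y : Base → ℕ → ℕ → ℂ
  Y B f l = inv (1# + q B ^ (l ℕ.* f)) (1+^≠0 (q B) (l ℕ.* f) (∣q∣<1 B))

  -- The last argument is the period in closed forms and the truncation N in partial sums.
  twisted : (ℕ → ℂ) → ℂ → ℕ → ℂ
  twisted ψ t f = ∑< f λ j → ψ j * (- t) ^ j

  -- The value of either kind of polynomial up to the factor [2]^r: ψ is χ with period f, or
  -- constantly 1 with period 1. The sum over a₁, ..., aᵣ appears as the r-th power of a single sum.
  closedForm : Base → ∀ r (f : ℕ) → (ℕ → ℂ) → ℝ → ℕ → ℂ
  closedForm B r f ψ x n = [1-q]⁻¹ B ^ n
    * ∑< (suc n) λ l → (n C l) ×ₙ ((- pow B x) ^ l * (Y B f l * twisted ψ (q B ^ l) f) ^ r)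

  pow-cong : ∀ B {x y} → x ℝ.≈ y → pow B x ≈ pow B y
  pow-cong B p = exp-cong (·-congʳ p)

  []-cong : ∀ B {x y} → x ℝ.≈ y → [ x ] B ≈ [ y ] B
  []-cong B p = *-congʳ (+-congˡ (-‿cong (pow-cong B p)))

  module _ (B : Base) (exp-log-q : exp (log-q B) ≈ q B) where

    pow-fromℕ : ∀ n → pow B (ℝ.fromℕ n) ≈ q B ^ n
    pow-fromℕ n = trans (exp-fromℕ-· n (log-q B)) (^-congˡ n exp-log-q)

    pow-+-fromℕ : ∀ x n → pow B (x ℝ.+ ℝ.fromℕ n) ≈ pow B x * q B ^ n
    pow-+-fromℕ x n = trans (exp-cong (·-distrib x _ (log-q B)))
      (trans (exp-homo-+ _ _) (*-congˡ (pow-fromℕ n)))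

    ^-flip : ∀ z l n → (z ^ n) ^ l ≈ (z ^ l) ^ n
    ^-flip z l n = trans (^-assocʳ z n l) (trans (^-congʳ z (ℕ.*-comm n l)) (sym (^-assocʳ z l n)))

    -- Reading 1 - q^(x + M) as (- q^x) q^M + 1 lets the binomial theorem produce the factor (-
    -- q^x)^l directly.
    bracket-^ : ∀ x M k → ([ x ℝ.+ ℝ.fromℕ M ] B) ^ k ≈
      (∑< (suc k) λ l → (k C l) ×ₙ (- pow B x) ^ l * (q B ^ l) ^ M) * [1-q]⁻¹ B ^ k
    bracket-^ x M k = trans (^-distrib-* _ _ k) (*-congʳ (begin
      (1# - pow B (x ℝ.+ ℝ.fromℕ M)) ^ k
        ≈⟨ ^-congˡ k (trans (+-congˡ (-‿cong (pow-+-fromℕ x M)))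
             (solve 2 (λ Q p → con (+ 1) :- Q :* p := (:- Q) :* p :+ con (+ 1)) refl (pow B x) (q B ^ M))) ⟩
      (- pow B x * q B ^ M + 1#) ^ k
        ≈⟨ theorem k _ _ ⟩
      ∑[ l ≤ k ] ((k C toℕ l) ×ₙ ((- pow B x * q B ^ M) ^ toℕ l * 1# ^ (k ℕ.∸ toℕ l)))
        ≈⟨ ∑<-cong (suc k) expand ⟩
      (∑< (suc k) λ l → (k C l) ×ₙ (- pow B x) ^ l * (q B ^ l) ^ M) ∎))
      where
      expand : ∀ l → (k C l) ×ₙ ((- pow B x * q B ^ M) ^ l * 1# ^ (k ℕ.∸ l)) ≈ (k C l) ×ₙ (- pow B x) ^ l * (q B ^ l) ^ M
      expand l = begin
        (k C l) ×ₙ ((- pow B x * q B ^ M) ^ l * 1# ^ (k ℕ.∸ l))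
          ≈⟨ ×-congʳ (k C l) (trans (*-congˡ (1^ (k ℕ.∸ l))) (*-identityʳ _)) ⟩
        (k C l) ×ₙ (- pow B x * q B ^ M) ^ l
          ≈⟨ ×-congʳ (k C l) (trans (^-distrib-* (- pow B x) (q B ^ M) l) (*-congˡ (^-flip (q B) l M))) ⟩
        (k C l) ×ₙ ((- pow B x) ^ l * (q B ^ l) ^ M)
          ≈⟨ ×-assoc-* (k C l) _ _ ⟨
        (k C l) ×ₙ (- pow B x) ^ l * (q B ^ l) ^ M ∎

    -- The coefficient of (q^l)^(m₁ + ⋯ + mᵣ) in [x + m₁ + ⋯ + mᵣ]^k / k!
    coefficient : ℝ → ℕ → ℕ → ℂ
    coefficient x k l = 1# /! k * ([1-q]⁻¹ B ^ k * (k C l) ×ₙ (- pow B x) ^ l)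

    -- Damping, sign and (q^l)^M are all M-th powers and merge into one. With M the sum of the
    -- indices and P the product of characters, each l then gives a product of one-variable terms.
    damped-term : ∀ s M P x k →
      (s ℝ.^ M) · (((- 1#) ^ M * P) * (([ x ℝ.+ ℝ.fromℕ M ] B) ^ k /! k)) ≈
      ∑< (suc k) λ l → coefficient x k l * (P * (- (ofReal s * q B ^ l)) ^ M)
    damped-term s M P x k = begin
      (s ℝ.^ M) · (((- 1#) ^ M * P) * (([ x ℝ.+ ℝ.fromℕ M ] B) ^ k /! k))
        ≈⟨ ofReal-* (s ℝ.^ M) D ⟨
      ofReal (s ℝ.^ M) * D
        ≈⟨ *-cong (ofReal-^ s M) (*-congˡ (trans (/!≈* _ k) (*-congˡ (bracket-^ x M k)))) ⟩
      ofReal s ^ M * (((- 1#) ^ M * P) * (1# /! k * (∑< (suc k) (λ l → K l * (q B ^ l) ^ M) * [1-q]⁻¹ B ^ k)))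
        ≈⟨ solve 6 (λ s n P e S v → s :* ((n :* P) :* (e :* (S :* v))) := (s :* (n :* P) :* e :* v) :* S) refl
             (ofReal s ^ M) ((- 1#) ^ M) P (1# /! k) (∑< (suc k) (λ l → K l * (q B ^ l) ^ M)) ([1-q]⁻¹ B ^ k) ⟩
      (ofReal s ^ M * ((- 1#) ^ M * P) * (1# /! k) * [1-q]⁻¹ B ^ k) * ∑< (suc k) (λ l → K l * (q B ^ l) ^ M)
        ≈⟨ *-distribˡ-∑< (suc k) _ (λ l → K l * (q B ^ l) ^ M) ⟩
      ∑< (suc k) (λ l → (ofReal s ^ M * ((- 1#) ^ M * P) * (1# /! k) * [1-q]⁻¹ B ^ k) * (K l * (q B ^ l) ^ M))
        ≈⟨ ∑<-cong (suc k) (λ l → trans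
             (solve 7 (λ s n P e v K p → (s :* (n :* P) :* e :* v) :* (K :* p) := (e :* (v :* K)) :* (P :* (n :* (s :* p)))) refl
               (ofReal s ^ M) ((- 1#) ^ M) P (1# /! k) ([1-q]⁻¹ B ^ k) (K l) ((q B ^ l) ^ M))
             (*-congˡ (*-congˡ (sym (trans (neg-^ _ M) (*-congˡ (^-distrib-* (ofReal s) (q B ^ l) M))))))) ⟩
      ∑< (suc k) (λ l → coefficient x k l * (P * (- (ofReal s * q B ^ l)) ^ M)) ∎
      where
      D : ℂ
      D = ((- 1#) ^ M * P) * (([ x ℝ.+ ℝ.fromℕ M ] B) ^ k /! k)

      K : ℕ → ℂ
      K l = (k C l) ×ₙ (- pow B x) ^ l

    module _ (f : ℕ) .{{_ : NonZero f}} (odd : ¬ (2 ∣ f))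
             {ψ : ℕ → ℂ} (periodic : ∀ m → ψ (m ℕ.+ f) ≈ ψ m) (r : ℕ) (x : ℝ) where

      ∣s∣<1 : ∀ {s} → ℝ.0# ℝ.< s → s ℝ.< ℝ.1# → ∣ ofReal s ∣< ℝ.1#
      ∣s∣<1 {s} 0<s s<1 = ℝ.<-respˡ-≈
        (ℝ.solve 1 (λ s → s ℝ.:* s ℝ.:= s ℝ.:* s ℝ.:+ ℝ.con (+ 0) ℝ.:* ℝ.con (+ 0)) ℝ.refl s)
        (proj₂ (ℝ.∣∣<-* (pos⇒∣∣< 0<s s<1) (pos⇒∣∣< 0<s s<1)))

      t : ℝ → ℕ → ℂ
      t s l = ofReal s * q B ^ l

      ∣∣<-resp-≈ : ∀ {z w b} → z ≈ w → ∣ z ∣< b → ∣ w ∣< b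
      ∣∣<-resp-≈ z≈w = ℝ.<-respˡ-≈ (ℝ.+-cong (ℝ.*-cong (re≈ z≈w) (re≈ z≈w)) (ℝ.*-cong (im≈ z≈w) (im≈ z≈w)))

      -- For l = 0 the power q^l is 1, and s alone brings the modulus below 1.
      ∣t∣<1 : ∀ {s} l → ℝ.0# ℝ.< s → s ℝ.< ℝ.1# → ∣ t s l ∣< ℝ.1#
      ∣t∣<1 {s} zero    0<s s<1 = ∣∣<-resp-≈ {ofReal s} (sym (*-identityʳ (ofReal s))) (∣s∣<1 0<s s<1)
      ∣t∣<1 {s} (suc l) 0<s s<1 = ∣∣<1-* (ofReal s) (q B ^ suc l) (∣s∣<1 0<s s<1) (∣∣<1-^ (q B) (suc l) (∣q∣<1 B))

      ∣-t∣<1 : ∀ {s} l → ℝ.0# ℝ.< s → s ℝ.< ℝ.1# → ∣ - t s l ∣< ℝ.1#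
      ∣-t∣<1 {s} l 0<s s<1 = ℝ.<-respˡ-≈
        (ℝ.solve 2 (λ a b → a ℝ.:* a ℝ.:+ b ℝ.:* b ℝ.:= (ℝ.:- a) ℝ.:* (ℝ.:- a) ℝ.:+ (ℝ.:- b) ℝ.:* (ℝ.:- b))
          ℝ.refl (re (t s l)) (im (t s l)))
        (∣t∣<1 l 0<s s<1)

      1+t^f≠0 : ∀ {s} l → ℝ.0# ℝ.< s → s ℝ.< ℝ.1# → NonZeroᶜ (1# + t s l ^ f)
      1+t^f≠0 {s} l 0<s s<1 = 1+≠0 (t s l ^ f) (∣∣<1-^ (t s l) f (∣t∣<1 l 0<s s<1))

      innerSum : ∀ l → UnitInterval → ℂ
      innerSum l (s , 0<s , s<1) = inv (1# + t s l ^ f) (1+t^f≠0 l 0<s s<1) * twisted ψ (t s l) f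

      -- Numerator and denominator are polynomials in s, and the limiting denominator 1 + q^(l f) is
      -- nonzero for every l.
      innerSum-lim : ∀ l → S.Limᶜ (innerSum l) (Y B f l * twisted ψ (q B ^ l) f)
      innerSum-lim l = S.Limᶜ-* inverse-lim (S.Limᶜ-sum {f} λ j →
          S.Limᶜ-* (S.Limᶜ-const (ψ (toℕ j))) (S.Limᶜ-^ (toℕ j) (S.Limᶜ-neg t-lim)))
        where
        open RealLimits R leftOfOne using (Lim-const)

        t-lim : S.Limᶜ (λ s → t (proj₁ s) l) (q B ^ l)
        t-lim = S.Limᶜ-cong (λ _ → refl) (*-identityˡ _)
          (S.Limᶜ-* {F = ofReal ∘ proj₁} {L = 1#} (Lim-identity S., Lim-const ℝ.0#) (S.Limᶜ-const (q B ^ l)))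

        inverse-lim = S.Limᶜ-inv (λ { (s , 0<s , s<1) → 1+t^f≠0 l 0<s s<1 }) (1+^≠0 (q B) (l ℕ.* f) (∣q∣<1 B))
          (S.Limᶜ-cong (λ _ → refl) (+-congˡ (^-assocʳ (q B) l f))
            (S.Limᶜ-+ (S.Limᶜ-const 1#) (S.Limᶜ-^ f t-lim)))

      innerSum-partial : ∀ l s 0<s s<1 → N.Limᶜ (λ N → twisted ψ (t s l) N) (innerSum l (s , 0<s , s<1))
      innerSum-partial l s 0<s s<1 = geometric-lim f periodic (∣-t∣<1 l 0<s s<1)
        -- With w = - t and f odd, 1 - w^f equals 1 + t^f, whose inverse is the factor in
        -- `innerSum`.
        (trans (*-congˡ (trans (+-congˡ (-‿cong (neg-^-odd (t s l) f odd)))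
            (solve 1 (λ p → con (+ 1) :- (:- p) := con (+ 1) :+ p) refl (t s l ^ f))))
          (inv-inverseˡ _ (1+t^f≠0 l 0<s s<1)))

      boxSum-damped : ∀ s N k →
        boxSum r N (λ m → (s ℝ.^ Vec.sum m) · (((- 1#) ^ Vec.sum m * ∏ ψ m)
          * (([ x ℝ.+ ℝ.fromℕ (Vec.sum m) ] B) ^ k /! k)))
        ≈ ∑< (suc k) λ l → coefficient x k l * twisted ψ (t s l) N ^ r
      boxSum-damped s N k = trans
        (boxSum-cong r N (λ m → damped-term s (Vec.sum m) (∏ ψ m) x k))
        (trans (boxSum-∑<-comm r N (suc k) (λ l m → coefficient x k l * (∏ ψ m * (- t s l) ^ Vec.sum m)))
          (∑<-cong (suc k) λ l → trans
            (sym (*-distribˡ-boxSum r N (coefficient x k l) (λ m → ∏ ψ m * (- t s l) ^ Vec.sum m)))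
            (*-congˡ (boxSum-∏-^ r N ψ (- t s l)))))

      closedForm-coefficient : ∀ k →
        ∑< (suc k) (λ l → coefficient x k l * (Y B f l * twisted ψ (q B ^ l) f) ^ r) ≈ closedForm B r f ψ x k /! k
      closedForm-coefficient k = sym (begin
        closedForm B r f ψ x k /! k         ≈⟨ /!≈* (closedForm B r f ψ x k) k ⟩
        1# /! k * ([1-q]⁻¹ B ^ k * ∑< (suc k) (λ l → (k C l) ×ₙ ((- pow B x) ^ l * Z l)))
          ≈⟨ *-assoc _ _ _ ⟨
        (1# /! k * [1-q]⁻¹ B ^ k) * ∑< (suc k) (λ l → (k C l) ×ₙ ((- pow B x) ^ l * Z l))
          ≈⟨ *-distribˡ-∑< (suc k) _ (λ l → (k C l) ×ₙ ((- pow B x) ^ l * Z l)) ⟩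
        ∑< (suc k) (λ l → (1# /! k * [1-q]⁻¹ B ^ k) * (k C l) ×ₙ ((- pow B x) ^ l * Z l))
          ≈⟨ ∑<-cong (suc k) (λ l → trans (*-congˡ (sym (×-assoc-* (k C l) ((- pow B x) ^ l) (Z l))))
               (solve 4 (λ a b c d → (a :* b) :* (c :* d) := (a :* (b :* c)) :* d) refl
                 (1# /! k) ([1-q]⁻¹ B ^ k) ((k C l) ×ₙ (- pow B x) ^ l) (Z l))) ⟩
        ∑< (suc k) (λ l → coefficient x k l * Z l) ∎)
        where
        Z : ℕ → ℂ
        Z l = (Y B f l * twisted ψ (q B ^ l) f) ^ r

      hasAbelSum : HasAbelSumₚ r
        (λ m → ((- 1#) ^ Vec.sum m * ∏ ψ m) *ₚ exp[ [ x ℝ.+ ℝ.fromℕ (Vec.sum m) ] B t])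
        (egf (closedForm B r f ψ x))
      hasAbelSum k = record
        { sumAt  = λ s 0<s s<1 → total (s , 0<s , s<1)
        ; hasSum = λ s 0<s s<1 → N.Limᶜ⇒∣∣<
            (N.Limᶜ-cong (λ N → sym (boxSum-damped s N k)) refl
              (N.Limᶜ-sum {suc k} λ l → N.Limᶜ-* (N.Limᶜ-const (coefficient x k (toℕ l)))
                (N.Limᶜ-^ r (innerSum-partial (toℕ l) s 0<s s<1))))
        ; limit  = S.Limᶜ⇒∣∣< {F = total}
            (S.Limᶜ-cong (λ _ → refl) (closedForm-coefficient k)
              (S.Limᶜ-sum {suc k} λ l → S.Limᶜ-* (S.Limᶜ-const (coefficient x k (toℕ l)))
                (S.Limᶜ-^ r (innerSum-lim (toℕ l)))))
        }
        where
        total : UnitInterval → ℂ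
        total s = ∑< (suc k) λ l → coefficient x k l * innerSum l s ^ r

      egf-scale : ∀ z F → z *ₚ egf F ≈ₚ egf (λ n → z * F n)
      egf-scale z F k = *-·-comm _ z (F k)

      -- The series g is given only up to pointwise equality because `IsEuler` writes its summand
      -- differently: x comes last in the bracket and there is no product of characters.
      closedForm-unique : ∀ {g G E} →
        (∀ m k → g m k ≈ (((- 1#) ^ Vec.sum m * ∏ ψ m) *ₚ exp[ [ x ℝ.+ ℝ.fromℕ (Vec.sum m) ] B t]) k) →
        HasAbelSumₚ r g G → ([2] B ^ r) *ₚ G ≈ₚ egf E → ∀ n → E n ≈ [2] B ^ r * closedForm B r f ψ x n
      closedForm-unique {G = G} {E} g≈ sums scaled n = /!-cancel n (begin
        E n /! n                                          ≈⟨ scaled n ⟨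
        [2] B ^ r * G n                                   ≈⟨ *-congˡ (HasAbelSum-unique (λ m → g≈ m n) (sums n) (hasAbelSum n)) ⟩
        [2] B ^ r * (closedForm B r f ψ x n /! n)         ≈⟨ egf-scale _ (closedForm B r f ψ x) n ⟩
        ([2] B ^ r * closedForm B r f ψ x n) /! n         ∎)

-- The two identities

module EulerPolynomials {c ℓ₁ ℓ₂} (R : CompleteOrderedField c ℓ₁ ℓ₂) where

  open QEuler R
  open ComplexLemmas R
  open BoxSums R
  open AbelSums R
  open EulerSums R
  open Exponential R using (exp-cong)
  open IntegerSolver ℂ-commutativeRing using (solve; _:=_; _:+_; _:*_; _:-_; :-_; con)
  open import Algebra.Properties.Semiring.Exp semiring using (^-congˡ; ^-assocʳ; ^-congʳ)
  open import Algebra.Properties.CommutativeSemiring.Exp commutativeSemiring using (^-distrib-*)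
  open import Algebra.Properties.Semiring.Mult semiring using (×-congʳ; ×-assoc-*)
  open import Relation.Binary.Reasoning.Setoid setoid

  module _ (B : Base) (exp-log-q : exp (log-q B) ≈ q B) (r : ℕ) (y : ℝ) where

    2∤1 : ¬ (2 ∣ 1)
    2∤1 2∣1 with ∣1⇒≡1 2∣1
    ... | ()

    euler : ℕ → ℂ
    euler = closedForm B r 1 (const 1#) y

    summand≈ : ∀ (m : Vec ℕ r) k →
      (((- 1#) ^ Vec.sum m) *ₚ exp[ [ ℝ.fromℕ (Vec.sum m) ℝ.+ y ] B t]) k ≈
      (((- 1#) ^ Vec.sum m * ∏ (const 1#) m) *ₚ exp[ [ y ℝ.+ ℝ.fromℕ (Vec.sum m) ] B t]) k
    summand≈ m k = *-cong
      (sym (trans (*-congˡ (∏-1 m)) (*-identityʳ _)))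
      (·-congˡ (^-congˡ k ([]-cong B (ℝ.+-comm _ _))))

    euler-isEuler : IsEuler B r y (λ n → [2] B ^ r * euler n)
    euler-isEuler = egf euler ,
      (λ k → HasAbelSum-cong (λ m → sym (summand≈ m k))
        (hasAbelSum B exp-log-q 1 2∤1 {const 1#} (λ _ → refl) r y k)) ,
      egf-scale B exp-log-q 1 2∤1 {const 1#} (λ _ → refl) r y ([2] B ^ r) euler

    isEuler-unique : ∀ {E} → IsEuler B r y E → ∀ n → E n ≈ [2] B ^ r * euler n
    isEuler-unique (G , sums , scaled) =
      closedForm-unique B exp-log-q 1 2∤1 {const 1#} (λ _ → refl) r y summand≈ sums scaled

  module _ (B : Base) (exp-log-q : exp (log-q B) ≈ q B) (r : ℕ)
           (x : ℝ) (f : ℕ) .{{_ : NonZero f}} (odd : ¬ (2 ∣ f)) (χ : ℤ → ℂ)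
           (periodic : ∀ m → χ (+ (m ℕ.+ f)) ≈ χ (+ m)) where

    private
      ψ : ℕ → ℂ
      ψ j = χ (+ j)

      v = [1-q]⁻¹ B

    generalized : ℕ → ℂ
    generalized = closedForm B r f ψ x

    generalized-isGeneralizedEuler : IsGeneralizedEuler B r χ x (λ n → [2] B ^ r * generalized n)
    generalized-isGeneralizedEuler = egf generalized ,
      hasAbelSum B exp-log-q f odd periodic r x ,
      egf-scale B exp-log-q f odd periodic r x ([2] B ^ r) generalized

    isGeneralizedEuler-unique : ∀ {E} → IsGeneralizedEuler B r χ x E → ∀ n → E n ≈ [2] B ^ r * generalized n
    isGeneralizedEuler-unique (G , sums , scaled) =
      closedForm-unique B exp-log-q f odd periodic r x (λ _ _ → refl) sums scaled

    numerator : ℕ → Vec ℕ r → ℂ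
    numerator l a = ∏ ψ a * (- (q B ^ l)) ^ Vec.sum a

    box : ℕ → ℂ
    box l = boxSum r f (numerator l)

    twisted-^ : ∀ l → (Y B f l * twisted ψ (q B ^ l) f) ^ r ≈ Y B f l ^ r * box l
    twisted-^ l = trans (^-distrib-* _ _ r) (*-congˡ (sym (boxSum-∏-^ r f ψ (- (q B ^ l)))))

    -- The form in which the two identities meet: the second moves the denominators into the box
    -- sum, the first is reached by expanding every Euler polynomial.
    generalized-box : ∀ n → generalized n ≈
      v ^ n * ∑< (suc n) λ l → (n C l) ×ₙ ((- pow B x) ^ l * (Y B f l ^ r * box l))
    generalized-box n = *-congˡ (∑<-cong (suc n) λ l → ×-congʳ (n C l) (*-congˡ {(- pow B x) ^ l} (twisted-^ l)))

    fraction : ℕ → Vec ℕ r → ℂ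
    fraction l a = numerator l a / (1# + q B ^ (l ℕ.* f)) ^ r
      [ NonZeroᶜ-^ (1# + q B ^ (l ℕ.* f)) r (1+^≠0 (q B) (l ℕ.* f) (∣q∣<1 B)) ]

    identity₂ : ∀ n →
      [2] B ^ r * generalized n ≈
      [2] B ^ r / (1# - q B) ^ n [ NonZeroᶜ-^ (1# - q B) n (1-≠0 (q B) (∣q∣<1 B)) ]
        * ∑[ l ≤ n ] ((n C toℕ l) ×ₙ ((- pow B x) ^ toℕ l * boxSum r f (fraction (toℕ l))))
    identity₂ n = begin
      [2] B ^ r * generalized n
        ≈⟨ *-congˡ (generalized-box n) ⟩
      [2] B ^ r * (v ^ n * ∑< (suc n) λ l → (n C l) ×ₙ ((- pow B x) ^ l * (Y B f l ^ r * box l)))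
        ≈⟨ *-assoc _ _ _ ⟨
      ([2] B ^ r * v ^ n) * (∑< (suc n) λ l → (n C l) ×ₙ ((- pow B x) ^ l * (Y B f l ^ r * box l)))
        ≈⟨ *-cong
             (*-congˡ (sym (inv-^ (1# - q B) n (1-≠0 (q B) (∣q∣<1 B)) (NonZeroᶜ-^ (1# - q B) n (1-≠0 (q B) (∣q∣<1 B))))))
             (∑<-cong (suc n) λ l → ×-congʳ (n C l) (*-congˡ {(- pow B x) ^ l} (divide l))) ⟩
      _ ∎
      where
      divide : ∀ l → Y B f l ^ r * box l ≈ boxSum r f (fraction l)
      divide l = trans
        (*-distribˡ-boxSum r f (Y B f l ^ r) (numerator l))
        (boxSum-cong r f λ a → trans (*-comm _ _) (*-congˡ {numerator l a} (sym (inv-^ D r D≠0 (NonZeroᶜ-^ D r D≠0)))))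
        where
        D = 1# + q B ^ (l ℕ.* f)
        D≠0 = 1+^≠0 (q B) (l ℕ.* f) (∣q∣<1 B)

    formula₂ : ∀ {Eχ} → IsGeneralizedEuler B r χ x Eχ → ∀ n → Eχ n ≈
      [2] B ^ r / (1# - q B) ^ n [ NonZeroᶜ-^ (1# - q B) n (1-≠0 (q B) (∣q∣<1 B)) ]
        * ∑[ l ≤ n ] ((n C toℕ l) ×ₙ ((- pow B x) ^ toℕ l * boxSum r f (fraction (toℕ l))))
    formula₂ isEχ n = trans (isGeneralizedEuler-unique isEχ n) (identity₂ n)

    scaledBracket : NonZeroᶜ (1# - q B ^ f) → ℝ → ℂ
    scaledBracket p z = (1# - exp (z · ℝ.fromℕ f · log-q B)) * inv (1# - q B ^ f) p

    -- IsEuler (B ^ᵇ f) with the proof that 1 - q^f is nonzero left arbitrary: comparing two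
    -- such proofs would make Agda unfold them completely.
    IsScaledEuler : NonZeroᶜ (1# - q B ^ f) → ℝ → (ℕ → ℂ) → Set (c ⊔ ℓ₁ ⊔ ℓ₂)
    IsScaledEuler p y E = ∃ λ G →
      HasAbelSumₚ r (λ m → ((- 1#) ^ Vec.sum m) *ₚ exp[ scaledBracket p (ℝ.fromℕ (Vec.sum m) ℝ.+ y) t]) G
      × ((1# + q B ^ f) ^ r) *ₚ G ≈ₚ egf E

    -- `Bᶠ` is `B ^ᵇ f` seen only through these two equations, so that its proof of |q^f| < 1 stays
    -- opaque.
    module _ (Bᶠ : Base) (qᶠ≈ : q Bᶠ ≈ q B ^ f) (log-qᶠ≈ : log-q Bᶠ ≈ ℝ.fromℕ f · log-q B) where

      exp-log-qᶠ : exp (log-q Bᶠ) ≈ q Bᶠ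
      exp-log-qᶠ = trans (exp-cong log-qᶠ≈) (trans (pow-fromℕ B exp-log-q f) (sym qᶠ≈))

      -- With period 1 the twisted sum is its single term 1, and (q^f)^l = q^(l f).
      Y≈ : ∀ l → Y Bᶠ 1 l * twisted (const 1#) (q Bᶠ ^ l) 1 ≈ Y B f l
      Y≈ l = trans
        (*-cong
          (inv-cong _ _ (+-congˡ (trans (^-congʳ (q Bᶠ) (ℕ.*-identityʳ l))
            (trans (^-congˡ l qᶠ≈) (trans (^-assocʳ (q B) f l) (^-congʳ (q B) (ℕ.*-comm f l)))))))
          (solve 0 (con (+ 1) :* con (+ 1) :+ con (+ 0) := con (+ 1)) refl))
        (*-identityʳ _)

      -- The logarithm of the new base is f log q, which cancels the division by f.
      pow-scaled : ∀ a → pow Bᶠ ((x ℝ.+ ℝ.fromℕ a) /ʳ f) ≈ pow B x * q B ^ a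
      pow-scaled a = trans
        (exp-cong (trans (·-congˡ log-qᶠ≈) (sym (·-assoc (y /ʳ f) (ℝ.fromℕ f) (log-q B)))))
        (trans (pow-cong B cancel) (pow-+-fromℕ B exp-log-q x a))
        where
        y : ℝ
        y = x ℝ.+ ℝ.fromℕ a

        cancel : y /ʳ f ℝ.* ℝ.fromℕ f ℝ.≈ y
        cancel = ℝ.trans (ℝ.*-assoc _ _ _)
          (ℝ.trans (ℝ.*-congˡ (ℝ.recip-inverseˡ (ℝ.fromℕ f) (ℝ.fromℕ#0 f))) (ℝ.*-identityʳ y))

      coefficient-scaled : ∀ a l →
        (- pow Bᶠ ((x ℝ.+ ℝ.fromℕ a) /ʳ f)) ^ l ≈ (- pow B x) ^ l * (q B ^ l) ^ a
      coefficient-scaled a l = begin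
        (- pow Bᶠ ((x ℝ.+ ℝ.fromℕ a) /ʳ f)) ^ l    ≈⟨ ^-congˡ l (-‿cong (pow-scaled a)) ⟩
        (- (pow B x * q B ^ a)) ^ l
          ≈⟨ ^-congˡ l (solve 2 (λ Q p → :- (Q :* p) := (:- Q) :* p) refl (pow B x) (q B ^ a)) ⟩
        (- pow B x * q B ^ a) ^ l                  ≈⟨ ^-distrib-* _ _ l ⟩
        (- pow B x) ^ l * (q B ^ a) ^ l            ≈⟨ *-congˡ (^-flip B exp-log-q (q B) l a) ⟩
        (- pow B x) ^ l * (q B ^ l) ^ a            ∎

      vᶠ = [1-q]⁻¹ Bᶠ

      -- After expansion, a enters each polynomial only through (q^l)^(a₁ + ⋯ + aᵣ). Together with
      -- the characters and the sign this is `numerator`, and the two summations can be exchanged.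
      box-euler : ∀ n →
        (∑[ a <[ f ]^ r ] (∏ ψ a * (- 1#) ^ Vec.sum a
           * ([2] Bᶠ ^ r * closedForm Bᶠ r 1 (const 1#) ((x ℝ.+ ℝ.fromℕ (Vec.sum a)) /ʳ f) n)))
        ≈ ([2] Bᶠ ^ r * vᶠ ^ n) * ∑< (suc n) λ l → (n C l) ×ₙ ((- pow B x) ^ l * (Y B f l ^ r * box l))
      box-euler n = begin
        boxSum r f (λ a → ∏ ψ a * (- 1#) ^ Vec.sum a
           * ([2] Bᶠ ^ r * closedForm Bᶠ r 1 (const 1#) ((x ℝ.+ ℝ.fromℕ (Vec.sum a)) /ʳ f) n))
          ≈⟨ boxSum-cong r f expand ⟩
        boxSum r f (λ a → W * ∑< (suc n) (λ l → K l * numerator l a))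
          ≈⟨ *-distribˡ-boxSum r f W (λ a → ∑< (suc n) (λ l → K l * numerator l a)) ⟨
        W * boxSum r f (λ a → ∑< (suc n) (λ l → K l * numerator l a))
          ≈⟨ *-congˡ (boxSum-∑<-comm r f (suc n) (λ l a → K l * numerator l a)) ⟩
        W * ∑< (suc n) (λ l → boxSum r f (λ a → K l * numerator l a))
          ≈⟨ *-congˡ (∑<-cong (suc n) collect) ⟩
        W * ∑< (suc n) (λ l → (n C l) ×ₙ ((- pow B x) ^ l * (Y B f l ^ r * box l))) ∎
        where
        W : ℂ
        W = [2] Bᶠ ^ r * vᶠ ^ n

        K : ℕ → ℂ
        K l = (n C l) ×ₙ ((- pow B x) ^ l * Y B f l ^ r)

        collect : ∀ l → boxSum r f (λ a → K l * numerator l a) ≈ (n C l) ×ₙ ((- pow B x) ^ l * (Y B f l ^ r * box l))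
        collect l = trans (sym (*-distribˡ-boxSum r f (K l) (numerator l)))
          (trans (×-assoc-* (n C l) _ _) (×-congʳ (n C l) (*-assoc _ _ _)))

        expand : ∀ a → ∏ ψ a * (- 1#) ^ Vec.sum a
           * ([2] Bᶠ ^ r * closedForm Bᶠ r 1 (const 1#) ((x ℝ.+ ℝ.fromℕ (Vec.sum a)) /ʳ f) n)
           ≈ W * ∑< (suc n) (λ l → K l * numerator l a)
        expand a = begin
          P * s * ([2] Bᶠ ^ r * (vᶠ ^ n * ∑< (suc n) H))
            ≈⟨ solve 5 (λ P s t v S → P :* s :* (t :* (v :* S)) := (t :* v) :* ((P :* s) :* S)) refl
                 P s ([2] Bᶠ ^ r) (vᶠ ^ n) (∑< (suc n) H) ⟩
          W * ((P * s) * ∑< (suc n) H)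
            ≈⟨ *-congˡ (*-distribˡ-∑< (suc n) (P * s) H) ⟩
          W * ∑< (suc n) (λ l → (P * s) * H l)
            ≈⟨ *-congˡ (∑<-cong (suc n) summand) ⟩
          W * ∑< (suc n) (λ l → K l * numerator l a) ∎
          where
          M = Vec.sum a

          P s : ℂ
          P = ∏ ψ a
          s = (- 1#) ^ M

          H : ℕ → ℂ
          H l = (n C l) ×ₙ ((- pow Bᶠ ((x ℝ.+ ℝ.fromℕ M) /ʳ f)) ^ l
                  * (Y Bᶠ 1 l * twisted (const 1#) (q Bᶠ ^ l) 1) ^ r)

          summand : ∀ l → (P * s) * H l ≈ K l * numerator l a
          summand l = begin
            (P * s) * H l
              ≈⟨ *-congˡ (×-congʳ (n C l) (*-cong (coefficient-scaled M l) (^-congˡ r (Y≈ l)))) ⟩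
            (P * s) * (n C l) ×ₙ (((- pow B x) ^ l * (q B ^ l) ^ M) * Y B f l ^ r)
              ≈⟨ *-congˡ (×-congʳ (n C l) (solve 3 (λ a b c → (a :* b) :* c := (a :* c) :* b) refl
                   ((- pow B x) ^ l) ((q B ^ l) ^ M) (Y B f l ^ r))) ⟩
            (P * s) * (n C l) ×ₙ (((- pow B x) ^ l * Y B f l ^ r) * (q B ^ l) ^ M)
              ≈⟨ *-congˡ (×-assoc-* (n C l) _ _) ⟨
            (P * s) * (K l * (q B ^ l) ^ M)
              ≈⟨ solve 4 (λ P s K p → (P :* s) :* (K :* p) := K :* (P :* (s :* p))) refl P s (K l) ((q B ^ l) ^ M) ⟩
            K l * (P * (s * (q B ^ l) ^ M))
              ≈⟨ *-congˡ (*-congˡ (neg-^ (q B ^ l) M)) ⟨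
            K l * numerator l a ∎

      -- [f]_q = (1 - q^f) / (1 - q) trades the inverses of 1 - q^f for inverses of 1 - q, while the
      -- powers of [2] for the base q^f cancel.
      prefactor : ∀ n →
        (([ ℝ.fromℕ f ] B) ^ n * ([2] B / [2] Bᶠ [ [2]≠0 Bᶠ ]) ^ r) * ([2] Bᶠ ^ r * vᶠ ^ n) ≈ [2] B ^ r * v ^ n
      prefactor n = begin
        (([ ℝ.fromℕ f ] B) ^ n * ([2] B * inv₂) ^ r) * ([2] Bᶠ ^ r * vᶠ ^ n)
          ≈⟨ *-congʳ (*-cong
               (trans (^-congˡ n (*-congʳ (+-congˡ (-‿cong (trans (pow-fromℕ B exp-log-q f) (sym qᶠ≈)))))) (^-distrib-* _ v n))
               (^-distrib-* ([2] B) inv₂ r)) ⟩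
        (((1# - q Bᶠ) ^ n * v ^ n) * ([2] B ^ r * inv₂ ^ r)) * ([2] Bᶠ ^ r * vᶠ ^ n)
          ≈⟨ solve 6 (λ d v t i u w → ((d :* v) :* (t :* i)) :* (u :* w) := (t :* v) :* ((i :* u) :* (w :* d))) refl
               ((1# - q Bᶠ) ^ n) (v ^ n) ([2] B ^ r) (inv₂ ^ r) ([2] Bᶠ ^ r) (vᶠ ^ n) ⟩
        ([2] B ^ r * v ^ n) * ((inv₂ ^ r * [2] Bᶠ ^ r) * (vᶠ ^ n * (1# - q Bᶠ) ^ n))
          ≈⟨ *-congˡ (*-cong (^-inverse r (inv-inverseˡ _ ([2]≠0 Bᶠ)))
               (^-inverse n (inv-inverseˡ _ (1-≠0 (q Bᶠ) (∣q∣<1 Bᶠ))))) ⟩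
        ([2] B ^ r * v ^ n) * (1# * 1#)
          ≈⟨ trans (*-congˡ (*-identityˡ 1#)) (*-identityʳ _) ⟩
        [2] B ^ r * v ^ n ∎
        where
        inv₂ : ℂ
        inv₂ = inv ([2] Bᶠ) ([2]≠0 Bᶠ)

      identity₁ : ∀ n →
        [2] B ^ r * generalized n ≈
        ([ ℝ.fromℕ f ] B) ^ n * ([2] B / [2] Bᶠ [ [2]≠0 Bᶠ ]) ^ r
          * (∑[ a <[ f ]^ r ] (∏ ψ a * (- 1#) ^ Vec.sum a
               * ([2] Bᶠ ^ r * closedForm Bᶠ r 1 (const 1#) ((x ℝ.+ ℝ.fromℕ (Vec.sum a)) /ʳ f) n)))
      identity₁ n = sym (begin
        _ ≈⟨ *-congˡ (box-euler n) ⟩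
        _ ≈⟨ *-assoc _ _ _ ⟨
        _ ≈⟨ *-congʳ (prefactor n) ⟩
        _ ≈⟨ *-assoc _ _ _ ⟩
        _ ≈⟨ *-congˡ (generalized-box n) ⟨
        [2] B ^ r * generalized n ∎)

      scaled-bracket : (p : NonZeroᶜ (1# - q B ^ f)) → ∀ z →
        (1# - exp (z · ℝ.fromℕ f · log-q B)) * inv (1# - q B ^ f) p ≈ [ z ] Bᶠ
      scaled-bracket p z = *-cong
        (+-congˡ (-‿cong (exp-cong (·-congˡ (sym log-qᶠ≈)))))
        (inv-cong p (1-≠0 (q Bᶠ) (∣q∣<1 Bᶠ)) (+-congˡ (-‿cong (sym qᶠ≈))))

      scaled-summand : (p : NonZeroᶜ (1# - q B ^ f)) → ∀ y (m : Vec ℕ r) k →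
        (((- 1#) ^ Vec.sum m) *ₚ exp[ scaledBracket p (ℝ.fromℕ (Vec.sum m) ℝ.+ y) t]) k ≈
        (((- 1#) ^ Vec.sum m) *ₚ exp[ [ ℝ.fromℕ (Vec.sum m) ℝ.+ y ] Bᶠ t]) k
      scaled-summand p y m k = *-congˡ (·-congˡ (^-congˡ k (scaled-bracket p _)))

      [2]ᶠ≈ : 1# + q B ^ f ≈ [2] Bᶠ
      [2]ᶠ≈ = +-congˡ (sym qᶠ≈)

      toIsEuler : ∀ {p y E} → IsScaledEuler p y E → IsEuler Bᶠ r y E
      toIsEuler {p} {y} (G , sums , scaled) = G ,
        (λ k → HasAbelSum-cong (λ m → scaled-summand p y m k) (sums k)) ,
        (λ k → trans (*-congʳ (^-congˡ r (sym [2]ᶠ≈))) (scaled k))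

      fromIsEuler : ∀ {p y E} → IsEuler Bᶠ r y E → IsScaledEuler p y E
      fromIsEuler {p} {y} (G , sums , scaled) = G ,
        (λ k → HasAbelSum-cong (λ m → sym (scaled-summand p y m k)) (sums k)) ,
        (λ k → trans (*-congʳ (^-congˡ r [2]ᶠ≈)) (scaled k))

      isScaledEuler-abstract : ∀ p y → ∃ λ E → IsScaledEuler p y E
      isScaledEuler-abstract p y = E , fromIsEuler {p} {y} {E} (euler-isEuler Bᶠ exp-log-qᶠ r y)
        where
        E : ℕ → ℂ
        E n = [2] Bᶠ ^ r * euler Bᶠ exp-log-qᶠ r y n

      formula₁-abstract : ∀ {p p′ Eχ} {E : ℝ → ℕ → ℂ} → IsGeneralizedEuler B r χ x Eχ → (∀ y → IsScaledEuler p y (E y)) →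
        ∀ n → Eχ n ≈
        ([ ℝ.fromℕ f ] B) ^ n * ([2] B / (1# + q B ^ f) [ p′ ]) ^ r
          * (∑[ a <[ f ]^ r ] (∏ ψ a * (- 1#) ^ Vec.sum a * E ((x ℝ.+ ℝ.fromℕ (Vec.sum a)) /ʳ f) n))
      formula₁-abstract {p} {p′} {Eχ} {E} isEχ isE n = begin
        Eχ n                        ≈⟨ isGeneralizedEuler-unique isEχ n ⟩
        [2] B ^ r * generalized n   ≈⟨ identity₁ n ⟩
        _                           ≈⟨ *-cong
          (*-congˡ (^-congˡ r (*-congˡ (inv-cong ([2]≠0 Bᶠ) p′ (sym [2]ᶠ≈)))))
          (boxSum-cong r f λ a → *-congˡ {∏ ψ a * (- 1#) ^ Vec.sum a} (sym (isEuler-unique′ (y a)))) ⟩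
        _                           ∎
        where
        y : Vec ℕ r → ℝ
        y a = (x ℝ.+ ℝ.fromℕ (Vec.sum a)) /ʳ f

        isEuler-unique′ : ∀ y → E y n ≈ [2] Bᶠ ^ r * closedForm Bᶠ r 1 (const 1#) y n
        isEuler-unique′ y = isEuler-unique Bᶠ exp-log-qᶠ r y (toIsEuler (isE y)) n

    isScaledEuler : ∀ p y → ∃ λ E → IsScaledEuler p y E
    isScaledEuler = isScaledEuler-abstract (B ^ᵇ f) refl refl

    formula₁ : ∀ {p p′ Eχ} {E : ℝ → ℕ → ℂ} → IsGeneralizedEuler B r χ x Eχ → (∀ y → IsScaledEuler p y (E y)) →
      ∀ n → Eχ n ≈
      ([ ℝ.fromℕ f ] B) ^ n * ([2] B / (1# + q B ^ f) [ p′ ]) ^ r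
        * (∑[ a <[ f ]^ r ] (∏ ψ a * (- 1#) ^ Vec.sum a * E ((x ℝ.+ ℝ.fromℕ (Vec.sum a)) /ʳ f) n))
    formula₁ {p} {p′} {Eχ} {E} = formula₁-abstract (B ^ᵇ f) refl refl {p} {p′} {Eχ} {E}

theorem5 :
  ∀ {c ℓ₁ ℓ₂} (R : CompleteOrderedField c ℓ₁ ℓ₂) → let open QEuler R hiding (sum) in
  (B : Base) → exp (log-q B) ≈ q B →
  (r : ℕ) .{{_ : NonZero r}} →
  (x : ℝ) → (∀ k → ¬ (x ℝ.≈ ℝ.- ℝ.fromℕ k)) →
  (f : ℕ) .{{_ : NonZero f}} → ¬ (2 ∣ f) →
  (X : DirichletCharacter f) → let open DirichletCharacter X in
  HasConductor f →
  -- the polynomials are well defined ...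
  (∃ λ Eχ → IsGeneralizedEuler B r χ x Eχ)
  × (∀ y → ∃ λ E → IsEuler (B ^ᵇ f) r y E)
  -- ... and satisfy the two identities
  × (∀ Eχ (E : ℝ → ℕ → ℂ) →
      IsGeneralizedEuler B r χ x Eχ →
      (∀ y → IsEuler (B ^ᵇ f) r y (E y)) →
      ∀ n →
      (Eχ n ≈ ([ ℝ.fromℕ f ] B) ^ n
            * ([2] B / [2] (B ^ᵇ f) [ [2]≠0 (B ^ᵇ f) ]) ^ r
            * (∑[ a <[ f ]^ r ]
                 (∏ (λ j → χ (+ j)) a * (- 1#) ^ sum a
                   * E ((x ℝ.+ ℝ.fromℕ (sum a)) /ʳ f) n)))
      × (Eχ n ≈ ([2] B) ^ r / (1# - q B) ^ n [ NonZeroᶜ-^ (1# - q B) n (1-≠0 (q B) (∣q∣<1 B)) ]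
            * (∑[ l ≤ n ]
                 ((n C toℕ l) ×ₙ
                   ((- pow B x) ^ toℕ l
                     * (∑[ a <[ f ]^ r ]
                          ((∏ (λ j → χ (+ j)) a * (- (q B ^ toℕ l)) ^ sum a)
                            / (1# + q B ^ (toℕ l ℕ.* f)) ^ r
                              [ NonZeroᶜ-^ (1# + q B ^ (toℕ l ℕ.* f)) r (1+^≠0 (q B) (toℕ l ℕ.* f) (∣q∣<1 B)) ])))))))
theorem5 R B exp-log-q r x _ f odd X _ =
  (_ , generalized-isGeneralizedEuler B exp-log-q r x f odd χ χ-periodic) ,
  -- For the proof of nonvanishing carried by `B ^ᵇ f`, `IsScaledEuler` unfolds to
  -- `IsEuler (B ^ᵇ f)`.
  (λ y → isScaledEuler B exp-log-q r x f odd χ χ-periodic _ y) ,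
  λ Eχ E isEχ isE n →
    formula₁ B exp-log-q r x f odd χ χ-periodic {_} {_} {Eχ} {E} isEχ isE n ,
    formula₂ B exp-log-q r x f odd χ χ-periodic {Eχ} isEχ n
  where
  open QEuler R hiding (sum)
  open EulerPolynomials R
  open DirichletCharacter X

  χ-periodic : ∀ m → χ (+ (m ℕ.+ f)) ≈ χ (+ m)
  χ-periodic m = periodic (+ m)
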